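{- Let $(G,\sigma)$ be a connection graph with $d$-dimensional signature $\sigma$, let $1\le\rho\le d$ be the dimension of the kernel of $\mathcal{L}^\sigma$, and let $\tau$ be the absolutely inconsistent component of $\sigma$, i.e. a $(d-\rho)$-dimensional signature with $\mathcal{L}^\tau$ invertible and $\sigma\cong(\bigoplus_{l=1}^{\rho}\iota^1)\oplus\tau$. Then for distinct $i,j\in V$, $$r^\sigma_{ij}=\frac{\rho}{d}\,r_{ij}+\frac{1}{2d}\operatorname{Tr}\Big((\mathcal{C}^\tau_{ii})^{ -1}+(\mathcal{C}^\tau_{jj})^{ -1}\Big).$$
   Context: $G=(V,E,W)$ finite connected weighted graph, $V=\{1,\dots,n\}$, $w_{xy}>0$ iff $\{x,y\}\in E$, $\deg(x)=\sum_yw_{xy}$. A $d$-dimensional signature maps oriented edges to $\mathsf{O}(d)$ with $\sigma_{yx}=\sigma_{xy}^{\mathrm T}$. Connection Laplacian $\mathcal{L}^\sigma$: $nd\times nd$ block matrix with blocks $\deg(x)I_d$ on the diagonal, $-w_{xy}\sigma_{xy}$ for $x\sim y$, $0$ otherwise. $\sigma\cong\tau'$ means there is $f:V\to\mathsf{O}(d)$ with $f(x)\sigma_{xy}=\tau'_{xy}f(y)$; $\oplus$ is edgewise block-diagonal sum; $\iota^1$ is the $1$-dimensional signature identically $1$. For $M=\begin{bmatrix}A&B\\C&D\end{bmatrix}$, $M/D=A-BD^\dagger C$; conductance matrix $\mathcal{C}^\tau(i,j)=\mathcal{L}^\tau/\mathcal{L}^\tau_{\{i,j\}^c,\{i,j\}^c}$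 with diagonal blocks $\mathcal{C}^\tau_{ii},\mathcal{C}^\tau_{jj}$. $r_{ij}=(e_i-e_j)^{\mathrm T}L^\dagger(e_i-e_j)$ with $L=D-W$ the graph Laplacian. $\Omega^0_{ij}=\mathbb{E}[\prod_{\ell=1}^{T^0_j}\sigma_{X_{\ell-1}X_\ell}\mid X_0=i]$ for the simple random walk with transition probabilities $w_{xy}/\deg(x)$, $T^0_j=\inf\{t\ge0:X_t=j\}$. $N_{ij}$: $nd\times d$ block column with $I_d$ at node $i$, $-(\Omega^0_{ij})^{\mathrm T}$ at node $j$, $0$ elsewhere; $\mathcal{W}_{i\to j}=(\mathcal{L}^\sigma)^\dagger N_{ij}$. Connection effective resistance: $r^\sigma_{ij}=\frac{1}{2d}\operatorname{Tr}\big(\mathcal{W}_{i\to j}^{\mathrm T}\mathcal{L}^\sigma\mathcal{W}_{i\to j}+\mathcal{W}_{j\to i}^{\mathrm T}\mathcal{L}^\sigma\mathcal{W}_{j\to i}\big)$. (If $\rho=d$, $\tau$ is $0$-dimensional and its trace term is $0$.) -}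

module Defs where

open import Algebra.Bundles using (CommutativeRing)
import Algebra.Definitions.RawMonoid as RawMonoidOps
import Algebra.Properties.Semiring.Sum as SemiringSum
open import Data.Bool.Base using (Bool; if_then_else_; not; _∧_)
open import Data.Fin.Base using (Fin; zero; suc; toℕ; splitAt; quotient; remainder; combine)
import Data.Fin.Properties as Fin
open import Data.List.Base using (List; []; _∷_; length; lookup; filter; allFin)
open import Data.Nat.Base as ℕ using (ℕ; zero; suc)
open import Data.Product.Base using (Σ; ∃; ∃-syntax; _×_; _,_; proj₁)
open import Data.Sum.Base using (inj₁; inj₂)
open import Data.Vec.Base using (Vec; []; _∷_)
open import Function.Bundles using (_⇔_)
open import Level using (Level; 0ℓ; _⊔_) renaming (suc to lsuc)
open import Relation.Binary.Construct.Closure.ReflexiveTransitive using (Star)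
open import Relation.Binary.Core using (Rel)
open import Relation.Binary.Structures using (IsStrictTotalOrder)
open import Relation.Nullary.Decidable using (yes; no; ⌊_⌋; _×-dec_; ¬?)
open import Relation.Nullary.Negation using (¬_)

-- The real numbers, axiomatised classically as a Cauchy-complete Archimedean
-- totally ordered field.  These axioms determine ℝ up to a unique isomorphism.
record Reals c ℓ₁ ℓ₂ : Set (lsuc (c ⊔ ℓ₁ ⊔ ℓ₂)) where
  field
    commutativeRing : CommutativeRing c ℓ₁

  open CommutativeRing commutativeRing public

  infix 4 _<_
  field
    _<_                : Rel Carrier ℓ₂
    isStrictTotalOrder : IsStrictTotalOrder _≈_ _<_
    0<1                : 0# < 1#
    +-monoˡ-<          : ∀ z {x y} → x < y → x + z < y + z
    *-pos              : ∀ {x y} → 0# < x → 0# < y → 0# < x * y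
    inverse            : ∀ {x} → ¬ (x ≈ 0#) → ∃[ y ] x * y ≈ 1#

  fromℕ : ℕ → Carrier
  fromℕ n = RawMonoidOps._×_ +-rawMonoid n 1#

  ∣_-_∣<_ : Carrier → Carrier → Carrier → Set ℓ₂
  ∣ x - y ∣< ε = (x - y < ε) × (y - x < ε)

  IsCauchy : (ℕ → Carrier) → Set (c ⊔ ℓ₂)
  IsCauchy a = ∀ ε → 0# < ε → ∃[ N ] (∀ p q → N ℕ.≤ p → N ℕ.≤ q → ∣ a p - a q ∣< ε)

  ConvergesTo : (ℕ → Carrier) → Carrier → Set (c ⊔ ℓ₂)
  ConvergesTo a l = ∀ ε → 0# < ε → ∃[ N ] (∀ p → N ℕ.≤ p → ∣ a p - l ∣< ε)

  field
    archimedean : ∀ x → ∃[ n ] x < fromℕ n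
    complete    : ∀ a → IsCauchy a → ∃[ l ] ConvergesTo a l

module Over {c ℓ₁ ℓ₂} (𝓡 : Reals c ℓ₁ ℓ₂) where

  open Reals 𝓡 public
    renaming (Carrier to ℝ; zero to *-zero) hiding (commutativeRing; isStrictTotalOrder)
  open IsStrictTotalOrder (Reals.isStrictTotalOrder 𝓡) using (_≟_)
  open SemiringSum semiring using (sum)

  -- Total, with the convention 0⁻¹ = 0.
  infix 9 _⁻¹
  _⁻¹ : ℝ → ℝ
  x ⁻¹ with x ≟ 0#
  ... | yes _  = 0#
  ... | no x≉0 = proj₁ (inverse x≉0)

  ----------------------------------------------------------------------
  -- Matrices

  Vector : ℕ → Set c
  Vector m = Fin m → ℝ

  Matrix : ℕ → ℕ → Set c
  Matrix m n = Fin m → Fin n → ℝ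

  infix 4 _≈ᴹ_
  _≈ᴹ_ : ∀ {m n} → Matrix m n → Matrix m n → Set ℓ₁
  A ≈ᴹ B = ∀ a b → A a b ≈ B a b

  infixl 6 _+ᴹ_ _-ᴹ_
  infixl 7 _*ᴹ_ _*ᵛ_ _∙_
  infixr 7 _•ᴹ_
  infix  9 _ᵀ

  _+ᴹ_ _-ᴹ_ : ∀ {m n} → Matrix m n → Matrix m n → Matrix m n
  (A +ᴹ B) a b = A a b + B a b
  (A -ᴹ B) a b = A a b - B a b

  -ᴹ_ : ∀ {m n} → Matrix m n → Matrix m n
  (-ᴹ A) a b = - A a b

  _•ᴹ_ : ∀ {m n} → ℝ → Matrix m n → Matrix m n
  (s •ᴹ A) a b = s * A a b

  _*ᴹ_ : ∀ {m n p} → Matrix m n → Matrix n p → Matrix m p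
  (A *ᴹ B) a b = sum λ k → A a k * B k b

  _*ᵛ_ : ∀ {m n} → Matrix m n → Vector n → Vector m
  (A *ᵛ v) a = sum λ k → A a k * v k

  _∙_ : ∀ {n} → Vector n → Vector n → ℝ
  u ∙ v = sum λ k → u k * v k

  _ᵀ : ∀ {m n} → Matrix m n → Matrix n m
  (A ᵀ) a b = A b a

  Tr : ∀ {n} → Matrix n n → ℝ
  Tr A = sum λ a → A a a

  0ᴹ : ∀ {m n} → Matrix m n
  0ᴹ _ _ = 0#

  I : ∀ {n} → Matrix n n
  I a b = if ⌊ a Fin.≟ b ⌋ then 1# else 0#

  e : ∀ {n} → Fin n → Vector n
  e = I

  IsOrthogonal : ∀ {n} → Matrix n n → Set ℓ₁
  IsOrthogonal A = (A ᵀ *ᴹ A ≈ᴹ I) × (A *ᴹ A ᵀ ≈ᴹ I)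

  IsInverse : ∀ {n} → Matrix n n → Matrix n n → Set ℓ₁
  IsInverse A B = (A *ᴹ B ≈ᴹ I) × (B *ᴹ A ≈ᴹ I)

  Invertible : ∀ {n} → Matrix n n → Set (c ⊔ ℓ₁)
  Invertible A = ∃[ B ] IsInverse A B

  -- P is the Moore–Penrose pseudoinverse A†, which these equations determine
  -- uniquely.
  record IsPseudoinverse {m n} (A : Matrix m n) (P : Matrix n m) : Set ℓ₁ where
    field
      APA≈A   : A *ᴹ P *ᴹ A ≈ᴹ A
      PAP≈P   : P *ᴹ A *ᴹ P ≈ᴹ P
      AP-symm : (A *ᴹ P) ᵀ ≈ᴹ A *ᴹ P
      PA-symm : (P *ᴹ A) ᵀ ≈ᴹ P *ᴹ A

  -- S is the generalised Schur complement M/D = A - B D† C of M = [A B; C D].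
  IsSchurComplement : ∀ {p q} → Matrix p p → Matrix p q → Matrix q p → Matrix q q →
                      Matrix p p → Set (c ⊔ ℓ₁)
  IsSchurComplement A B C D S = ∃[ D† ]
    IsPseudoinverse D D† × S ≈ᴹ A -ᴹ B *ᴹ D† *ᴹ C

  -- ker A has dimension r: it has a basis of r vectors.
  record KernelHasDimension {m n} (A : Matrix m n) (r : ℕ) : Set (c ⊔ ℓ₁) where
    field
      basis       : Fin r → Vector n
      inKernel    : ∀ k a → (A *ᵛ basis k) a ≈ 0#
      independent : ∀ (t : Vector r) →
                    (∀ a → sum (λ k → t k * basis k a) ≈ 0#) → ∀ k → t k ≈ 0#
      spanning    : ∀ (v : Vector n) → (∀ a → (A *ᵛ v) a ≈ 0#) →
                    Σ (Vector r) λ t → ∀ a → v a ≈ sum (λ k → t k * basis k a)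

  -- A (p·a) × (q·b) matrix is viewed as a p × q array of a × b blocks.
  fromBlocks : ∀ {p q a b} → (Fin p → Fin q → Matrix a b) → Matrix (p ℕ.* a) (q ℕ.* b)
  fromBlocks {p} {q} {a} {b} B r s =
    B (quotient a r) (quotient b s) (remainder {p} a r) (remainder {q} b s)

  fromBlockColumn : ∀ {p a b} → (Fin p → Matrix a b) → Matrix (p ℕ.* a) b
  fromBlockColumn {p} {a} B r s = B (quotient a r) (remainder {p} a r) s

  block : ∀ {p q a b} → Matrix (p ℕ.* a) (q ℕ.* b) → Fin p → Fin q → Matrix a b
  block M x y k l = M (combine x k) (combine y l)

  -- M_{X,Y}: the block rows listed in X and the block columns listed in Y.
  submatrix : ∀ {n d} → Matrix (n ℕ.* d) (n ℕ.* d) → (X Y : List (Fin n)) →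
              Matrix (length X ℕ.* d) (length Y ℕ.* d)
  submatrix M X Y = fromBlocks λ k l → block M (lookup X k) (lookup Y l)

  infixr 6 _⊕ᴹ_
  _⊕ᴹ_ : ∀ {p q} → Matrix p p → Matrix q q → Matrix (p ℕ.+ q) (p ℕ.+ q)
  _⊕ᴹ_ {p} A B r s with splitAt p r | splitAt p s
  ... | inj₁ a | inj₁ b = A a b
  ... | inj₂ a | inj₂ b = B a b
  ... | inj₁ _ | inj₂ _ = 0#
  ... | inj₂ _ | inj₁ _ = 0#

  ----------------------------------------------------------------------
  -- Weighted graphs and signatures

  record WeightedGraph (n : ℕ) : Set (lsuc 0ℓ ⊔ c ⊔ ℓ₁ ⊔ ℓ₂) where
    field
      Edge        : Rel (Fin n) 0ℓ
      w           : Fin n → Fin n → ℝ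
      w-sym       : ∀ x y → w x y ≈ w y x
      w-nonneg    : ∀ x y → ¬ (w x y < 0#)
      w-pos⇔edge  : ∀ x y → (0# < w x y) ⇔ Edge x y
      irreflexive : ∀ x → ¬ Edge x x
      connected   : ∀ x y → Star Edge x y

    deg : Fin n → ℝ
    deg x = sum (w x)

  -- Values at pairs that are not edges are irrelevant: below they only ever
  -- occur multiplied by the weight of the pair, which is zero.
  Signature : ℕ → ℕ → Set c
  Signature n d = Fin n → Fin n → Matrix d d

  ι¹ : ∀ {n} → Signature n 1
  ι¹ _ _ = I

  infixr 6 _⊕_
  _⊕_ : ∀ {n p q} → Signature n p → Signature n q → Signature n (p ℕ.+ q)
  (σ ⊕ τ) x y = σ x y ⊕ᴹ τ x y

  ⨁ι¹ : ∀ {n} (r : ℕ) → Signature n r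
  ⨁ι¹ zero    _ _ ()
  ⨁ι¹ (suc r) = ι¹ ⊕ ⨁ι¹ r

  module _ {n : ℕ} (G : WeightedGraph n) where
    open WeightedGraph G

    IsSignature : ∀ {d} → Signature n d → Set ℓ₁
    IsSignature σ = ∀ x y → Edge x y → IsOrthogonal (σ x y) × (σ y x ≈ᴹ (σ x y) ᵀ)

    _≅_ : ∀ {d} → Signature n d → Signature n d → Set (c ⊔ ℓ₁)
    _≅_ {d} σ τ = Σ (Fin n → Matrix d d) λ f →
      (∀ x → IsOrthogonal (f x)) ×
      (∀ x y → Edge x y → f x *ᴹ σ x y ≈ᴹ τ x y *ᴹ f y)

    graphLaplacian : Matrix n n
    graphLaplacian x y = (if ⌊ x Fin.≟ y ⌋ then deg x else 0#) - w x y

    connectionLaplacian : ∀ {d} → Signature n d → Matrix (n ℕ.* d) (n ℕ.* d)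
    connectionLaplacian σ = fromBlocks λ x y →
      if ⌊ x Fin.≟ y ⌋ then deg x •ᴹ I else -ᴹ (w x y •ᴹ σ x y)

    IsEffectiveResistance : (i j : Fin n) → ℝ → Set (c ⊔ ℓ₁)
    IsEffectiveResistance i j r = ∃[ L† ]
      IsPseudoinverse graphLaplacian L† × r ≈ eᵢ-eⱼ ∙ (L† *ᵛ eᵢ-eⱼ)
      where
      eᵢ-eⱼ : Vector n
      eᵢ-eⱼ x = e i x - e j x

    --------------------------------------------------------------------
    -- Conductance matrices

    complement : (i j : Fin n) → List (Fin n)
    complement i j = filter (λ x → ¬? (x Fin.≟ i) ×-dec ¬? (x Fin.≟ j)) (allFin n)

    -- The blocks of C are indexed by zero (for i) and suc zero (for j).
    IsConductance : ∀ {d} → Signature n d → (i j : Fin n) →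
                    Matrix (2 ℕ.* d) (2 ℕ.* d) → Set (c ⊔ ℓ₁)
    IsConductance {d} τ i j C =
      IsSchurComplement (𝓛 S S) (𝓛 S Sᶜ) (𝓛 Sᶜ S) (𝓛 Sᶜ Sᶜ) C
      where
      S Sᶜ : List (Fin n)
      S  = i ∷ j ∷ []
      Sᶜ = complement i j
      𝓛 : (X Y : List (Fin n)) → Matrix (length X ℕ.* d) (length Y ℕ.* d)
      𝓛 = submatrix (connectionLaplacian τ)

    --------------------------------------------------------------------
    -- Random walk.  A trajectory X₀ = i, X₁, …, X_t is given by i and the
    -- vector of the t later positions.

    transition : Fin n → Fin n → ℝ
    transition x y = w x y * deg x ⁻¹

    probability : ∀ {t} → Fin n → Vec (Fin n) t → ℝ
    probability _ []      = 1#
    probability x (y ∷ p) = transition x y * probability y p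

    signatureProduct : ∀ {d t} → Signature n d → Fin n → Vec (Fin n) t → Matrix d d
    signatureProduct σ _ []      = I
    signatureProduct σ x (y ∷ p) = σ x y *ᴹ signatureProduct σ y p

    -- Whether T⁰ⱼ = t, i.e. the final position is the first one equal to j.
    hitsFirstAtEnd : ∀ {t} → Fin n → Fin n → Vec (Fin n) t → Bool
    hitsFirstAtEnd j x []      = ⌊ x Fin.≟ j ⌋
    hitsFirstAtEnd j x (y ∷ p) = not ⌊ x Fin.≟ j ⌋ ∧ hitsFirstAtEnd j y p

    sumOverPaths : ∀ t → (Vec (Fin n) t → ℝ) → ℝ
    sumOverPaths zero    g = g []
    sumOverPaths (suc t) g = sum λ y → sumOverPaths t λ p → g (y ∷ p)

    -- E[ 1{T⁰ⱼ = t} · ∏_{1≤ℓ≤t} σ_{X_{ℓ-1}X_ℓ} | X₀ = i ]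
    hittingTerm : ∀ {d} → Signature n d → (i j : Fin n) → ℕ → Matrix d d
    hittingTerm σ i j t a b = sumOverPaths t λ p →
      if hitsFirstAtEnd j i p then probability i p * signatureProduct σ i p a b else 0#

    -- Ω = Ω⁰ᵢⱼ.  Since T⁰ⱼ is almost surely finite and the product has entries
    -- bounded by 1, its expectation is the sum over all t of the terms above.
    IsΩ⁰ : ∀ {d} → Signature n d → (i j : Fin n) → Matrix d d → Set (c ⊔ ℓ₂)
    IsΩ⁰ σ i j Ω = ∀ a b →
      ConvergesTo (λ m → sum {m} λ t → hittingTerm σ i j (toℕ t) a b) (Ω a b)

    --------------------------------------------------------------------
    -- Connection effective resistance

    N : ∀ {d} (i j : Fin n) (Ωᵢⱼ : Matrix d d) → Matrix (n ℕ.* d) d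
    N i j Ωᵢⱼ = fromBlockColumn λ x →
      if ⌊ x Fin.≟ i ⌋ then I else
      if ⌊ x Fin.≟ j ⌋ then -ᴹ (Ωᵢⱼ ᵀ) else 0ᴹ

    IsConnectionEffectiveResistance : ∀ {d} → Signature n d → (i j : Fin n) →
                                      ℝ → Set (c ⊔ ℓ₁ ⊔ ℓ₂)
    IsConnectionEffectiveResistance {d} σ i j r =
      ∃[ 𝓛† ] ∃[ Ωᵢⱼ ] ∃[ Ωⱼᵢ ]
        IsPseudoinverse 𝓛 𝓛† × IsΩ⁰ σ i j Ωᵢⱼ × IsΩ⁰ σ j i Ωⱼᵢ ×
        r ≈ fromℕ (2 ℕ.* d) ⁻¹ *
            Tr (energy (𝓛† *ᴹ N i j Ωᵢⱼ) +ᴹ energy (𝓛† *ᴹ N j i Ωⱼᵢ))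
      where
      𝓛 : Matrix (n ℕ.* d) (n ℕ.* d)
      𝓛 = connectionLaplacian σ
      energy : Matrix (n ℕ.* d) d → Matrix d d
      energy 𝓦 = 𝓦 ᵀ *ᴹ 𝓛 *ᴹ 𝓦

{-# OPTIONS --safe #-}

-- Let Δ be the connection Laplacian acting on sections V → ℝᵈ.  If u solves Δu = δᵢ c off j with u(j) = 0,
-- then pairing Δu with the σ-harmonic extension of the boundary values at j, whose value at i is Ω⁰ᵢⱼ, gives
-- Δu = Nᵢⱼ c.  Hence Tr(𝓦ᵀ𝓛𝓦) = Tr(Nᵀ𝓛†N) is the trace at (i,i) of the Green function grounded at j.  This
-- trace is invariant under gauge transformations and additive over ⊕; for ι¹ it is rᵢⱼ, and for τ the Green
-- function at (i,i) is the inverse of the Schur complement block 𝒞ᵢᵢ.  The Dirichlet problem is solvable since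
-- the energy Σ w |u(x) - σ u(y)|² vanishes only on parallel sections, which are determined by one value.
-- The series for Ω⁰ converges to the harmonic extension because the squared error is subharmonic for the
-- random walk, and the expected hitting time of j bounds the rate at which it is absorbed.

module Submission where

open import Defs
open import Algebra.Bundles using (CommutativeRing)
import Algebra.Properties.AbelianGroup as AbelianGroupProperties
import Algebra.Properties.Monoid.Mult as MonoidMultiples
import Algebra.Properties.Ring as RingProperties
import Algebra.Properties.Semiring.Mult.TCOptimised as Multiples
import Algebra.Properties.Semiring.Sum as SemiringSum
import Algebra.Solver.Ring as RingSolver
open import Algebra.Solver.Ring.AlmostCommutativeRing using (fromCommutativeRing; _-Raw-AlmostCommutative⟶_)
open import Data.Bool.Base using (if_then_else_; true; false; not; _∧_)
open import Data.Fin.Base using (Fin; zero; suc; combine; quotient; remainder; _↑ˡ_; _↑ʳ_; toℕ; splitAt; join)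
import Data.Fin.Properties as Fin
open import Data.Integer.Base as ℤ using (ℤ; +_; -[1+_]; _⊖_; _◃_)
import Data.Integer.Properties as ℤ
open import Data.List.Base using (List; []; _∷_; filter; allFin; length; lookup)
open import Data.List.Membership.Propositional.Properties using (∈-filter⁺; ∈-filter⁻; ∈-allFin; ∈-lookup)
import Data.List.Relation.Unary.All as All
import Data.List.Relation.Unary.AllPairs as AllPairs
import Data.List.Relation.Unary.Any as Any
open import Data.List.Relation.Unary.Any.Properties using (lookup-index)
open import Data.List.Relation.Unary.Unique.Propositional using (Unique)
import Data.List.Relation.Unary.Unique.Propositional.Properties as Unique
open import Data.Maybe.Base using (Maybe; just; nothing)
open import Data.Nat.Base as ℕ using (ℕ; zero; suc)
import Data.Nat.Properties as ℕ
open import Data.Product.Base using (Σ; ∃; ∃-syntax; _×_; _,_; proj₁; proj₂)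
import Data.Sign.Base as Sign
open import Data.Sum.Base using (_⊎_; inj₁; inj₂)
open import Data.Vec.Base using (Vec; []; _∷_)
open import Function.Bundles using (Equivalence)
open import Level using (_⊔_)
open import Relation.Binary.Bundles using (Setoid)
open import Relation.Binary.Construct.Closure.ReflexiveTransitive using (Star; ε; _◅_)
import Relation.Binary.Construct.StrictToNonStrict as NonStrict
open import Relation.Binary.Definitions using (tri<; tri≈; tri>)
open import Relation.Binary.PropositionalEquality.Core as ≡ using (_≡_; _≢_)
import Relation.Binary.Reasoning.Base.Triple as TripleReasoning
import Relation.Binary.Reasoning.Setoid as SetoidReasoning
open import Relation.Binary.Structures using (IsStrictTotalOrder)
open import Relation.Nullary.Decidable.Core using (yes; no; ⌊_⌋; ¬?; _×-dec_)
open import Relation.Nullary.Negation.Core using (¬_; contradiction)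
open import Relation.Unary using (Decidable)

-- The two sides of the formula belong to different matrices: `𝓛†` for σ, a Schur complement for τ,
-- a scalar pseudoinverse for the graph. They meet in the Green function grounded at one vertex
-- because it is characterised by pointwise equations, so that a gauged family or a block sum of
-- families can be checked directly to be a Green function again. Grounding at j also explains why
-- only the diagonal block 𝒞ᵢᵢ appears: the value at j is zero, so the off-diagonal blocks of the
-- two-vertex Schur complement never act on it. Exchanging i and j gives the other trace, and the
-- two copies of ρ rᵢⱼ turn 1/(2d) into ρ/d. All existence statements rest on one fact: a matrix
-- whose quadratic form has no nonzero null vector can be solved by Gaussian elimination without row
-- exchanges. It yields the Dirichlet solutions, the inverse of the eliminated block, the
-- pseudoinverses once the kernel is filled in, and, for ι¹ with source `deg`, the hitting time that
-- controls the convergence of Ω⁰.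

-- Integer coefficients let the ring solver decide cancellation over an arbitrary commutative ring.
module IntegerCoefficients {c ℓ} (R : CommutativeRing c ℓ) where
  open CommutativeRing R
  open Multiples semiring using (×1-homo-*; ×-homo-+; 1+×) renaming (_×_ to _×′_)
  open RingProperties ring using (-0#≈0#; -‿distribˡ-*; -‿distribʳ-*; -‿involutive; -‿+-comm)
  open SetoidReasoning setoid

  -- These multiples are the variant in which one copy of `1#` is `1#` definitionally, so that
  -- `con (ℤ.+ 1)` in a solver equation reads as `1#`.
  ⟦_⟧ᶻ : ℤ → Carrier
  ⟦ + n ⟧ᶻ      = n ×′ 1#
  ⟦ -[1+ n ] ⟧ᶻ = - (suc n ×′ 1#)

  ⟦⟧-⊖ : ∀ m n → ⟦ m ⊖ n ⟧ᶻ ≈ m ×′ 1# - n ×′ 1#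
  ⟦⟧-⊖ m zero = begin
    m ×′ 1#       ≈⟨ +-identityʳ _ ⟨
    m ×′ 1# + 0#  ≈⟨ +-congˡ -0#≈0# ⟨
    m ×′ 1# - 0#  ∎
  ⟦⟧-⊖ zero (suc n) = sym (+-identityˡ _)
  ⟦⟧-⊖ (suc m) (suc n) = begin
    ⟦ suc m ⊖ suc n ⟧ᶻ                  ≡⟨ ≡.cong ⟦_⟧ᶻ (ℤ.[1+m]⊖[1+n]≡m⊖n m n) ⟩
    ⟦ m ⊖ n ⟧ᶻ                          ≈⟨ ⟦⟧-⊖ m n ⟩
    a - b                               ≈⟨ +-congʳ (+-identityʳ a) ⟨
    a + 0# - b                          ≈⟨ +-congʳ (+-congˡ (-‿inverseʳ 1#)) ⟨
    a + (1# - 1#) - b                   ≈⟨ +-congʳ (+-assoc a 1# (- 1#)) ⟨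
    a + 1# - 1# - b                     ≈⟨ +-assoc _ _ _ ⟩
    a + 1# + (- 1# - b)                 ≈⟨ +-cong (+-comm a 1#) (-‿+-comm 1# b) ⟩
    (1# + a) - (1# + b)                 ≈⟨ +-cong (1+× m 1#) (-‿cong (1+× n 1#)) ⟨
    suc m ×′ 1# - suc n ×′ 1#           ∎
    where
    a = m ×′ 1#
    b = n ×′ 1#

  ⟦⟧-homo-+ : ∀ x y → ⟦ x ℤ.+ y ⟧ᶻ ≈ ⟦ x ⟧ᶻ + ⟦ y ⟧ᶻ
  ⟦⟧-homo-+ (+ m)      (+ n)      = ×-homo-+ 1# m n
  ⟦⟧-homo-+ (+ m)      -[1+ n ]   = ⟦⟧-⊖ m (suc n)
  ⟦⟧-homo-+ -[1+ m ]   (+ n)      = trans (⟦⟧-⊖ n (suc m)) (+-comm _ _)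
  ⟦⟧-homo-+ -[1+ m ]   -[1+ n ]   = begin
    - (suc (suc (m ℕ.+ n)) ×′ 1#)      ≈⟨ -‿cong (1+× (suc m ℕ.+ n) 1#) ⟩
    - (1# + (suc m ℕ.+ n) ×′ 1#)       ≈⟨ -‿cong (+-congˡ (×-homo-+ 1# (suc m) n)) ⟩
    - (1# + (suc m ×′ 1# + n ×′ 1#))   ≈⟨ -‿cong (trans (sym (+-assoc _ _ _)) (trans (+-congʳ (+-comm _ _)) (+-assoc _ _ _))) ⟩
    - (suc m ×′ 1# + (1# + n ×′ 1#))   ≈⟨ -‿cong (+-congˡ (1+× n 1#)) ⟨
    - (suc m ×′ 1# + suc n ×′ 1#)      ≈⟨ -‿+-comm _ _ ⟨
    - (suc m ×′ 1#) - suc n ×′ 1#      ∎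

  ⟦⟧-+◃ : ∀ n → ⟦ Sign.+ ◃ n ⟧ᶻ ≈ n ×′ 1#
  ⟦⟧-+◃ zero    = refl
  ⟦⟧-+◃ (suc n) = refl

  ⟦⟧--◃ : ∀ n → ⟦ Sign.- ◃ n ⟧ᶻ ≈ - (n ×′ 1#)
  ⟦⟧--◃ zero    = sym -0#≈0#
  ⟦⟧--◃ (suc n) = refl

  ⟦⟧-homo-* : ∀ x y → ⟦ x ℤ.* y ⟧ᶻ ≈ ⟦ x ⟧ᶻ * ⟦ y ⟧ᶻ
  ⟦⟧-homo-* (+ m)      (+ n)      = trans (⟦⟧-+◃ (m ℕ.* n)) (×1-homo-* m n)
  ⟦⟧-homo-* (+ m)      -[1+ n ]   =
    trans (⟦⟧--◃ (m ℕ.* suc n)) (trans (-‿cong (×1-homo-* m (suc n))) (-‿distribʳ-* _ _))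
  ⟦⟧-homo-* -[1+ m ]   (+ n)      =
    trans (⟦⟧--◃ (suc m ℕ.* n)) (trans (-‿cong (×1-homo-* (suc m) n)) (-‿distribˡ-* _ _))
  ⟦⟧-homo-* -[1+ m ]   -[1+ n ]   = begin
    (suc m ℕ.* suc n) ×′ 1#            ≈⟨ ×1-homo-* (suc m) (suc n) ⟩
    (suc m ×′ 1#) * (suc n ×′ 1#)      ≈⟨ -‿involutive _ ⟨
    - - ((suc m ×′ 1#) * (suc n ×′ 1#)) ≈⟨ -‿cong (-‿distribˡ-* _ _) ⟩
    - (- (suc m ×′ 1#) * (suc n ×′ 1#)) ≈⟨ -‿distribʳ-* _ _ ⟩
    - (suc m ×′ 1#) * - (suc n ×′ 1#)  ∎

  ⟦⟧-homo-- : ∀ x → ⟦ ℤ.- x ⟧ᶻ ≈ - ⟦ x ⟧ᶻ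
  ⟦⟧-homo-- (+ zero)  = sym -0#≈0#
  ⟦⟧-homo-- (+ suc n) = refl
  ⟦⟧-homo-- -[1+ n ]  = sym (-‿involutive _)

  homomorphism : ℤ.+-*-rawRing -Raw-AlmostCommutative⟶ fromCommutativeRing R
  homomorphism = record
    { ⟦_⟧    = ⟦_⟧ᶻ
    ; +-homo = ⟦⟧-homo-+
    ; *-homo = ⟦⟧-homo-*
    ; -‿homo = ⟦⟧-homo--
    ; 0-homo = refl
    ; 1-homo = refl
    }

  -- Different integers may have equal images in the ring, so a failed comparison proves nothing and
  -- yields `nothing`.
  coefficient≟ : ∀ x y → Maybe (⟦ x ⟧ᶻ ≈ ⟦ y ⟧ᶻ)
  coefficient≟ x y with x ℤ.≟ y
  ... | yes x≡y = just (reflexive (≡.cong ⟦_⟧ᶻ x≡y))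
  ... | no  _   = nothing

  open RingSolver ℤ.+-*-rawRing (fromCommutativeRing R) homomorphism coefficient≟ public
    using (solve; _:=_; _:+_; _:*_; _:-_; :-_; con)

-- Ordered-field arithmetic and finite sums.

module OrderedField {c ℓ₁ ℓ₂} (𝓡 : Reals c ℓ₁ ℓ₂) where
  open Over 𝓡
  open IntegerCoefficients (Reals.commutativeRing 𝓡) using (solve; _:=_; _:+_; _:*_; _:-_; :-_; con) public
  open IsStrictTotalOrder (Reals.isStrictTotalOrder 𝓡) public
    using (compare; _≟_; <-resp-≈; <-respˡ-≈; <-respʳ-≈)
    renaming (trans to <-trans; irrefl to <-irrefl; asym to <-asym)
  open SemiringSum semiring public
  open NonStrict _≈_ _<_ public using (_≤_; <⇒≤)
  open RingProperties ring public using (-0#≈0#; -‿distribʳ-*)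
  open AbelianGroupProperties +-abelianGroup public
    using () renaming (x∙y⁻¹≈ε⇒x≈y to x-y≈0⇒x≈y; x≈y⇒x∙y⁻¹≈ε to x≈y⇒x-y≈0; ⁻¹-involutive to -‿involutive)

  module ≈-Reasoning = SetoidReasoning setoid

  ≤-refl : ∀ {x} → x ≤ x
  ≤-refl = inj₂ refl

  ≤-reflexive : ∀ {x y} → x ≈ y → x ≤ y
  ≤-reflexive = inj₂

  ≤-trans : ∀ {x y z} → x ≤ y → y ≤ z → x ≤ z
  ≤-trans = NonStrict.trans _≈_ _<_ isEquivalence <-resp-≈ <-trans

  <-≤-trans : ∀ {x y z} → x < y → y ≤ z → x < z
  <-≤-trans = NonStrict.<-≤-trans _≈_ _<_ <-trans <-respʳ-≈

  ≤-<-trans : ∀ {x y z} → x ≤ y → y < z → x < z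
  ≤-<-trans = NonStrict.≤-<-trans _≈_ _<_ sym <-trans <-respˡ-≈

  ≤-antisym : ∀ {x y} → x ≤ y → y ≤ x → x ≈ y
  ≤-antisym = NonStrict.antisym _≈_ _<_ isEquivalence <-trans <-irrefl

  ≤-total : ∀ x y → x ≤ y ⊎ y ≤ x
  ≤-total = NonStrict.total _≈_ _<_ compare

  module ≤-Reasoning = TripleReasoning
    (NonStrict.isPreorder₂ _≈_ _<_ (IsStrictTotalOrder.isStrictPartialOrder (Reals.isStrictTotalOrder 𝓡)))
    <-asym <-trans <-resp-≈ <⇒≤ <-≤-trans ≤-<-trans

  ≮⇒≥ : ∀ {x y} → ¬ (x < y) → y ≤ x
  ≮⇒≥ {x} {y} x≮y with compare x y
  ... | tri< x<y _ _ = contradiction x<y x≮y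
  ... | tri≈ _ x≈y _ = inj₂ (sym x≈y)
  ... | tri> _ _ y<x = inj₁ y<x

  <⇒≉ : ∀ {x y} → x < y → ¬ (y ≈ x)
  <⇒≉ x<y y≈x = <-irrefl (sym y≈x) x<y

  +-monoʳ-< : ∀ z {x y} → x < y → z + x < z + y
  +-monoʳ-< z x<y = <-respˡ-≈ (+-comm _ _) (<-respʳ-≈ (+-comm _ _) (+-monoˡ-< z x<y))

  +-monoˡ-≤ : ∀ z {x y} → x ≤ y → x + z ≤ y + z
  +-monoˡ-≤ z (inj₁ x<y) = inj₁ (+-monoˡ-< z x<y)
  +-monoˡ-≤ z (inj₂ x≈y) = inj₂ (+-congʳ x≈y)

  +-monoʳ-≤ : ∀ z {x y} → x ≤ y → z + x ≤ z + y
  +-monoʳ-≤ z (inj₁ x<y) = inj₁ (+-monoʳ-< z x<y)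
  +-monoʳ-≤ z (inj₂ x≈y) = inj₂ (+-congˡ x≈y)

  +-mono-≤ : ∀ {x y u v} → x ≤ y → u ≤ v → x + u ≤ y + v
  +-mono-≤ {y = y} {u = u} x≤y u≤v = ≤-trans (+-monoˡ-≤ u x≤y) (+-monoʳ-≤ y u≤v)

  x<y⇒0<y-x : ∀ {x y} → x < y → 0# < y - x
  x<y⇒0<y-x {x} x<y = <-respˡ-≈ (-‿inverseʳ x) (+-monoˡ-< (- x) x<y)

  x≤y⇒0≤y-x : ∀ {x y} → x ≤ y → 0# ≤ y - x
  x≤y⇒0≤y-x {x} x≤y = ≤-trans (≤-reflexive (sym (-‿inverseʳ x))) (+-monoˡ-≤ (- x) x≤y)

  0≤y-x⇒x≤y : ∀ {x y} → 0# ≤ y - x → x ≤ y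
  0≤y-x⇒x≤y {x} {y} 0≤y-x = begin
    x            ≈⟨ +-identityˡ x ⟨
    0# + x       ≤⟨ +-monoˡ-≤ x 0≤y-x ⟩
    y - x + x    ≈⟨ solve 2 (λ x y → y :- x :+ x := y) refl x y ⟩
    y            ∎
    where open ≤-Reasoning

  0<y-x⇒x<y : ∀ {x y} → 0# < y - x → x < y
  0<y-x⇒x<y {x} {y} 0<y-x = begin-strict
    x            ≈⟨ +-identityˡ x ⟨
    0# + x       <⟨ +-monoˡ-< x 0<y-x ⟩
    y - x + x    ≈⟨ solve 2 (λ x y → y :- x :+ x := y) refl x y ⟩
    y            ∎
    where open ≤-Reasoning

  +-nonneg : ∀ {x y} → 0# ≤ x → 0# ≤ y → 0# ≤ x + y
  +-nonneg 0≤x 0≤y = ≤-trans (≤-reflexive (sym (+-identityˡ 0#))) (+-mono-≤ 0≤x 0≤y)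

  +-pos-nonneg : ∀ {x y} → 0# < x → 0# ≤ y → 0# < x + y
  +-pos-nonneg {x} 0<x 0≤y = <-≤-trans 0<x (≤-trans (≤-reflexive (sym (+-identityʳ x))) (+-monoʳ-≤ x 0≤y))

  *-nonneg : ∀ {x y} → 0# ≤ x → 0# ≤ y → 0# ≤ x * y
  *-nonneg (inj₁ 0<x) (inj₁ 0<y) = inj₁ (*-pos 0<x 0<y)
  *-nonneg {x} {y} (inj₂ 0≈x) _ = inj₂ (sym (trans (*-congʳ (sym 0≈x)) (zeroˡ y)))
  *-nonneg {x} {y} _ (inj₂ 0≈y) = inj₂ (sym (trans (*-congˡ (sym 0≈y)) (zeroʳ x)))

  *-monoˡ-≤ : ∀ {x y z} → 0# ≤ z → x ≤ y → z * x ≤ z * y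
  *-monoˡ-≤ {x} {y} {z} 0≤z x≤y = 0≤y-x⇒x≤y
    (≤-trans (*-nonneg 0≤z (x≤y⇒0≤y-x x≤y))
      (≤-reflexive (solve 3 (λ x y z → z :* (y :- x) := z :* y :- z :* x) refl x y z)))

  *-monoˡ-< : ∀ {x y z} → 0# < z → x < y → z * x < z * y
  *-monoˡ-< {x} {y} {z} 0<z x<y = 0<y-x⇒x<y
    (<-respʳ-≈ (solve 3 (λ x y z → z :* (y :- x) := z :* y :- z :* x) refl x y z)
      (*-pos 0<z (x<y⇒0<y-x x<y)))

  *-cancelˡ-≤ : ∀ {x y z} → 0# < z → z * x ≤ z * y → x ≤ y
  *-cancelˡ-≤ {x} {y} 0<z zx≤zy with compare x y
  ... | tri< x<y _ _ = inj₁ x<y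
  ... | tri≈ _ x≈y _ = inj₂ x≈y
  ... | tri> _ _ y<x = contradiction (≤-<-trans zx≤zy (*-monoˡ-< 0<z y<x)) (<-irrefl refl)

  *-cancelˡ-< : ∀ {x y z} → 0# < z → z * x < z * y → x < y
  *-cancelˡ-< {x} {y} {z} 0<z zx<zy with compare x y
  ... | tri< x<y _ _ = x<y
  ... | tri≈ _ x≈y _ = contradiction zx<zy (<-irrefl (*-congˡ x≈y))
  ... | tri> _ _ y<x = contradiction (<-trans zx<zy (*-monoˡ-< 0<z y<x)) (<-irrefl refl)

  x<0⇒0<-x : ∀ {x} → x < 0# → 0# < - x
  x<0⇒0<-x {x} x<0 = <-respʳ-≈ (+-identityˡ (- x)) (x<y⇒0<y-x x<0)

  square-pos : ∀ {x} → ¬ (x ≈ 0#) → 0# < x * x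
  square-pos {x} x≉0 with compare x 0#
  ... | tri< x<0 _ _ = <-respʳ-≈ (solve 1 (λ x → :- x :* :- x := x :* x) refl x) (*-pos (x<0⇒0<-x x<0) (x<0⇒0<-x x<0))
  ... | tri≈ _ x≈0 _ = contradiction x≈0 x≉0
  ... | tri> _ _ 0<x = *-pos 0<x 0<x

  square-nonneg : ∀ x → 0# ≤ x * x
  square-nonneg x with x ≟ 0#
  ... | yes x≈0 = inj₂ (sym (trans (*-congˡ x≈0) (zeroʳ x)))
  ... | no  x≉0 = inj₁ (square-pos x≉0)

  square≈0⇒≈0 : ∀ {x} → x * x ≈ 0# → x ≈ 0#
  square≈0⇒≈0 {x} xx≈0 with x ≟ 0#
  ... | yes x≈0 = x≈0
  ... | no  x≉0 = contradiction xx≈0 (<⇒≉ (square-pos x≉0))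

  -- The sign of `x` is left open: if `y < x` then `x` is positive as well and its square is too
  -- large. A bound on a squared error thus gives both one-sided bounds on the error.
  square-<-cancel : ∀ {x y} → 0# < y → x * x < y * y → x < y
  square-<-cancel {x} {y} 0<y xx<yy with compare x y
  ... | tri< x<y _ _ = x<y
  ... | tri≈ _ x≈y _ = contradiction xx<yy (<-irrefl (*-cong x≈y x≈y))
  ... | tri> _ _ y<x = contradiction
    (<-trans xx<yy (<-trans (*-monoˡ-< 0<y y<x)
      (<-respˡ-≈ (*-comm x y) (*-monoˡ-< (<-trans 0<y y<x) y<x))))
    (<-irrefl refl)

  nonneg-sum≈0⇒≈0 : ∀ {x y} → 0# ≤ x → 0# ≤ y → x + y ≈ 0# → x ≈ 0#
  nonneg-sum≈0⇒≈0 {x} {y} 0≤x 0≤y x+y≈0 = ≤-antisym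
    (≤-trans (≤-reflexive (sym (+-identityʳ x))) (≤-trans (+-monoʳ-≤ x 0≤y) (≤-reflexive x+y≈0))) 0≤x

  ⁻¹-inverse : ∀ {x} → ¬ (x ≈ 0#) → x * x ⁻¹ ≈ 1#
  ⁻¹-inverse {x} x≉0 with x ≟ 0#
  ... | yes x≈0 = contradiction x≈0 x≉0
  ... | no  x≉0 = proj₂ (inverse x≉0)

  *-cancelˡ-≈ : ∀ {x y z} → ¬ (z ≈ 0#) → z * x ≈ z * y → x ≈ y
  *-cancelˡ-≈ {x} {y} {z} z≉0 zx≈zy = begin
    x               ≈⟨ *-identityˡ x ⟨
    1# * x          ≈⟨ *-congʳ (trans (*-comm _ _) (⁻¹-inverse z≉0)) ⟨
    z ⁻¹ * z * x    ≈⟨ *-assoc _ _ _ ⟩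
    z ⁻¹ * (z * x)  ≈⟨ *-congˡ zx≈zy ⟩
    z ⁻¹ * (z * y)  ≈⟨ *-assoc _ _ _ ⟨
    z ⁻¹ * z * y    ≈⟨ *-congʳ (trans (*-comm _ _) (⁻¹-inverse z≉0)) ⟩
    1# * y          ≈⟨ *-identityˡ y ⟩
    y               ∎
    where open ≈-Reasoning

  ⁻¹-nonneg : ∀ {x} → 0# < x → 0# ≤ x ⁻¹
  ⁻¹-nonneg {x} 0<x = *-cancelˡ-≤ 0<x
    (≤-trans (≤-reflexive (zeroʳ x)) (≤-trans (inj₁ 0<1) (≤-reflexive (sym (⁻¹-inverse (<⇒≉ 0<x))))))

  fromℕ-nonneg : ∀ n → 0# ≤ fromℕ n
  fromℕ-nonneg zero    = ≤-refl
  fromℕ-nonneg (suc n) = +-nonneg (inj₁ 0<1) (fromℕ-nonneg n)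

  fromℕ-pos : ∀ n → 0# < fromℕ (suc n)
  fromℕ-pos n = +-pos-nonneg 0<1 (fromℕ-nonneg n)

  fromℕ-mono-≤ : ∀ {m n} → m ℕ.≤ n → fromℕ m ≤ fromℕ n
  fromℕ-mono-≤ {n = n} ℕ.z≤n = fromℕ-nonneg n
  fromℕ-mono-≤ (ℕ.s≤s m≤n)   = +-monoʳ-≤ 1# (fromℕ-mono-≤ m≤n)

  sum-cong : ∀ {n} {f g : Vector n} → (∀ k → f k ≈ g k) → sum f ≈ sum g
  sum-cong = sum-cong-≋

  sum-zero : ∀ {n} {f : Vector n} → (∀ k → f k ≈ 0#) → sum f ≈ 0#
  sum-zero {n} f≈0 = trans (sum-cong f≈0) (sum-replicate-zero n)

  sum-nonneg : ∀ {n} {f : Vector n} → (∀ k → 0# ≤ f k) → 0# ≤ sum f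
  sum-nonneg {zero}  0≤f = ≤-refl
  sum-nonneg {suc n} 0≤f = +-nonneg (0≤f zero) (sum-nonneg λ k → 0≤f (suc k))

  sum-mono-≤ : ∀ {n} {f g : Vector n} → (∀ k → f k ≤ g k) → sum f ≤ sum g
  sum-mono-≤ {zero}  f≤g = ≤-refl
  sum-mono-≤ {suc n} f≤g = +-mono-≤ (f≤g zero) (sum-mono-≤ λ k → f≤g (suc k))

  term≤sum : ∀ {n} {f : Vector n} → (∀ k → 0# ≤ f k) → ∀ k → f k ≤ sum f
  term≤sum 0≤f zero =
    ≤-trans (≤-reflexive (sym (+-identityʳ _))) (+-monoʳ-≤ _ (sum-nonneg λ k → 0≤f (suc k)))
  term≤sum 0≤f (suc k) =
    ≤-trans (term≤sum (λ k → 0≤f (suc k)) k)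
      (≤-trans (≤-reflexive (sym (+-identityˡ _))) (+-monoˡ-≤ _ (0≤f zero)))

  sum≈0⇒term≈0 : ∀ {n} {f : Vector n} → (∀ k → 0# ≤ f k) → sum f ≈ 0# → ∀ k → f k ≈ 0#
  sum≈0⇒term≈0 0≤f Σf≈0 k = ≤-antisym (≤-trans (term≤sum 0≤f k) (≤-reflexive Σf≈0)) (0≤f k)

  sum-single : ∀ {n} (f : Vector n) i → (∀ k → k ≢ i → f k ≈ 0#) → sum f ≈ f i
  sum-single f zero    f≈0 =
    trans (+-congˡ (sum-zero λ k → f≈0 (suc k) λ ())) (+-identityʳ _)
  sum-single f (suc i) f≈0 =
    trans (+-cong (f≈0 zero λ ()) (sum-single (λ k → f (suc k)) i λ k k≢i → f≈0 (suc k) λ { ≡.refl → k≢i ≡.refl }))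
      (+-identityˡ _)

  sum-neg : ∀ {n} (f : Vector n) → sum (λ k → - f k) ≈ - sum f
  sum-neg {zero}  f = sym -0#≈0#
  sum-neg {suc n} f = trans (+-congˡ (sum-neg λ k → f (suc k)))
    (solve 2 (λ x y → :- x :+ :- y := :- (x :+ y)) refl (f zero) (sum λ k → f (suc k)))

  sum-sub : ∀ {n} (f g : Vector n) → sum (λ k → f k - g k) ≈ sum f - sum g
  sum-sub f g = trans (∑-distrib-+ f λ k → - g k) (+-congˡ (sum-neg g))

-- Linear algebra: elimination, symmetric inverses and pseudoinverses.

module LinearAlgebra {c ℓ₁ ℓ₂} (𝓡 : Reals c ℓ₁ ℓ₂) where
  open Over 𝓡
  open OrderedField 𝓡

  I-diagonal : ∀ {n} (a : Fin n) → I a a ≈ 1#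
  I-diagonal a with a Fin.≟ a
  ... | yes _  = refl
  ... | no a≢a = contradiction ≡.refl a≢a

  I-offDiagonal : ∀ {n} {a b : Fin n} → a ≢ b → I a b ≈ 0#
  I-offDiagonal {_} {a} {b} a≢b with a Fin.≟ b
  ... | yes a≡b = contradiction a≡b a≢b
  ... | no _    = refl

  I-symmetric : ∀ {n} (a b : Fin n) → I a b ≈ I b a
  I-symmetric a b with a Fin.≟ b
  ... | yes ≡.refl = sym (I-diagonal a)
  ... | no a≢b     = sym (I-offDiagonal λ b≡a → a≢b (≡.sym b≡a))

  ∙-cong : ∀ {n} {u u′ v v′ : Vector n} →
           (∀ k → u k ≈ u′ k) → (∀ k → v k ≈ v′ k) → u ∙ v ≈ u′ ∙ v′
  ∙-cong u≈u′ v≈v′ = sum-cong λ k → *-cong (u≈u′ k) (v≈v′ k)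

  ∙-comm : ∀ {n} (u v : Vector n) → u ∙ v ≈ v ∙ u
  ∙-comm u v = sum-cong λ k → *-comm (u k) (v k)

  ∙-zeroʳ : ∀ {n} (u : Vector n) {v : Vector n} → (∀ k → v k ≈ 0#) → u ∙ v ≈ 0#
  ∙-zeroʳ u v≈0 = sum-zero λ k → trans (*-congˡ (v≈0 k)) (zeroʳ (u k))

  ∙-zeroˡ : ∀ {n} {u : Vector n} (v : Vector n) → (∀ k → u k ≈ 0#) → u ∙ v ≈ 0#
  ∙-zeroˡ v u≈0 = trans (∙-comm _ v) (∙-zeroʳ v u≈0)

  ∙-distribˡ-+ : ∀ {n} (u v w : Vector n) → u ∙ (λ k → v k + w k) ≈ u ∙ v + u ∙ w
  ∙-distribˡ-+ u v w = trans (sum-cong λ k → distribˡ (u k) (v k) (w k)) (∑-distrib-+ (λ k → u k * v k) λ k → u k * w k)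

  ∙-distribˡ-sub : ∀ {n} (u v w : Vector n) → u ∙ (λ k → v k - w k) ≈ u ∙ v - u ∙ w
  ∙-distribˡ-sub u v w = trans
    (sum-cong λ k → solve 3 (λ x y z → x :* (y :- z) := x :* y :- x :* z) refl (u k) (v k) (w k))
    (sum-sub (λ k → u k * v k) λ k → u k * w k)

  ∙-scaleˡ : ∀ {n} s (u v : Vector n) → (λ k → s * u k) ∙ v ≈ s * (u ∙ v)
  ∙-scaleˡ s u v = trans (sum-cong λ k → *-assoc s (u k) (v k)) (sym (*-distribˡ-sum s λ k → u k * v k))

  ∙-scaleʳ : ∀ {n} s (u v : Vector n) → u ∙ (λ k → s * v k) ≈ s * (u ∙ v)
  ∙-scaleʳ s u v = trans (∙-comm u _) (trans (∙-scaleˡ s v u) (*-congˡ (∙-comm v u)))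

  ∙-sumʳ : ∀ {m n} (u : Vector n) (f : Fin m → Vector n) →
           u ∙ (λ k → sum λ l → f l k) ≈ sum λ l → u ∙ f l
  ∙-sumʳ u f = trans (sum-cong λ k → *-distribˡ-sum (u k) λ l → f l k) (∑-comm λ k l → u k * f l k)

  square-norm-nonneg : ∀ {n} (u : Vector n) → 0# ≤ u ∙ u
  square-norm-nonneg u = sum-nonneg λ k → square-nonneg (u k)

  square-norm≈0⇒≈0 : ∀ {n} (u : Vector n) → u ∙ u ≈ 0# → ∀ k → u k ≈ 0#
  square-norm≈0⇒≈0 u uu≈0 k = square≈0⇒≈0 (sum≈0⇒term≈0 (λ l → square-nonneg (u l)) uu≈0 k)

  I-∙ : ∀ {n} (a : Fin n) (v : Vector n) → I a ∙ v ≈ v a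
  I-∙ a v = trans
    (sum-single (λ k → I a k * v k) a λ k k≢a →
      trans (*-congʳ (I-offDiagonal λ a≡k → k≢a (≡.sym a≡k))) (zeroˡ (v k)))
    (trans (*-congʳ (I-diagonal a)) (*-identityˡ (v a)))

  *ᵛ-congˡ : ∀ {m n} (A : Matrix m n) {u v : Vector n} → (∀ k → u k ≈ v k) → ∀ a → (A *ᵛ u) a ≈ (A *ᵛ v) a
  *ᵛ-congˡ A u≈v a = ∙-cong (λ _ → refl) u≈v

  adjoint : ∀ {m n} (A : Matrix m n) u v → u ∙ (A *ᵛ v) ≈ (A ᵀ *ᵛ u) ∙ v
  adjoint A u v = begin
    sum (λ a → u a * sum λ k → A a k * v k)    ≈⟨ sum-cong (λ a → *-distribˡ-sum (u a) λ k → A a k * v k) ⟩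
    sum (λ a → sum λ k → u a * (A a k * v k))  ≈⟨ ∑-comm (λ a k → u a * (A a k * v k)) ⟩
    sum (λ k → sum λ a → u a * (A a k * v k))  ≈⟨ sum-cong (λ k → sum-cong λ a →
        solve 3 (λ x y z → x :* (y :* z) := y :* x :* z) refl (u a) (A a k) (v k)) ⟩
    sum (λ k → sum λ a → A a k * u a * v k)    ≈⟨ sum-cong (λ k → *-distribʳ-sum (v k) λ a → A a k * u a) ⟨
    sum (λ k → sum (λ a → A a k * u a) * v k)  ∎
    where open ≈-Reasoning

  -- This is adjointness of `B`, applied to the row `A a`.
  *ᵛ-assoc : ∀ {m n p} (A : Matrix m n) (B : Matrix n p) v a → ((A *ᴹ B) *ᵛ v) a ≈ (A *ᵛ (B *ᵛ v)) a
  *ᵛ-assoc A B v a = sym (trans (adjoint B (A a) v)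
    (∙-cong (λ k → ∙-comm (λ l → B l k) (A a)) λ _ → refl))

  Symmetric : ∀ {n} → Matrix n n → Set ℓ₁
  Symmetric A = ∀ a b → A a b ≈ A b a

  symmetric-adjoint : ∀ {n} {A : Matrix n n} → Symmetric A → ∀ u v → u ∙ (A *ᵛ v) ≈ (A *ᵛ u) ∙ v
  symmetric-adjoint {A = A} A-sym u v = trans (adjoint A u v)
    (∙-cong (λ k → ∙-cong (λ a → A-sym a k) λ _ → refl) λ _ → refl)

  matrixSetoid : ℕ → ℕ → Setoid c ℓ₁
  matrixSetoid m n = record
    { Carrier = Matrix m n
    ; _≈_ = _≈ᴹ_
    ; isEquivalence = record
      { refl  = λ _ _ → refl
      ; sym   = λ A≈B a b → sym (A≈B a b)
      ; trans = λ A≈B B≈C a b → trans (A≈B a b) (B≈C a b)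
      }
    }

  module ≈ᴹ-Reasoning {m n} = SetoidReasoning (matrixSetoid m n)

  *ᴹ-cong : ∀ {m n p} {A A′ : Matrix m n} {B B′ : Matrix n p} → A ≈ᴹ A′ → B ≈ᴹ B′ → A *ᴹ B ≈ᴹ A′ *ᴹ B′
  *ᴹ-cong A≈A′ B≈B′ a b = ∙-cong (A≈A′ a) λ k → B≈B′ k b

  *ᴹ-congˡ : ∀ {m n p} (A : Matrix m n) {B B′ : Matrix n p} → B ≈ᴹ B′ → A *ᴹ B ≈ᴹ A *ᴹ B′
  *ᴹ-congˡ A B≈B′ = *ᴹ-cong {A = A} (λ _ _ → refl) B≈B′

  *ᴹ-congʳ : ∀ {m n p} {A A′ : Matrix m n} (B : Matrix n p) → A ≈ᴹ A′ → A *ᴹ B ≈ᴹ A′ *ᴹ B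
  *ᴹ-congʳ B A≈A′ = *ᴹ-cong {B = B} A≈A′ λ _ _ → refl

  *ᴹ-assoc : ∀ {m n p q} (A : Matrix m n) (B : Matrix n p) (C : Matrix p q) → A *ᴹ B *ᴹ C ≈ᴹ A *ᴹ (B *ᴹ C)
  *ᴹ-assoc A B C a b = *ᵛ-assoc A B (λ k → C k b) a

  *ᴹ-identityˡ : ∀ {m n} (A : Matrix m n) → I *ᴹ A ≈ᴹ A
  *ᴹ-identityˡ A a b = I-∙ a λ k → A k b

  *ᴹ-identityʳ : ∀ {m n} (A : Matrix m n) → A *ᴹ I ≈ᴹ A
  *ᴹ-identityʳ A a b = trans
    (trans (∙-comm (A a) λ k → I k b) (∙-cong (λ k → I-symmetric k b) λ _ → refl)) (I-∙ b (A a))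

  *ᴹ-ᵀ : ∀ {m n p} (A : Matrix m n) (B : Matrix n p) → (A *ᴹ B) ᵀ ≈ᴹ B ᵀ *ᴹ A ᵀ
  *ᴹ-ᵀ A B a b = ∙-comm (A b) λ k → B k a

  -- The property that carries Gaussian elimination without row exchanges: it forces the pivot to be
  -- nonzero and is inherited by what remains after eliminating one unknown.
  Anisotropic : ∀ {n} → Matrix n n → Set (c ⊔ ℓ₁)
  Anisotropic A = ∀ x → x ∙ (A *ᵛ x) ≈ 0# → ∀ a → x a ≈ 0#

  module Elimination {m} (A : Matrix (suc m) (suc m)) (α⁻¹ : ℝ) (αα⁻¹≈1 : A zero zero * α⁻¹ ≈ 1#) where
    row : Vector m
    row l = A zero (suc l)

    -- The Schur complement of the pivot, i.e. the later rows after the first unknown has been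
    -- eliminated.
    minor : Matrix m m
    minor k l = A (suc k) (suc l) - A (suc k) zero * (α⁻¹ * row l)

    backSubstitute : ℝ → Vector m → Vector (suc m)
    backSubstitute β x zero    = α⁻¹ * (β - row ∙ x)
    backSubstitute β x (suc k) = x k

    firstRow : ∀ β x → (A *ᵛ backSubstitute β x) zero ≈ β
    firstRow β x = begin
      A zero zero * (α⁻¹ * (β - t)) + t  ≈⟨ +-congʳ (*-assoc _ _ _) ⟨
      A zero zero * α⁻¹ * (β - t) + t    ≈⟨ +-congʳ (*-congʳ αα⁻¹≈1) ⟩
      1# * (β - t) + t                   ≈⟨ +-congʳ (*-identityˡ _) ⟩
      β - t + t                          ≈⟨ solve 2 (λ x y → x :- y :+ y := x) refl β t ⟩
      β                                  ∎
      where
      open ≈-Reasoning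
      t = row ∙ x

    minor-*ᵛ : ∀ x k → (minor *ᵛ x) k ≈ (λ l → A (suc k) (suc l)) ∙ x - A (suc k) zero * α⁻¹ * (row ∙ x)
    minor-*ᵛ x k = begin
      sum (λ l → (A (suc k) (suc l) - γ * (α⁻¹ * row l)) * x l)
        ≈⟨ sum-cong (λ l → solve 5 (λ a g i r x → (a :- g :* (i :* r)) :* x := a :* x :- g :* i :* (r :* x))
             refl (A (suc k) (suc l)) γ α⁻¹ (row l) (x l)) ⟩
      sum (λ l → A (suc k) (suc l) * x l - γ * α⁻¹ * (row l * x l))
        ≈⟨ sum-sub (λ l → A (suc k) (suc l) * x l) (λ l → γ * α⁻¹ * (row l * x l)) ⟩
      (λ l → A (suc k) (suc l)) ∙ x - sum (λ l → γ * α⁻¹ * (row l * x l))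
        ≈⟨ +-congˡ (-‿cong (*-distribˡ-sum (γ * α⁻¹) λ l → row l * x l)) ⟨
      (λ l → A (suc k) (suc l)) ∙ x - γ * α⁻¹ * (row ∙ x) ∎
      where
      open ≈-Reasoning
      γ = A (suc k) zero

    laterRow : ∀ β x k → (A *ᵛ backSubstitute β x) (suc k) ≈ A (suc k) zero * α⁻¹ * β + (minor *ᵛ x) k
    laterRow β x k = begin
      γ * (α⁻¹ * (β - t)) + s
        ≈⟨ solve 5 (λ g i b t s → g :* (i :* (b :- t)) :+ s := g :* i :* b :+ (s :- g :* i :* t)) refl γ α⁻¹ β t s ⟩
      γ * α⁻¹ * β + (s - γ * α⁻¹ * t)
        ≈⟨ +-congˡ (minor-*ᵛ x k) ⟨
      γ * α⁻¹ * β + (minor *ᵛ x) k ∎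
      where
      open ≈-Reasoning
      γ = A (suc k) zero
      t = row ∙ x
      s = (λ l → A (suc k) (suc l)) ∙ x

    -- Back substitution with `β = 0` makes the first entry of `A y` vanish and the others agree
    -- with `minor x`. The two quadratic forms then have the same value, so a null vector of `minor`
    -- extends to one of `A`.
    minor-anisotropic : Anisotropic A → Anisotropic minor
    minor-anisotropic A-aniso x xMx≈0 k = A-aniso (backSubstitute 0# x) (begin
      y zero * (A *ᵛ y) zero + sum (λ k → x k * (A *ᵛ y) (suc k))
        ≈⟨ +-cong (trans (*-congˡ (firstRow 0# x)) (zeroʳ (y zero)))
             (sum-cong λ k → *-congˡ (trans (laterRow 0# x k)
               (trans (+-congʳ (zeroʳ (A (suc k) zero * α⁻¹))) (+-identityˡ _)))) ⟩
      0# + x ∙ (minor *ᵛ x)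
        ≈⟨ trans (+-identityˡ _) xMx≈0 ⟩
      0# ∎) (suc k)
      where
      open ≈-Reasoning
      y = backSubstitute 0# x

  -- The pivot is the value of the quadratic form at the first basis vector.
  anisotropic⇒pivot≉0 : ∀ {m} {A : Matrix (suc m) (suc m)} → Anisotropic A → ¬ (A zero zero ≈ 0#)
  anisotropic⇒pivot≉0 {A = A} A-aniso α≈0 = <⇒≉ 0<1 (A-aniso (I zero) (begin
    I zero ∙ (A *ᵛ I zero)           ≈⟨ I-∙ zero (A *ᵛ I zero) ⟩
    A zero ∙ I zero                  ≈⟨ ∙-comm (A zero) (I zero) ⟩
    I zero ∙ A zero                  ≈⟨ I-∙ zero (A zero) ⟩
    A zero zero                      ≈⟨ α≈0 ⟩
    0#                               ∎) zero)
    where open ≈-Reasoning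

  anisotropic⇒solvable : ∀ {m} (A : Matrix m m) → Anisotropic A →
                         ∀ (b : Vector m) → ∃[ x ] (∀ a → (A *ᵛ x) a ≈ b a)
  anisotropic⇒solvable {zero}  A A-aniso b = b , λ ()
  anisotropic⇒solvable {suc m} A A-aniso b = backSubstitute (b zero) x , correct
    where
    open ≈-Reasoning
    α≉0 = anisotropic⇒pivot≉0 {A = A} A-aniso
    open Elimination A (A zero zero ⁻¹) (⁻¹-inverse α≉0)

    γ : Fin m → ℝ
    γ k = A (suc k) zero * A zero zero ⁻¹ * b zero

    -- `γ k` is what the first equation's right-hand side contributes to row `k` through back
    -- substitution; it is subtracted in advance.
    solution = anisotropic⇒solvable minor (minor-anisotropic A-aniso) λ k → b (suc k) - γ k
    x = proj₁ solution

    correct : ∀ a → (A *ᵛ backSubstitute (b zero) x) a ≈ b a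
    correct zero    = firstRow (b zero) x
    correct (suc k) = begin
      (A *ᵛ backSubstitute (b zero) x) (suc k) ≈⟨ laterRow (b zero) x k ⟩
      γ k + (minor *ᵛ x) k                     ≈⟨ +-congˡ (proj₂ solution k) ⟩
      γ k + (b (suc k) - γ k)                  ≈⟨ solve 2 (λ x y → x :+ (y :- x) := y) refl (γ k) (b (suc k)) ⟩
      b (suc k)                                ∎

  -- Solving for the columns of the identity gives a right inverse. Since `A` is symmetric, its
  -- transpose is a left inverse, and a left and a right inverse coincide; this proves both
  -- invertibility and the symmetry of `R`.
  symmetric-anisotropic⇒inverse : ∀ {m} (A : Matrix m m) → Symmetric A → Anisotropic A →
                                  ∃[ R ] (IsInverse A R × Symmetric R)
  symmetric-anisotropic⇒inverse {m} A A-sym A-aniso = R , (AR≈I , RA≈I) , λ a b → sym (Rᵀ≈R a b)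
    where
    open ≈ᴹ-Reasoning
    R : Matrix m m
    R a b = proj₁ (anisotropic⇒solvable A A-aniso (λ a → I a b)) a

    AR≈I : A *ᴹ R ≈ᴹ I
    AR≈I a b = proj₂ (anisotropic⇒solvable A A-aniso (λ a → I a b)) a

    RᵀA≈I : R ᵀ *ᴹ A ≈ᴹ I
    RᵀA≈I = begin
      R ᵀ *ᴹ A    ≈⟨ *ᴹ-congˡ (R ᵀ) A-sym ⟩
      R ᵀ *ᴹ A ᵀ  ≈⟨ *ᴹ-ᵀ A R ⟨
      (A *ᴹ R) ᵀ  ≈⟨ (λ a b → AR≈I b a) ⟩
      I ᵀ         ≈⟨ (λ a b → I-symmetric b a) ⟩
      I           ∎

    Rᵀ≈R : R ᵀ ≈ᴹ R
    Rᵀ≈R = begin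
      R ᵀ               ≈⟨ *ᴹ-identityʳ (R ᵀ) ⟨
      R ᵀ *ᴹ I          ≈⟨ *ᴹ-congˡ (R ᵀ) AR≈I ⟨
      R ᵀ *ᴹ (A *ᴹ R)   ≈⟨ *ᴹ-assoc (R ᵀ) A R ⟨
      R ᵀ *ᴹ A *ᴹ R     ≈⟨ *ᴹ-congʳ R RᵀA≈I ⟩
      I *ᴹ R            ≈⟨ *ᴹ-identityˡ R ⟩
      R                 ∎

    RA≈I : R *ᴹ A ≈ᴹ I
    RA≈I = begin
      R *ᴹ A    ≈⟨ *ᴹ-congʳ A Rᵀ≈R ⟨
      R ᵀ *ᴹ A  ≈⟨ RᵀA≈I ⟩
      I         ∎

  inverse⇒pseudoinverse : ∀ {m} {A R : Matrix m m} → IsInverse A R → IsPseudoinverse A R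
  inverse⇒pseudoinverse {_} {A} {R} (AR≈I , RA≈I) = record
    { APA≈A   = λ a b → trans (*ᴹ-congʳ A AR≈I a b) (*ᴹ-identityˡ A a b)
    ; PAP≈P   = λ a b → trans (*ᴹ-congʳ R RA≈I a b) (*ᴹ-identityˡ R a b)
    ; AP-symm = λ a b → trans (AR≈I b a) (trans (I-symmetric b a) (sym (AR≈I a b)))
    ; PA-symm = λ a b → trans (RA≈I b a) (trans (I-symmetric b a) (sym (RA≈I a b)))
    }

  -- With B spanning ker M, the matrix A = M + B Bᵀ is invertible and M A = M² = A M,
  -- so M commutes with A⁻¹ and A⁻¹ M A⁻¹ is the pseudoinverse of M.
  symmetric-semidefinite⇒pseudoinverse :
    ∀ {m r} (M : Matrix m m) → Symmetric M →
    (∀ x → 0# ≤ x ∙ (M *ᵛ x)) → (∀ x → x ∙ (M *ᵛ x) ≈ 0# → ∀ a → (M *ᵛ x) a ≈ 0#) →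
    (basis : Fin r → Vector m) → (∀ k a → (M *ᵛ basis k) a ≈ 0#) →
    (∀ v → (∀ a → (M *ᵛ v) a ≈ 0#) → Σ (Vector r) λ t → ∀ a → v a ≈ sum (λ k → t k * basis k a)) →
    ∃[ P ] IsPseudoinverse M P
  symmetric-semidefinite⇒pseudoinverse {m} M M-sym M-nonneg M-null basis inKernel spanning =
    R *ᴹ M *ᴹ R , record
      { APA≈A   = begin
          M *ᴹ P *ᴹ M    ≈⟨ *ᴹ-congʳ M MP≈MR ⟩
          M *ᴹ R *ᴹ M    ≈⟨ MRM≈M ⟩
          M              ∎
      ; PAP≈P   = begin
          P *ᴹ M *ᴹ P    ≈⟨ *ᴹ-congʳ P PM≈MR ⟩
          M *ᴹ R *ᴹ P    ≈⟨ *ᴹ-congʳ P RM≈MR ⟨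
          R *ᴹ M *ᴹ P    ≈⟨ *ᴹ-assoc R M P ⟩
          R *ᴹ (M *ᴹ P)  ≈⟨ *ᴹ-congˡ R MP≈MR ⟩
          R *ᴹ (M *ᴹ R)  ≈⟨ *ᴹ-assoc R M R ⟨
          P              ∎
      ; AP-symm = begin
          (M *ᴹ P) ᵀ     ≈⟨ (λ a b → MP≈MR b a) ⟩
          (M *ᴹ R) ᵀ     ≈⟨ MR-sym ⟩
          M *ᴹ R         ≈⟨ MP≈MR ⟨
          M *ᴹ P         ∎
      ; PA-symm = begin
          (P *ᴹ M) ᵀ     ≈⟨ (λ a b → PM≈MR b a) ⟩
          (M *ᴹ R) ᵀ     ≈⟨ MR-sym ⟩
          M *ᴹ R         ≈⟨ PM≈MR ⟨
          P *ᴹ M         ∎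
      }
    where
    open ≈ᴹ-Reasoning
    B : Matrix m _
    B a k = basis k a

    A : Matrix m m
    A = M +ᴹ B *ᴹ B ᵀ

    A-sym : Symmetric A
    A-sym a b = +-cong (M-sym a b) (∙-comm (B a) (B b))

    A-form : ∀ x → x ∙ (A *ᵛ x) ≈ x ∙ (M *ᵛ x) + (B ᵀ *ᵛ x) ∙ (B ᵀ *ᵛ x)
    A-form x = trans
      (∙-cong (λ _ → refl) λ a → trans
        (sum-cong λ k → distribʳ (x k) (M a k) ((B *ᴹ B ᵀ) a k))
        (trans (∑-distrib-+ (λ k → M a k * x k) λ k → (B *ᴹ B ᵀ) a k * x k)
          (+-congˡ (*ᵛ-assoc B (B ᵀ) x a))))
      (trans (∙-distribˡ-+ x (M *ᵛ x) (B *ᵛ (B ᵀ *ᵛ x)))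
        (+-congˡ (adjoint B x (B ᵀ *ᵛ x))))

    -- Both summands of the form vanish. The first puts `x` in ker M, hence in the span of the
    -- columns of `B`; the second makes `x` orthogonal to these columns. So `x` is orthogonal to
    -- itself.
    A-aniso : Anisotropic A
    A-aniso x xAx≈0 = square-norm≈0⇒≈0 x (trans
      (∙-cong (λ _ → refl) λ a → trans (x≈Bt a) (∙-comm t (λ k → B a k)))
      (trans (adjoint B x t) (∙-zeroˡ t Bᵀx≈0)))
      where
      form≈0 = trans (sym (A-form x)) xAx≈0
      Mx≈0 = M-null x (nonneg-sum≈0⇒≈0 (M-nonneg x) (square-norm-nonneg (B ᵀ *ᵛ x)) form≈0)
      Bᵀx≈0 = square-norm≈0⇒≈0 (B ᵀ *ᵛ x)
        (nonneg-sum≈0⇒≈0 (square-norm-nonneg (B ᵀ *ᵛ x)) (M-nonneg x) (trans (+-comm _ _) form≈0))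
      t = proj₁ (spanning x Mx≈0)
      x≈Bt = proj₂ (spanning x Mx≈0)

    inverseOfA = symmetric-anisotropic⇒inverse A A-sym A-aniso
    R = proj₁ inverseOfA
    AR≈I = proj₁ (proj₁ (proj₂ inverseOfA))
    RA≈I = proj₂ (proj₁ (proj₂ inverseOfA))
    R-sym = proj₂ (proj₂ inverseOfA)
    P = R *ᴹ M *ᴹ R

    MA≈MM : M *ᴹ A ≈ᴹ M *ᴹ M
    MA≈MM a b = trans (∙-distribˡ-+ (M a) (λ k → M k b) (λ k → (B *ᴹ B ᵀ) k b)) (trans
      (+-congˡ (trans (sym (*ᴹ-assoc M B (B ᵀ) a b)) (∙-zeroˡ (B b) λ k → inKernel k a)))
      (+-identityʳ _))

    AM≈MM : A *ᴹ M ≈ᴹ M *ᴹ M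
    AM≈MM = begin
      A *ᴹ M      ≈⟨ (λ a b → ∙-cong (λ k → A-sym a k) (λ k → M-sym k b)) ⟩
      A ᵀ *ᴹ M ᵀ  ≈⟨ *ᴹ-ᵀ M A ⟨
      (M *ᴹ A) ᵀ  ≈⟨ (λ a b → MA≈MM b a) ⟩
      (M *ᴹ M) ᵀ  ≈⟨ *ᴹ-ᵀ M M ⟩
      M ᵀ *ᴹ M ᵀ  ≈⟨ (λ a b → ∙-cong (λ k → M-sym k a) (λ k → M-sym b k)) ⟩
      M *ᴹ M      ∎

    RMM≈M : R *ᴹ (M *ᴹ M) ≈ᴹ M
    RMM≈M = begin
      R *ᴹ (M *ᴹ M)  ≈⟨ *ᴹ-congˡ R AM≈MM ⟨
      R *ᴹ (A *ᴹ M)  ≈⟨ *ᴹ-assoc R A M ⟨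
      R *ᴹ A *ᴹ M    ≈⟨ *ᴹ-congʳ M RA≈I ⟩
      I *ᴹ M         ≈⟨ *ᴹ-identityˡ M ⟩
      M              ∎

    RM≈MR : R *ᴹ M ≈ᴹ M *ᴹ R
    RM≈MR = begin
      R *ᴹ M                  ≈⟨ *ᴹ-identityʳ (R *ᴹ M) ⟨
      R *ᴹ M *ᴹ I             ≈⟨ *ᴹ-congˡ (R *ᴹ M) AR≈I ⟨
      R *ᴹ M *ᴹ (A *ᴹ R)      ≈⟨ *ᴹ-assoc (R *ᴹ M) A R ⟨
      R *ᴹ M *ᴹ A *ᴹ R        ≈⟨ *ᴹ-congʳ R (*ᴹ-assoc R M A) ⟩
      R *ᴹ (M *ᴹ A) *ᴹ R      ≈⟨ *ᴹ-congʳ R (*ᴹ-congˡ R MA≈MM) ⟩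
      R *ᴹ (M *ᴹ M) *ᴹ R      ≈⟨ *ᴹ-congʳ R RMM≈M ⟩
      M *ᴹ R                  ∎

    MRM≈M : M *ᴹ R *ᴹ M ≈ᴹ M
    MRM≈M = begin
      M *ᴹ R *ᴹ M    ≈⟨ *ᴹ-congʳ M RM≈MR ⟨
      R *ᴹ M *ᴹ M    ≈⟨ *ᴹ-assoc R M M ⟩
      R *ᴹ (M *ᴹ M)  ≈⟨ RMM≈M ⟩
      M              ∎

    MP≈MR : M *ᴹ P ≈ᴹ M *ᴹ R
    MP≈MR = begin
      M *ᴹ (R *ᴹ M *ᴹ R)    ≈⟨ *ᴹ-congˡ M (*ᴹ-assoc R M R) ⟩
      M *ᴹ (R *ᴹ (M *ᴹ R))  ≈⟨ *ᴹ-assoc M R (M *ᴹ R) ⟨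
      M *ᴹ R *ᴹ (M *ᴹ R)    ≈⟨ *ᴹ-assoc (M *ᴹ R) M R ⟨
      M *ᴹ R *ᴹ M *ᴹ R      ≈⟨ *ᴹ-congʳ R MRM≈M ⟩
      M *ᴹ R                ∎

    PM≈MR : P *ᴹ M ≈ᴹ M *ᴹ R
    PM≈MR = begin
      R *ᴹ M *ᴹ R *ᴹ M    ≈⟨ *ᴹ-congʳ M (*ᴹ-assoc R M R) ⟩
      R *ᴹ (M *ᴹ R) *ᴹ M  ≈⟨ *ᴹ-assoc R (M *ᴹ R) M ⟩
      R *ᴹ (M *ᴹ R *ᴹ M)  ≈⟨ *ᴹ-congˡ R MRM≈M ⟩
      R *ᴹ M              ≈⟨ RM≈MR ⟩
      M *ᴹ R              ∎

    MR-sym : (M *ᴹ R) ᵀ ≈ᴹ M *ᴹ R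
    MR-sym = begin
      (M *ᴹ R) ᵀ  ≈⟨ *ᴹ-ᵀ M R ⟩
      R ᵀ *ᴹ M ᵀ  ≈⟨ (λ a b → ∙-cong (λ k → R-sym k a) (λ k → M-sym b k)) ⟩
      R *ᴹ M      ≈⟨ RM≈MR ⟩
      M *ᴹ R      ∎

-- Sections over the vertices, the connection Laplacian and its energy.

module Sections {c ℓ₁ ℓ₂} (𝓡 : Reals c ℓ₁ ℓ₂) where
  open Over 𝓡
  open OrderedField 𝓡
  open LinearAlgebra 𝓡

  sum-↑ : ∀ m {n} (f : Vector (m ℕ.+ n)) → sum f ≈ sum (λ a → f (a ↑ˡ n)) + sum (λ b → f (m ↑ʳ b))
  sum-↑ zero    f = sym (+-identityˡ _)
  sum-↑ (suc m) f = trans (+-congˡ (sum-↑ m λ k → f (suc k))) (sym (+-assoc _ _ _))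

  sum-combine : ∀ n {d} (f : Vector (n ℕ.* d)) → sum f ≈ sum λ x → sum λ a → f (combine {n} x a)
  sum-combine zero    f = refl
  sum-combine (suc n) {d} f = trans (sum-↑ d f) (+-congˡ (sum-combine n λ r → f (d ↑ʳ r)))

  combine-induction : ∀ {n d p} {P : Fin (n ℕ.* d) → Set p} → (∀ x a → P (combine {n} x a)) → ∀ r → P r
  combine-induction {n} {d} {P = P} P-combine r =
    ≡.subst P (Fin.combine-remQuot {n} d r) (P-combine (quotient d r) (remainder {n} d r))

  -- A section of the bundle ℝᵈ over the vertices is an n × d array.
  infix 4 ⟪_,_⟫
  ⟪_,_⟫ : ∀ {n d} → Matrix n d → Matrix n d → ℝ
  ⟪ f , g ⟫ = sum λ x → f x ∙ g x

  unflatten : ∀ {n d} → Vector (n ℕ.* d) → Matrix n d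
  unflatten v x a = v (combine x a)

  flatten : ∀ {n d} → Matrix n d → Vector (n ℕ.* d)
  flatten {n} {d} s r = s (quotient d r) (remainder {n} d r)

  unflatten-flatten : ∀ {n d} (s : Matrix n d) x a → unflatten (flatten s) x a ≡ s x a
  unflatten-flatten s x a = ≡.cong (λ p → s (proj₁ p) (proj₂ p)) (Fin.remQuot-combine x a)

  fromBlocks-combine : ∀ {p q a b} (B : Fin p → Fin q → Matrix a b) x y k l →
                       fromBlocks B (combine x k) (combine y l) ≡ B x y k l
  fromBlocks-combine B x y k l =
    ≡.cong₂ (λ p q → B (proj₁ p) (proj₁ q) (proj₂ p) (proj₂ q)) (Fin.remQuot-combine x k) (Fin.remQuot-combine y l)

  ∙-unflatten : ∀ {n d} (u v : Vector (n ℕ.* d)) → u ∙ v ≈ ⟪ unflatten {n} u , unflatten v ⟫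
  ∙-unflatten {n} u v = sum-combine n λ r → u r * v r

  ⟪⟫-cong : ∀ {n d} {f f′ g g′ : Matrix n d} → f ≈ᴹ f′ → g ≈ᴹ g′ → ⟪ f , g ⟫ ≈ ⟪ f′ , g′ ⟫
  ⟪⟫-cong f≈f′ g≈g′ = sum-cong λ x → ∙-cong (f≈f′ x) (g≈g′ x)

  ⟪⟫-comm : ∀ {n d} (f g : Matrix n d) → ⟪ f , g ⟫ ≈ ⟪ g , f ⟫
  ⟪⟫-comm f g = sum-cong λ x → ∙-comm (f x) (g x)

  orthogonal-isometry : ∀ {n} {A : Matrix n n} → IsOrthogonal A → ∀ u v → (A *ᵛ u) ∙ (A *ᵛ v) ≈ u ∙ v
  orthogonal-isometry {A = A} (AᵀA≈I , _) u v = trans (adjoint A (A *ᵛ u) v)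
    (∙-cong (λ a → trans (sym (*ᵛ-assoc (A ᵀ) A u a)) (trans (∙-cong (AᵀA≈I a) λ _ → refl) (I-∙ a u))) λ _ → refl)

  module ConnectionGraph {n} (G : WeightedGraph n) where
    open WeightedGraph G

    w≥0 : ∀ x y → 0# ≤ w x y
    w≥0 x y = ≮⇒≥ (w-nonneg x y)

    edge? : ∀ x y → Edge x y ⊎ w x y ≈ 0#
    edge? x y with w≥0 x y
    ... | inj₁ 0<w = inj₁ (Equivalence.to (w-pos⇔edge x y) 0<w)
    ... | inj₂ 0≈w = inj₂ (sym 0≈w)

    edge⇒w>0 : ∀ {x y} → Edge x y → 0# < w x y
    edge⇒w>0 {x} {y} = Equivalence.from (w-pos⇔edge x y)

    w-loop : ∀ x → w x x ≈ 0#
    w-loop x with edge? x x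
    ... | inj₁ loop = contradiction loop (irreflexive x)
    ... | inj₂ w≈0  = w≈0

    -- The laws of a signature hold on edges only. Off the edges the weight is zero, so after
    -- multiplication by it an equality is owed on edges alone.
    w-congˡ : ∀ x y {u v} → (Edge x y → u ≈ v) → w x y * u ≈ w x y * v
    w-congˡ x y u≈v with edge? x y
    ... | inj₁ xy  = *-congˡ (u≈v xy)
    ... | inj₂ w≈0 = trans (trans (*-congʳ w≈0) (zeroˡ _)) (sym (trans (*-congʳ w≈0) (zeroˡ _)))

    module Laplacian {d} (σ : Signature n d) where

      laplacianBlock : Fin n → Fin n → Matrix d d
      laplacianBlock x y = if ⌊ x Fin.≟ y ⌋ then deg x •ᴹ I else -ᴹ (w x y •ᴹ σ x y)

      Δ : Matrix n d → Matrix n d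
      Δ s x a = ⟪ (λ y → laplacianBlock x y a) , s ⟫

      -- One formula serves on and off the diagonal because there are no loops: the signature term
      -- at `x = y` has weight zero.
      laplacian-entry : ∀ x y a b → laplacianBlock x y a b ≈ I x y * (deg x * I a b) - w x y * σ x y a b
      laplacian-entry x y a b with x Fin.≟ y
      ... | yes ≡.refl = sym (trans (+-cong (*-identityˡ _) (-‿cong (trans (*-congʳ (w-loop x)) (zeroˡ _))))
                           (trans (+-congˡ -0#≈0#) (+-identityʳ _)))
      ... | no _       = sym (trans (+-congʳ (zeroˡ _)) (+-identityˡ _))

      Δ-cong : ∀ {s t} → s ≈ᴹ t → Δ s ≈ᴹ Δ t
      Δ-cong s≈t x a = ⟪⟫-cong (λ _ _ → refl) s≈t

      laplacianBlock-∙ : ∀ x y a v → laplacianBlock x y a ∙ v ≈ I x y * (deg x * v a) - w x y * (σ x y *ᵛ v) a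
      laplacianBlock-∙ x y a v = begin
        laplacianBlock x y a ∙ v
          ≈⟨ ∙-comm (laplacianBlock x y a) v ⟩
        v ∙ laplacianBlock x y a
          ≈⟨ ∙-cong (λ _ → refl) (laplacian-entry x y a) ⟩
        v ∙ (λ b → I x y * (deg x * I a b) - w x y * σ x y a b)
          ≈⟨ ∙-distribˡ-sub v (λ b → I x y * (deg x * I a b)) (λ b → w x y * σ x y a b) ⟩
        v ∙ (λ b → I x y * (deg x * I a b)) - v ∙ (λ b → w x y * σ x y a b)
          ≈⟨ +-cong (trans (∙-scaleʳ (I x y) v (λ b → deg x * I a b)) (*-congˡ (trans (∙-scaleʳ (deg x) v (I a))
               (*-congˡ (trans (∙-comm v (I a)) (I-∙ a v))))))
               (-‿cong (trans (∙-scaleʳ (w x y) v (σ x y a)) (*-congˡ (∙-comm v (σ x y a))))) ⟩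
        I x y * (deg x * v a) - w x y * (σ x y *ᵛ v) a ∎
        where open ≈-Reasoning

      Δ-transport : ∀ s x a → Δ s x a ≈ deg x * s x a - sum λ y → w x y * (σ x y *ᵛ s y) a
      Δ-transport s x a = begin
        sum (λ y → laplacianBlock x y a ∙ s y)
          ≈⟨ sum-cong (λ y → laplacianBlock-∙ x y a (s y)) ⟩
        sum (λ y → I x y * (deg x * s y a) - w x y * (σ x y *ᵛ s y) a)
          ≈⟨ sum-sub (λ y → I x y * (deg x * s y a)) (λ y → w x y * (σ x y *ᵛ s y) a) ⟩
        I x ∙ (λ y → deg x * s y a) - sum (λ y → w x y * (σ x y *ᵛ s y) a)
          ≈⟨ +-congʳ (I-∙ x λ y → deg x * s y a) ⟩
        deg x * s x a - sum (λ y → w x y * (σ x y *ᵛ s y) a) ∎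
        where open ≈-Reasoning

      -- The covariant difference along the pair: the value at `y` is first transported into the
      -- fibre over `x`.
      gradient : Matrix n d → Fin n → Fin n → Vector d
      gradient s x y a = s x a - (σ x y *ᵛ s y) a

      Δ-gradient : ∀ s x a → Δ s x a ≈ sum λ y → w x y * gradient s x y a
      Δ-gradient s x a = begin
        Δ s x a
          ≈⟨ Δ-transport s x a ⟩
        deg x * s x a - sum (λ y → w x y * (σ x y *ᵛ s y) a)
          ≈⟨ +-congʳ (*-distribʳ-sum (s x a) (w x)) ⟩
        sum (λ y → w x y * s x a) - sum (λ y → w x y * (σ x y *ᵛ s y) a)
          ≈⟨ sum-sub (λ y → w x y * s x a) (λ y → w x y * (σ x y *ᵛ s y) a) ⟨
        sum (λ y → w x y * s x a - w x y * (σ x y *ᵛ s y) a)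
          ≈⟨ sum-cong (λ y → solve 3 (λ w s t → w :* s :- w :* t := w :* (s :- t)) refl (w x y) (s x a) ((σ x y *ᵛ s y) a)) ⟩
        sum (λ y → w x y * gradient s x y a) ∎
        where open ≈-Reasoning

      laplacian-*ᵛ : ∀ v x a → (connectionLaplacian G σ *ᵛ v) (combine x a) ≈ Δ (unflatten v) x a
      laplacian-*ᵛ v x a = trans (sum-combine n λ r → connectionLaplacian G σ (combine x a) r * v r)
        (sum-cong λ y → sum-cong λ b → *-congʳ (reflexive (fromBlocks-combine laplacianBlock x y a b)))

      laplacian-form : ∀ v → v ∙ (connectionLaplacian G σ *ᵛ v) ≈ ⟪ unflatten v , Δ (unflatten v) ⟫
      laplacian-form v = trans (∙-unflatten {n} v (connectionLaplacian G σ *ᵛ v))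
        (⟪⟫-cong (λ _ _ → refl) (laplacian-*ᵛ v))

      Parallel : Matrix n d → Set ℓ₁
      Parallel s = ∀ {x y} → Edge x y → ∀ a → s x a ≈ (σ x y *ᵛ s y) a

      parallel⇒Δ≈0 : ∀ {s} → Parallel s → ∀ x a → Δ s x a ≈ 0#
      parallel⇒Δ≈0 {s} s-par x a = trans (Δ-gradient s x a) (sum-zero λ y →
        trans (w-congˡ x y λ xy → x≈y⇒x-y≈0 (s-par xy a)) (zeroʳ _))

      parallel-vanishing : ∀ {s} → Parallel s → ∀ j → (∀ a → s j a ≈ 0#) → ∀ x a → s x a ≈ 0#
      parallel-vanishing {s} s-par j sj≈0 x = along (connected x j)
        where
        along : ∀ {x} → Star Edge x j → ∀ a → s x a ≈ 0#
        along ε                     = sj≈0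
        along (_◅_ {x} {y} xy path) a = trans (s-par xy a) (∙-zeroʳ (σ x y a) (along path))

      module _ (σ-sig : IsSignature G σ) where

        laplacianBlock-symmetric : ∀ x y a b → laplacianBlock x y a b ≈ laplacianBlock y x b a
        laplacianBlock-symmetric x y a b =
          trans (laplacian-entry x y a b) (trans (+-cong (diagonal x y) (-‿cong offDiagonal)) (sym (laplacian-entry y x b a)))
          where
          diagonal : ∀ x y → I x y * (deg x * I a b) ≈ I y x * (deg y * I b a)
          diagonal x y with x Fin.≟ y
          ... | yes ≡.refl = *-cong (sym (I-diagonal x)) (*-congˡ (I-symmetric a b))
          ... | no x≢y     = trans (zeroˡ _)
            (sym (trans (*-congʳ (I-offDiagonal λ y≡x → x≢y (≡.sym y≡x))) (zeroˡ _)))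
          offDiagonal : w x y * σ x y a b ≈ w y x * σ y x b a
          offDiagonal = trans (w-congˡ x y λ xy → sym (proj₂ (σ-sig x y xy) b a)) (*-congʳ (w-sym x y))

        connectionLaplacian-symmetric : Symmetric (connectionLaplacian G σ)
        connectionLaplacian-symmetric r s = laplacianBlock-symmetric
          (quotient d r) (quotient d s) (remainder {n} d r) (remainder {n} d s)

        Δ-selfAdjoint : ∀ f g → ⟪ f , Δ g ⟫ ≈ ⟪ Δ f , g ⟫
        Δ-selfAdjoint f g = begin
          ⟪ f , Δ g ⟫                                  ≈⟨ ⟪⟫-cong (unflat f) (λ x a → Δ-unflat g x a) ⟩
          ⟪ unflatten {n} u , unflatten (𝓛 *ᵛ v) ⟫         ≈⟨ ∙-unflatten {n} u (𝓛 *ᵛ v) ⟨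
          u ∙ (𝓛 *ᵛ v)                                 ≈⟨ symmetric-adjoint connectionLaplacian-symmetric u v ⟩
          (𝓛 *ᵛ u) ∙ v                                 ≈⟨ ∙-unflatten {n} (𝓛 *ᵛ u) v ⟩
          ⟪ unflatten {n} (𝓛 *ᵛ u) , unflatten v ⟫         ≈⟨ ⟪⟫-cong (λ x a → Δ-unflat f x a) (unflat g) ⟨
          ⟪ Δ f , g ⟫                                  ∎
          where
          open ≈-Reasoning
          𝓛 = connectionLaplacian G σ
          u = flatten f
          v = flatten g
          unflat : ∀ s x a → s x a ≈ unflatten (flatten s) x a
          unflat s x a = sym (reflexive (unflatten-flatten s x a))
          Δ-unflat : ∀ s x a → Δ s x a ≈ unflatten (𝓛 *ᵛ flatten s) x a
          Δ-unflat s x a = trans (Δ-cong (unflat s) x a) (sym (laplacian-*ᵛ (flatten s) x a))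

        energy : Matrix n d → ℝ
        energy s = sum λ x → sum λ y → w x y * (gradient s x y ∙ gradient s x y)

        -- The contributions of the two orientations of an edge complete a square: transport
        -- preserves the length of `s y`, and `σ y x` is its adjoint, so both mixed terms are the
        -- same product.
        gradient-square : ∀ s {x y} → Edge x y →
          s x ∙ gradient s x y + s y ∙ gradient s y x ≈ gradient s x y ∙ gradient s x y
        gradient-square s {x} {y} xy = begin
          s x ∙ gradient s x y + s y ∙ gradient s y x
            ≈⟨ +-cong (∙-distribˡ-sub (s x) (s x) v) (∙-distribˡ-sub (s y) (s y) (σ y x *ᵛ s x)) ⟩
          s x ∙ s x - s x ∙ v + (s y ∙ s y - s y ∙ (σ y x *ᵛ s x))
            ≈⟨ +-congˡ (+-cong (sym (orthogonal-isometry (proj₁ (σ-sig x y xy)) (s y) (s y))) (-‿cong yx)) ⟩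
          s x ∙ s x - s x ∙ v + (v ∙ v - v ∙ s x)
            ≈⟨ solve 4 (λ a b c e → a :- b :+ (c :- e) := a :- b :- (e :- c)) refl (s x ∙ s x) (s x ∙ v) (v ∙ v) (v ∙ s x) ⟩
          s x ∙ s x - s x ∙ v - (v ∙ s x - v ∙ v)
            ≈⟨ +-cong (trans (+-congˡ (-‿cong (∙-comm (s x) v))) (+-congˡ (-‿cong (∙-comm v (s x)))))
                 (-‿cong (∙-distribˡ-sub v (s x) v)) ⟨
          s x ∙ s x - s x ∙ v - v ∙ gradient s x y
            ≈⟨ +-cong (∙-distribˡ-sub (s x) (s x) v) (-‿cong (∙-comm (gradient s x y) v)) ⟨
          s x ∙ gradient s x y - gradient s x y ∙ v
            ≈⟨ +-congʳ (∙-comm (gradient s x y) (s x)) ⟨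
          gradient s x y ∙ s x - gradient s x y ∙ v
            ≈⟨ ∙-distribˡ-sub (gradient s x y) (s x) v ⟨
          gradient s x y ∙ gradient s x y ∎
          where
          open ≈-Reasoning
          v = σ x y *ᵛ s y
          yx : s y ∙ (σ y x *ᵛ s x) ≈ v ∙ s x
          yx = trans (∙-cong {v = σ y x *ᵛ s x} (λ _ → refl) λ b → ∙-cong (proj₂ (σ-sig x y xy) b) λ _ → refl)
            (adjoint (σ x y ᵀ) (s y) (s x))

        form-gradient : ∀ s → ⟪ s , Δ s ⟫ ≈ sum λ x → sum λ y → w x y * (s x ∙ gradient s x y)
        form-gradient s = sum-cong λ x → trans (∙-cong (λ _ → refl) (Δ-gradient s x))
          (trans (∙-sumʳ (s x) λ y a → w x y * gradient s x y a) (sum-cong λ y → ∙-scaleʳ (w x y) (s x) (gradient s x y)))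

        -- `energy` runs over ordered pairs and so counts each edge twice. Relabelling one copy of
        -- the double sum pairs each orientation with its reverse.
        2form≈energy : ∀ s → ⟪ s , Δ s ⟫ + ⟪ s , Δ s ⟫ ≈ energy s
        2form≈energy s = begin
          ⟪ s , Δ s ⟫ + ⟪ s , Δ s ⟫
            ≈⟨ +-cong (form-gradient s) (trans (form-gradient s) (trans (∑-comm λ x y → w x y * p x y)
                 (sum-cong λ x → sum-cong λ y → *-congʳ (w-sym y x)))) ⟩
          sum (λ x → sum λ y → w x y * p x y) + sum (λ x → sum λ y → w x y * p y x)
            ≈⟨ ∑-distrib-+ (λ x → sum λ y → w x y * p x y) (λ x → sum λ y → w x y * p y x) ⟨
          sum (λ x → sum (λ y → w x y * p x y) + sum λ y → w x y * p y x)
            ≈⟨ sum-cong (λ x → trans (sym (∑-distrib-+ (λ y → w x y * p x y) λ y → w x y * p y x))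
                 (sum-cong λ y → trans (sym (distribˡ (w x y) (p x y) (p y x))) (w-congˡ x y (gradient-square s)))) ⟩
          energy s ∎
          where
          open ≈-Reasoning
          p : Fin n → Fin n → ℝ
          p x y = s x ∙ gradient s x y

        energy-term-nonneg : ∀ s x y → 0# ≤ w x y * (gradient s x y ∙ gradient s x y)
        energy-term-nonneg s x y = *-nonneg (w≥0 x y) (square-norm-nonneg (gradient s x y))

        form-nonneg : ∀ s → 0# ≤ ⟪ s , Δ s ⟫
        form-nonneg s with ≤-total 0# ⟪ s , Δ s ⟫
        ... | inj₁ 0≤q = 0≤q
        -- Halving is avoided: the energy gives `0 ≤ q + q`, and `q ≤ 0` gives `q + q ≤ q`.
        ... | inj₂ q≤0 = ≤-trans (≤-trans (sum-nonneg λ x → sum-nonneg (energy-term-nonneg s x))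
          (≤-reflexive (sym (2form≈energy s)))) (≤-trans (+-monoˡ-≤ _ q≤0) (≤-reflexive (+-identityˡ _)))

        form≈0⇒parallel : ∀ s → ⟪ s , Δ s ⟫ ≈ 0# → Parallel s
        form≈0⇒parallel s q≈0 {x} {y} xy a = x-y≈0⇒x≈y _ _
          (square-norm≈0⇒≈0 (gradient s x y)
            (*-cancelˡ-≈ (<⇒≉ (edge⇒w>0 xy)) (trans term≈0 (sym (zeroʳ (w x y))))) a)
          where
          energy≈0 : energy s ≈ 0#
          energy≈0 = trans (sym (2form≈energy s)) (trans (+-cong q≈0 q≈0) (+-identityˡ 0#))
          term≈0 = sum≈0⇒term≈0 (energy-term-nonneg s x)
            (sum≈0⇒term≈0 (λ x → sum-nonneg (energy-term-nonneg s x)) energy≈0 x) y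

        connectionLaplacian-pseudoinverse : ∀ {r} → KernelHasDimension (connectionLaplacian G σ) r →
                                            ∃[ P ] IsPseudoinverse (connectionLaplacian G σ) P
        connectionLaplacian-pseudoinverse kernel = symmetric-semidefinite⇒pseudoinverse
          (connectionLaplacian G σ) connectionLaplacian-symmetric
          (λ v → ≤-trans (form-nonneg (unflatten v)) (≤-reflexive (sym (laplacian-form v))))
          -- A section of zero energy is parallel, and every gradient in the Laplacian of a parallel
          -- section vanishes.
          (λ v q≈0 → combine-induction {n} λ x a → trans (laplacian-*ᵛ v x a)
            (parallel⇒Δ≈0 (form≈0⇒parallel (unflatten v) (trans (sym (laplacian-form v)) q≈0)) x a))
          basis inKernel spanning
          where open KernelHasDimension kernel

-- A bijection of `Fin m` with the indices satisfying `P`. It is used for the complement of one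
-- vertex, where the Dirichlet problem lives, and of two, which the Schur complement eliminates.
record Enumerates {m n} (s : Fin m → Fin n) (P : Fin n → Set) : Set where
  field
    injective : ∀ {k l} → s k ≡ s l → k ≡ l
    sound     : ∀ k → P (s k)
    surjective : ∀ x → P x → ∃[ k ] s k ≡ x

lookup-injective : ∀ {A : Set} {xs : List A} → Unique xs → ∀ {k l} → lookup xs k ≡ lookup xs l → k ≡ l
lookup-injective (_ AllPairs.∷ _)       {zero}  {zero}  _  = ≡.refl
lookup-injective (x∉xs AllPairs.∷ _)    {zero}  {suc l} eq = contradiction eq (All.lookup x∉xs (∈-lookup l))
lookup-injective (x∉xs AllPairs.∷ _)    {suc k} {zero}  eq = contradiction (≡.sym eq) (All.lookup x∉xs (∈-lookup k))
lookup-injective (_ AllPairs.∷ unique)  {suc k} {suc l} eq = ≡.cong suc (lookup-injective unique eq)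

filter-enumerates : ∀ {n} {P : Fin n → Set} (P? : Decidable P) → Enumerates (lookup (filter P? (allFin n))) P
filter-enumerates {n} P? = record
  { injective = lookup-injective (Unique.filter⁺ P? (Unique.allFin⁺ n))
  ; sound     = λ k → proj₂ (∈-filter⁻ P? {xs = allFin n} (∈-lookup k))
  ; surjective = λ x Px → let x∈ = ∈-filter⁺ P? (∈-allFin x) Px in Any.index x∈ , ≡.sym (lookup-index x∈)
  }

-- Grounded Green functions and harmonic extensions.

module Potentials {c ℓ₁ ℓ₂} (𝓡 : Reals c ℓ₁ ℓ₂) where
  open Over 𝓡
  open OrderedField 𝓡
  open LinearAlgebra 𝓡
  open Sections 𝓡

  module Extension {m n} (s : Fin m → Fin n) {d : ℕ} where

    -- For injective `s` this is extension by zero. Writing it as a sum makes it the adjoint of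
    -- restriction along `s`, with no case distinction on whether `x` is in the image.
    extend : Matrix m d → Matrix n d
    extend y x a = sum λ k → I (s k) x * y k a

    extend-dual : ∀ y g → ⟪ extend y , g ⟫ ≈ ⟪ y , (λ k → g (s k)) ⟫
    extend-dual y g = begin
      sum (λ x → extend y x ∙ g x)
        ≈⟨ sum-cong (λ x → trans (∙-comm (extend y x) (g x)) (trans (∙-sumʳ (g x) λ k a → I (s k) x * y k a)
             (sum-cong λ k → trans (∙-scaleʳ (I (s k) x) (g x) (y k)) (*-congˡ (∙-comm (g x) (y k)))))) ⟩
      sum (λ x → sum λ k → I (s k) x * (y k ∙ g x))
        ≈⟨ ∑-comm (λ x k → I (s k) x * (y k ∙ g x)) ⟩
      sum (λ k → sum λ x → I (s k) x * (y k ∙ g x))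
        ≈⟨ sum-cong (λ k → I-∙ (s k) λ x → y k ∙ g x) ⟩
      sum (λ k → y k ∙ g (s k)) ∎
      where open ≈-Reasoning

    extend-outside : ∀ y {x} → (∀ k → s k ≢ x) → ∀ a → extend y x a ≈ 0#
    extend-outside y s≢x a = sum-zero λ k → trans (*-congʳ (I-offDiagonal (s≢x k))) (zeroˡ _)

    extend-inside : (∀ {k l} → s k ≡ s l → k ≡ l) → ∀ y k a → extend y (s k) a ≈ y k a
    extend-inside s-injective y k a = trans
      (sum-single (λ l → I (s l) (s k) * y l a) k λ l l≢k →
        trans (*-congʳ (I-offDiagonal λ eq → l≢k (s-injective eq))) (zeroˡ _))
      (trans (*-congʳ (I-diagonal (s k))) (*-identityˡ _))

  pointMass : ∀ {n d} → Fin n → Vector d → Matrix n d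
  pointMass i v x a = I x i * v a

  pointMass-dual : ∀ {n d} (f : Matrix n d) i v → ⟪ f , pointMass i v ⟫ ≈ f i ∙ v
  pointMass-dual f i v = trans
    (sum-cong λ x → trans (∙-scaleʳ (I x i) (f x) v) (*-congʳ (I-symmetric x i)))
    (I-∙ i λ x → f x ∙ v)

  ⟪⟫-distribˡ-+ : ∀ {n d} (f g h : Matrix n d) → ⟪ f , g +ᴹ h ⟫ ≈ ⟪ f , g ⟫ + ⟪ f , h ⟫
  ⟪⟫-distribˡ-+ f g h = trans (sum-cong λ x → ∙-distribˡ-+ (f x) (g x) (h x))
    (∑-distrib-+ (λ x → f x ∙ g x) λ x → f x ∙ h x)

  twoPoint : ∀ {n d} {i j : Fin n} → i ≢ j → (g : Matrix n d) →
             (∀ x → x ≢ i → x ≢ j → ∀ a → g x a ≈ 0#) → g ≈ᴹ pointMass i (g i) +ᴹ pointMass j (g j)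
  twoPoint {i = i} {j} i≢j g g≈0 x a with x Fin.≟ i | x Fin.≟ j
  ... | yes ≡.refl | yes ≡.refl = contradiction ≡.refl i≢j
  ... | yes ≡.refl | no _       = sym (trans (+-cong (*-identityˡ _) (zeroˡ _)) (+-identityʳ _))
  ... | no _       | yes ≡.refl = sym (trans (+-cong (zeroˡ _) (*-identityˡ _)) (+-identityˡ _))
  ... | no x≢i     | no x≢j     = trans (g≈0 x x≢i x≢j a) (sym (trans (+-cong (zeroˡ _) (zeroˡ _)) (+-identityˡ _)))

  -- Column `c` comes from the section with index `c`, so the Green function becomes a matrix that
  -- acts on source vectors.
  valueAt : ∀ {n d} → Fin n → (Fin d → Matrix n d) → Matrix d d
  valueAt x u a c = u c x a

  module PotentialTheory {n} (G : WeightedGraph n) where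
    open WeightedGraph G
    open ConnectionGraph G public

    -- Green functions are defined for arbitrary edge matrices, so that they can be built for
    -- `⨁ι¹ r` and for block sums straight from their equations.
    module GreenFunction {d} (σ : Signature n d) where
      open Laplacian σ

      Grounded : Fin n → Matrix n d → Set ℓ₁
      Grounded j u = ∀ a → u j a ≈ 0#

      -- The equation is left open at `j`, where the ground absorbs whatever flows in; `green-flux`
      -- identifies that flux.
      record IsGreen (i j : Fin n) (u : Fin d → Matrix n d) : Set ℓ₁ where
        field
          grounded : ∀ c → Grounded j (u c)
          source   : ∀ c x → x ≢ j → ∀ a → Δ (u c) x a ≈ pointMass i (I c) x a

    module Potential {d} (σ : Signature n d) (σ-sig : IsSignature G σ) where
      open Laplacian σ public
      open GreenFunction σ public

      𝓛 : Matrix (n ℕ.* d) (n ℕ.* d)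
      𝓛 = connectionLaplacian G σ

      module Restriction {m} (s : Fin m → Fin n) where
        open Extension s {d} public

        restriction : Matrix (m ℕ.* d) (m ℕ.* d)
        restriction = fromBlocks λ k l → block 𝓛 (s k) (s l)

        -- A principal submatrix is the Laplacian compressed to sections supported on the chosen
        -- vertices: the sum over these vertices is moved to all vertices by `extend-dual`.
        restriction-*ᵛ : ∀ v k a → (restriction *ᵛ v) (combine k a) ≈ Δ (extend (unflatten v)) (s k) a
        restriction-*ᵛ v k a = begin
          sum (λ r → restriction (combine k a) r * v r)
            ≈⟨ sum-combine m (λ r → restriction (combine k a) r * v r) ⟩
          ⟪ (λ l b → restriction (combine k a) (combine l b)) , unflatten {m} v ⟫
            ≈⟨ ⟪⟫-cong (λ l b → reflexive (≡.trans
                 (fromBlocks-combine (λ k l → block 𝓛 (s k) (s l)) k l a b)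
                 (fromBlocks-combine laplacianBlock (s k) (s l) a b))) (λ _ _ → refl) ⟩
          ⟪ (λ l → laplacianBlock (s k) (s l) a) , unflatten v ⟫
            ≈⟨ ⟪⟫-comm (λ l → laplacianBlock (s k) (s l) a) (unflatten v) ⟩
          ⟪ unflatten v , (λ l → laplacianBlock (s k) (s l) a) ⟫
            ≈⟨ extend-dual (unflatten v) (λ y → laplacianBlock (s k) y a) ⟨
          ⟪ extend (unflatten v) , (λ y → laplacianBlock (s k) y a) ⟫
            ≈⟨ ⟪⟫-comm (extend (unflatten v)) (λ y → laplacianBlock (s k) y a) ⟩
          Δ (extend (unflatten v)) (s k) a ∎
          where open ≈-Reasoning

        restriction-symmetric : Symmetric restriction
        restriction-symmetric r r′ = connectionLaplacian-symmetric σ-sig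
          (combine (s (quotient d r)) (remainder {m} d r)) (combine (s (quotient d r′)) (remainder {m} d r′))

        -- An omitted vertex `j` is what removes the kernel: the extension by zero of a null vector
        -- is parallel and vanishes at `j`, hence everywhere.
        restriction-anisotropic : (∀ {k l} → s k ≡ s l → k ≡ l) → ∀ {j} → (∀ k → s k ≢ j) → Anisotropic restriction
        restriction-anisotropic s-injective {j} s≢j v q≈0 = combine-induction {m} λ k a →
          trans (sym (extend-inside s-injective y k a))
            (parallel-vanishing (form≈0⇒parallel σ-sig (extend y) form≈0) j (extend-outside y s≢j) (s k) a)
          where
          y : Matrix m d
          y = unflatten v
          form≈0 : ⟪ extend y , Δ (extend y) ⟫ ≈ 0#
          form≈0 = begin
            ⟪ extend y , Δ (extend y) ⟫             ≈⟨ extend-dual y (Δ (extend y)) ⟩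
            ⟪ y , (λ k → Δ (extend y) (s k)) ⟫      ≈⟨ ⟪⟫-cong (λ _ _ → refl) (restriction-*ᵛ v) ⟨
            ⟪ y , unflatten (restriction *ᵛ v) ⟫    ≈⟨ ∙-unflatten {m} v (restriction *ᵛ v) ⟨
            v ∙ (restriction *ᵛ v)                  ≈⟨ q≈0 ⟩
            0#                                      ∎
            where open ≈-Reasoning

      dirichletProblem-on : ∀ {m j} {s : Fin m → Fin n} → Enumerates s (_≢ j) → (f : Matrix n d) →
        ∃[ u ] (Grounded j u × (∀ x → x ≢ j → ∀ a → Δ u x a ≈ f x a))
      dirichletProblem-on {m} {j} {s} away f = fromSolution (anisotropic⇒solvable restriction
        (restriction-anisotropic injective sound) (flatten f∘s))
        where
        open Enumerates away
        open Restriction s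
        f∘s : Matrix m d
        f∘s k = f (s k)
        fromSolution : ∃[ v ] (∀ r → (restriction *ᵛ v) r ≈ flatten f∘s r) →
          ∃[ u ] (Grounded j u × (∀ x → x ≢ j → ∀ a → Δ u x a ≈ f x a))
        fromSolution (v , Dv≈f) = extend y , extend-outside y sound , equation
          where
          y : Matrix m d
          y = unflatten v
          equation-inside : ∀ k a → Δ (extend y) (s k) a ≈ f (s k) a
          equation-inside k a = trans (sym (restriction-*ᵛ v k a))
            (trans (Dv≈f (combine k a)) (reflexive (unflatten-flatten f∘s k a)))
          equation : ∀ x → x ≢ j → ∀ a → Δ (extend y) x a ≈ f x a
          equation x x≢j a with surjective x x≢j
          ... | k , ≡.refl = equation-inside k a

      dirichletProblem : ∀ j (f : Matrix n d) →
        ∃[ u ] (Grounded j u × (∀ x → x ≢ j → ∀ a → Δ u x a ≈ f x a))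
      dirichletProblem j = dirichletProblem-on (filter-enumerates λ x → ¬? (x Fin.≟ j))

      green : ∀ i j → ∃ (IsGreen i j)
      green i j = (λ c → proj₁ (solution c)) , record
        { grounded = λ c → proj₁ (proj₂ (solution c))
        ; source   = λ c → proj₂ (proj₂ (solution c))
        }
        where solution = λ c → dirichletProblem j (pointMass i (I c))

      -- The index `b` selects the boundary vector at `j`, which makes `φ b i a` the entry in row
      -- `a` and column `b` of Ω⁰ᵢⱼ.
      record IsHarmonicExtension (j : Fin n) (φ : Fin d → Matrix n d) : Set ℓ₁ where
        field
          boundary : ∀ b a → φ b j a ≈ I b a
          harmonic : ∀ b x → x ≢ j → ∀ a → Δ (φ b) x a ≈ 0#

      harmonicExtension : ∀ j → ∃ (IsHarmonicExtension j)
      harmonicExtension j = (λ b → mass b +ᴹ u b) , record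
        { boundary = λ b a → trans
            (+-cong (trans (*-congʳ (I-diagonal j)) (*-identityˡ _)) (proj₁ (proj₂ (solution b)) a)) (+-identityʳ _)
        ; harmonic = λ b x x≢j a → trans (⟪⟫-distribˡ-+ (λ y → laplacianBlock x y a) (mass b) (u b))
            (trans (+-congˡ (proj₂ (proj₂ (solution b)) x x≢j a)) (-‿inverseʳ _))
        }
        where
        mass = λ b → pointMass j (I b)
        -- The boundary value is put in as a point mass at `j`; a grounded section then cancels its
        -- Laplacian elsewhere without changing the value at `j`.
        solution = λ b → dirichletProblem j (-ᴹ Δ (mass b))
        u = λ b → proj₁ (solution b)

      module _ {i j : Fin n} (i≢j : i ≢ j) {u} (u-green : IsGreen i j u) where
        open IsGreen u-green

        source-at : ∀ c a → Δ (u c) i a ≈ I c a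
        source-at c a = trans (source c i i≢j a) (trans (*-congʳ (I-diagonal i)) (*-identityˡ _))

        Δ-green : ∀ c → Δ (u c) ≈ᴹ pointMass i (I c) +ᴹ pointMass j (Δ (u c) j)
        Δ-green c x a = trans
          (twoPoint i≢j (Δ (u c)) (λ x x≢i x≢j a → trans (source c x x≢j a)
            (trans (*-congʳ (I-offDiagonal x≢i)) (zeroˡ _))) x a)
          (+-congʳ (*-congˡ (source-at c a)))

        green-dual : ∀ c f → ⟪ f , Δ (u c) ⟫ ≈ f i c + f j ∙ Δ (u c) j
        green-dual c f = begin
          ⟪ f , Δ (u c) ⟫
            ≈⟨ ⟪⟫-cong (λ _ _ → refl) (Δ-green c) ⟩
          ⟪ f , pointMass i (I c) +ᴹ pointMass j (Δ (u c) j) ⟫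
            ≈⟨ ⟪⟫-distribˡ-+ f (pointMass i (I c)) (pointMass j (Δ (u c) j)) ⟩
          ⟪ f , pointMass i (I c) ⟫ + ⟪ f , pointMass j (Δ (u c) j) ⟫
            ≈⟨ +-cong (trans (pointMass-dual f i (I c)) (trans (∙-comm (f i) (I c)) (I-∙ c (f i))))
                 (pointMass-dual f j (Δ (u c) j)) ⟩
          f i c + f j ∙ Δ (u c) j ∎
          where open ≈-Reasoning

        green-dual-grounded : ∀ c {f} → Grounded j f → ⟪ f , Δ (u c) ⟫ ≈ f i c
        green-dual-grounded c {f} fj≈0 = trans (green-dual c f)
          (trans (+-congˡ (∙-zeroˡ (Δ (u c) j) fj≈0)) (+-identityʳ _))

        -- Reciprocity: either side reads off the pairing of `u a` with `Δ (u c)`, which is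
        -- symmetric in `a` and `c`.
        green-symmetric : ∀ a c → u a i c ≈ u c i a
        green-symmetric a c = begin
          u a i c              ≈⟨ green-dual-grounded c (grounded a) ⟨
          ⟪ u a , Δ (u c) ⟫    ≈⟨ Δ-selfAdjoint σ-sig (u a) (u c) ⟩
          ⟪ Δ (u a) , u c ⟫    ≈⟨ ⟪⟫-comm (Δ (u a)) (u c) ⟩
          ⟪ u c , Δ (u a) ⟫    ≈⟨ green-dual-grounded a (grounded c) ⟩
          u c i a              ∎
          where open ≈-Reasoning

        -- Green's identity: Δ is self-adjoint, and ⟪ Δ (φ b) , u c ⟫ vanishes since Δ (φ b) lives at j, where u c is 0.
        green-flux : ∀ {φ} → IsHarmonicExtension j φ → ∀ c b → Δ (u c) j b ≈ - φ b i c
        green-flux {φ} φ-ext c b = begin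
          Δ (u c) j b                      ≈⟨ solve 2 (λ x y → y := :- x :+ (x :+ y)) refl (φ b i c) (Δ (u c) j b) ⟩
          - φ b i c + (φ b i c + Δ (u c) j b) ≈⟨ +-congˡ (+-congˡ (trans (∙-cong (boundary b) λ _ → refl) (I-∙ b (Δ (u c) j)))) ⟨
          - φ b i c + (φ b i c + φ b j ∙ Δ (u c) j) ≈⟨ +-congˡ (green-dual c (φ b)) ⟨
          - φ b i c + ⟪ φ b , Δ (u c) ⟫    ≈⟨ +-congˡ (Δ-selfAdjoint σ-sig (φ b) (u c)) ⟩
          - φ b i c + ⟪ Δ (φ b) , u c ⟫    ≈⟨ +-congˡ (sum-zero pairing) ⟩
          - φ b i c + 0#                   ≈⟨ +-identityʳ _ ⟩
          - φ b i c                        ∎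
          where
          open ≈-Reasoning
          open IsHarmonicExtension φ-ext
          pairing : ∀ x → Δ (φ b) x ∙ u c x ≈ 0#
          pairing x with x Fin.≟ j
          ... | yes ≡.refl = ∙-zeroʳ (Δ (φ b) x) (grounded c)
          ... | no x≢j     = ∙-zeroˡ (u c x) (harmonic b x x≢j)

-- Random walk: hitting times and convergence of the series for Ω⁰.

module RandomWalk {c ℓ₁ ℓ₂} (𝓡 : Reals c ℓ₁ ℓ₂) where
  open Over 𝓡
  open OrderedField 𝓡
  open LinearAlgebra 𝓡
  open Sections 𝓡
  open Potentials 𝓡

  minimum : ∀ {n} → Fin n → (f : Vector n) → ∃[ k ] (∀ l → f k ≤ f l)
  minimum {suc zero}    _ f = zero , λ { zero → ≤-refl }
  minimum {suc (suc n)} _ f with minimum zero (λ k → f (suc k))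
  ... | k , k-min with ≤-total (f zero) (f (suc k))
  ...   | inj₁ f0≤fk = zero , λ { zero → ≤-refl ; (suc l) → ≤-trans f0≤fk (k-min l) }
  ...   | inj₂ fk≤f0 = suc k , λ { zero → fk≤f0 ; (suc l) → k-min l }

  -- With `V` the mean, the right side minus the left is the variance, the `p`-weighted sum of the
  -- squared lengths of `v y - V`.
  jensen : ∀ {n d} {p : Vector n} → (∀ y → 0# ≤ p y) → sum p ≈ 1# → (v : Matrix n d) →
           (λ a → sum λ y → p y * v y a) ∙ (λ a → sum λ y → p y * v y a) ≤ sum λ y → p y * (v y ∙ v y)
  jensen {n} {d} {p} p≥0 Σp≈1 v = 0≤y-x⇒x≤y (begin
    0#
      ≤⟨ sum-nonneg (λ y → *-nonneg (p≥0 y) (square-norm-nonneg (D y))) ⟩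
    sum (λ y → p y * (D y ∙ D y))
      ≈⟨ sum-cong (λ y → trans (*-congˡ (expand y)) (solve 4 (λ p a b c →
           p :* (a :- b :- (b :- c)) := p :* a :- p :* b :- (p :* b :- p :* c)) refl (p y) (v y ∙ v y) (V ∙ v y) (V ∙ V))) ⟩
    sum (λ y → p y * (v y ∙ v y) - p y * (V ∙ v y) - (p y * (V ∙ v y) - p y * (V ∙ V)))
      ≈⟨ trans (sum-sub (λ y → p y * (v y ∙ v y) - p y * (V ∙ v y)) (λ y → p y * (V ∙ v y) - p y * (V ∙ V)))
           (+-cong (sum-sub (λ y → p y * (v y ∙ v y)) (λ y → p y * (V ∙ v y)))
             (-‿cong (sum-sub (λ y → p y * (V ∙ v y)) (λ y → p y * (V ∙ V))))) ⟩
    sum (λ y → p y * (v y ∙ v y)) - sum (λ y → p y * (V ∙ v y))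
      - (sum (λ y → p y * (V ∙ v y)) - sum (λ y → p y * (V ∙ V)))
      ≈⟨ +-cong (+-congˡ (-‿cong mean)) (-‿cong (trans (+-cong mean (-‿cong total)) (-‿inverseʳ (V ∙ V)))) ⟩
    sum (λ y → p y * (v y ∙ v y)) - V ∙ V - 0#
      ≈⟨ trans (+-congˡ -0#≈0#) (+-identityʳ _) ⟩
    sum (λ y → p y * (v y ∙ v y)) - V ∙ V ∎)
    where
    open ≤-Reasoning
    V : Vector d
    V a = sum λ y → p y * v y a
    D : Matrix n d
    D y a = v y a - V a
    expand : ∀ y → D y ∙ D y ≈ v y ∙ v y - V ∙ v y - (V ∙ v y - V ∙ V)
    expand y = trans (∙-distribˡ-sub (D y) (v y) V) (+-cong
      (trans (∙-comm (D y) (v y)) (trans (∙-distribˡ-sub (v y) (v y) V) (+-congˡ (-‿cong (∙-comm (v y) V)))))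
      (-‿cong (trans (∙-comm (D y) V) (∙-distribˡ-sub V (v y) V))))
    mean : sum (λ y → p y * (V ∙ v y)) ≈ V ∙ V
    mean = trans (sum-cong λ y → sym (∙-scaleʳ (p y) V (v y))) (sym (∙-sumʳ V λ y a → p y * v y a))
    total : sum (λ y → p y * (V ∙ V)) ≈ V ∙ V
    total = trans (sym (*-distribʳ-sum (V ∙ V) p)) (trans (*-congʳ Σp≈1) (*-identityˡ _))

  module Walk {n} (G : WeightedGraph n) where
    open WeightedGraph G
    open PotentialTheory G

    ι¹-isSignature : IsSignature G ι¹
    ι¹-isSignature x y _ = ((λ { zero zero → 1*1+0≈1 }) , λ { zero zero → 1*1+0≈1 }) , λ { zero zero → refl }
      where
      1*1+0≈1 : 1# * 1# + 0# ≈ 1#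
      1*1+0≈1 = trans (+-identityʳ _) (*-identityˡ 1#)

    sumOverPaths-cong : ∀ t {f g : Vec (Fin n) t → ℝ} → (∀ p → f p ≈ g p) → sumOverPaths G t f ≈ sumOverPaths G t g
    sumOverPaths-cong zero    f≈g = f≈g []
    sumOverPaths-cong (suc t) f≈g = sum-cong λ y → sumOverPaths-cong t λ p → f≈g (y ∷ p)

    sumOverPaths-zero : ∀ t {f : Vec (Fin n) t → ℝ} → (∀ p → f p ≈ 0#) → sumOverPaths G t f ≈ 0#
    sumOverPaths-zero zero    f≈0 = f≈0 []
    sumOverPaths-zero (suc t) f≈0 = sum-zero λ y → sumOverPaths-zero t λ p → f≈0 (y ∷ p)

    sumOverPaths-linear : ∀ t {m} (s : Vector m) (f : Fin m → Vec (Fin n) t → ℝ) →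
      sumOverPaths G t (λ p → s ∙ (λ k → f k p)) ≈ s ∙ (λ k → sumOverPaths G t (f k))
    sumOverPaths-linear zero    s f = refl
    sumOverPaths-linear (suc t) s f = trans
      (sum-cong λ y → sumOverPaths-linear t s λ k p → f k (y ∷ p))
      (sym (∙-sumʳ s λ y k → sumOverPaths G t λ p → f k (y ∷ p)))

    -- A path from `x` to a different vertex starts with an edge, whose weight is one of the terms
    -- of `deg x`.
    deg-pos : ∀ {x j} → x ≢ j → 0# < deg x
    deg-pos {x} {j} x≢j = firstEdge (connected x j)
      where
      firstEdge : Star Edge x j → 0# < deg x
      firstEdge ε               = contradiction ≡.refl x≢j
      firstEdge (_◅_ {_} {y} xy _) = <-≤-trans (edge⇒w>0 xy) (term≤sum (w≥0 x) y)

    module Away {x j : Fin n} (x≢j : x ≢ j) where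
      deg≉0 : ¬ (deg x ≈ 0#)
      deg≉0 = <⇒≉ (deg-pos x≢j)

      deg⁻¹-inverse : deg x ⁻¹ * deg x ≈ 1#
      deg⁻¹-inverse = trans (*-comm _ _) (⁻¹-inverse deg≉0)

      transition-nonneg : ∀ y → 0# ≤ transition G x y
      transition-nonneg y = *-nonneg (w≥0 x y) (⁻¹-nonneg (deg-pos x≢j))

      transition-total : sum (transition G x) ≈ 1#
      transition-total = trans (sym (*-distribʳ-sum (deg x ⁻¹) (w x))) (⁻¹-inverse deg≉0)

      transition-congˡ : ∀ y {u v} → (Edge x y → u ≈ v) → transition G x y * u ≈ transition G x y * v
      transition-congˡ y {u} {v} u≈v = trans (rearrange u) (trans (w-congˡ x y λ xy → *-congˡ (u≈v xy)) (sym (rearrange v)))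
        where
        rearrange : ∀ u → transition G x y * u ≈ w x y * (deg x ⁻¹ * u)
        rearrange u = *-assoc (w x y) (deg x ⁻¹) u

      -- The equation for `Δ` divided by the degree. Where `Δ s` vanishes, it says that `s` is the
      -- expectation of its transported value after one step; where `Δ s` is the degree, each step
      -- costs one unit of time.
      meanValue : ∀ {d} (σ : Signature n d) s a → let open Laplacian σ in
        s x a ≈ deg x ⁻¹ * Δ s x a + sum λ y → transition G x y * (σ x y *ᵛ s y) a
      meanValue σ s a = begin
        s x a
          ≈⟨ trans (*-congʳ deg⁻¹-inverse) (*-identityˡ _) ⟨
        deg x ⁻¹ * deg x * s x a
          ≈⟨ solve 4 (λ i d s t → i :* d :* s := i :* (d :* s :- t) :+ i :* t) refl (deg x ⁻¹) (deg x) (s x a) flow ⟩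
        deg x ⁻¹ * (deg x * s x a - flow) + deg x ⁻¹ * flow
          ≈⟨ +-cong (*-congˡ (sym (Δ-transport s x a))) (trans (*-distribˡ-sum (deg x ⁻¹) λ y → w x y * (σ x y *ᵛ s y) a)
               (sum-cong λ y → solve 3 (λ i w v → i :* (w :* v) := w :* i :* v) refl (deg x ⁻¹) (w x y) ((σ x y *ᵛ s y) a))) ⟩
        deg x ⁻¹ * Δ s x a + sum (λ y → transition G x y * (σ x y *ᵛ s y) a) ∎
        where
        open ≈-Reasoning
        open Laplacian σ
        flow = sum λ y → w x y * (σ x y *ᵛ s y) a

    -- h x is the expected time at which the walk from x hits j; it is the Lyapunov function
    -- that makes the hitting series converge.
    record HittingTime (j : Fin n) : Set (c ⊔ ℓ₁ ⊔ ℓ₂) where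
      field
        h        : Vector n
        h-target : h j ≈ 0#
        h-step   : ∀ x → x ≢ j → h x ≈ 1# + transition G x ∙ h

      -- Minimum principle: at a minimum `k` other than `j` the average over the next step is at
      -- least `h k`, and the equation would give `h k ≥ 1 + h k`.
      h-nonneg : ∀ x → 0# ≤ h x
      h-nonneg x with minimum x h
      ... | k , k-min with k Fin.≟ j
      ...   | yes ≡.refl = ≤-trans (≤-reflexive (sym h-target)) (k-min x)
      ...   | no k≢j     = contradiction (<-≤-trans (begin-strict
        h k                                          ≈⟨ +-identityˡ (h k) ⟨
        0# + h k                                     <⟨ +-monoˡ-< (h k) 0<1 ⟩
        1# + h k                                     ≈⟨ +-congˡ (trans (*-congʳ transition-total) (*-identityˡ _)) ⟨
        1# + sum (transition G k) * h k              ≈⟨ +-congˡ (*-distribʳ-sum (h k) (transition G k)) ⟩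
        1# + sum (λ y → transition G k y * h k)      ≤⟨ +-monoʳ-≤ 1# (sum-mono-≤ λ y → *-monoˡ-≤ (transition-nonneg y) (k-min y)) ⟩
        1# + transition G k ∙ h                      ≈⟨ h-step k k≢j ⟨
        h k                                          ∎) ≤-refl) (<-irrefl refl)
        where
        open ≤-Reasoning
        open Away k≢j

      h≥1 : ∀ x → x ≢ j → 1# ≤ h x
      h≥1 x x≢j = begin
        1#                             ≈⟨ +-identityʳ 1# ⟨
        1# + 0#                        ≤⟨ +-monoʳ-≤ 1# (sum-nonneg λ y → *-nonneg (transition-nonneg y) (h-nonneg y)) ⟩
        1# + transition G x ∙ h        ≈⟨ h-step x x≢j ⟨
        h x                            ∎
        where
        open ≤-Reasoning
        open Away x≢j

      -- The summand `1#` keeps the bound positive even where `h` vanishes identically, as on a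
      -- single vertex.
      bound : ℝ
      bound = 1# + sum h

      h≤bound : ∀ x → h x ≤ bound
      h≤bound x = ≤-trans (term≤sum h-nonneg x)
        (≤-trans (≤-reflexive (sym (+-identityˡ _))) (+-monoˡ-≤ (sum h) (<⇒≤ 0<1)))

      bound-pos : 0# < bound
      bound-pos = +-pos-nonneg 0<1 (sum-nonneg h-nonneg)

    hittingTime : ∀ j → HittingTime j
    hittingTime j = record
      { h        = λ x → s x zero
      ; h-target = proj₁ (proj₂ solution) zero
      ; h-step   = λ x x≢j → let open Away x≢j in trans (meanValue ι¹ s zero) (+-cong
          (trans (*-congˡ (proj₂ (proj₂ solution) x x≢j zero)) deg⁻¹-inverse)
          (∙-cong {u = transition G x} {v = λ y → (ι¹ x y *ᵛ s y) zero} {v′ = λ y → s y zero} (λ _ → refl)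
            λ y → trans (+-identityʳ _) (*-identityˡ _)))
      }
      where
      open Potential ι¹ ι¹-isSignature using (dirichletProblem)
      -- The source `deg x` becomes the constant 1 of `h-step` after division by the degree.
      solution = dirichletProblem j λ x _ → deg x
      s = proj₁ solution

    -- A nonnegative quantity that vanishes at `j` and does not exceed its own one-step average off
    -- `j` decays at least like 1/m, because `scale m` times it stays below a fixed multiple of `h`.
    module Decay {j} (time : HittingTime j) (u : ℕ → Vector n) (u-nonneg : ∀ m x → 0# ≤ u m x)
                 (u-target : ∀ m → u m j ≈ 0#)
                 (u-step : ∀ m x → x ≢ j → u (suc m) x ≤ transition G x ∙ u m) where
      open HittingTime time

      -- The constant that starts the induction: `u 0 x` is at most the sum of `u 0`, and `h x` is
      -- at least 1 away from `j`.
      K : ℝ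
      K = bound * sum (u 0)

      K-nonneg : 0# ≤ K
      K-nonneg = *-nonneg (<⇒≤ bound-pos) (sum-nonneg (u-nonneg 0))

      scale : ℕ → ℝ
      scale m = bound + fromℕ m

      scale-pos : ∀ m → 0# < scale m
      scale-pos m = +-pos-nonneg bound-pos (fromℕ-nonneg m)

      decay-at-target : ∀ m → scale m * u m j ≤ K * h j
      decay-at-target m = ≤-reflexive (trans (trans (*-congˡ (u-target m)) (zeroʳ _))
        (sym (trans (*-congˡ h-target) (zeroʳ K))))

      -- With A = bound + m, the inequality (A + 1) (h - 1) ≤ A h holds because h ≤ bound ≤ A + 1.
      decay : ∀ m x → scale m * u m x ≤ K * h x
      decay zero x with x Fin.≟ j
      ... | yes ≡.refl = decay-at-target 0
      ... | no x≢j     = begin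
        (bound + 0#) * u 0 x   ≈⟨ *-congʳ (+-identityʳ bound) ⟩
        bound * u 0 x          ≤⟨ *-monoˡ-≤ (<⇒≤ bound-pos) (term≤sum (u-nonneg 0) x) ⟩
        K                      ≈⟨ *-identityʳ K ⟨
        K * 1#                 ≤⟨ *-monoˡ-≤ K-nonneg (h≥1 x x≢j) ⟩
        K * h x                ∎
        where open ≤-Reasoning
      decay (suc m) x with x Fin.≟ j
      ... | yes ≡.refl = decay-at-target (suc m)
      -- The extra factor `A` lets the induction hypothesis be inserted inside the average without
      -- division.
      ... | no x≢j     = *-cancelˡ-≤ (scale-pos m) (begin
        A * (scale (suc m) * u (suc m) x)
          ≤⟨ *-monoˡ-≤ (<⇒≤ (scale-pos m)) (*-monoˡ-≤ (<⇒≤ (scale-pos (suc m))) (u-step m x x≢j)) ⟩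
        A * (scale (suc m) * (transition G x ∙ u m))
          ≈⟨ trans (solve 3 (λ a b t → a :* (b :* t) := b :* (a :* t)) refl A (scale (suc m)) (transition G x ∙ u m))
               (*-congˡ (sym (∙-scaleʳ A (transition G x) (u m)))) ⟩
        scale (suc m) * (transition G x ∙ (λ y → A * u m y))
          ≤⟨ *-monoˡ-≤ (<⇒≤ (scale-pos (suc m))) (sum-mono-≤ λ y → *-monoˡ-≤ (transition-nonneg y) (decay m y)) ⟩
        scale (suc m) * (transition G x ∙ (λ y → K * h y))
          ≈⟨ *-congˡ (∙-scaleʳ K (transition G x) h) ⟩
        scale (suc m) * (K * (transition G x ∙ h))
          ≤⟨ 0≤y-x⇒x≤y (≤-trans (*-nonneg K-nonneg (+-nonneg (fromℕ-nonneg (suc m)) (x≤y⇒0≤y-x (h≤bound x))))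
               (≤-reflexive slack)) ⟩
        A * (K * h x) ∎)
        where
        open ≤-Reasoning
        open Away x≢j
        A = scale m
        -- The difference of the last two expressions is `K * (A + 1 - h x)`; splitting `A + 1` as
        -- `fromℕ (suc m)` plus `bound` leaves two nonnegative terms.
        slack : K * (fromℕ (suc m) + (bound - h x)) ≈ A * (K * h x) - scale (suc m) * (K * (transition G x ∙ h))
        slack = trans (*-congˡ (+-congˡ (+-congˡ (-‿cong (h-step x x≢j)))))
          (trans (solve 4 (λ k f b q → k :* (con (ℤ.+ 1) :+ f :+ (b :- (con (ℤ.+ 1) :+ q))) :=
            (b :+ f) :* (k :* (con (ℤ.+ 1) :+ q)) :- (b :+ (con (ℤ.+ 1) :+ f)) :* (k :* q))
            refl K (fromℕ m) bound (transition G x ∙ h))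
            (+-congʳ (*-congˡ (*-congˡ (sym (h-step x x≢j))))))

      eventually-small : ∀ δ → 0# < δ → ∃[ N ] (∀ m → N ℕ.≤ m → ∀ x → u m x < δ)
      eventually-small δ 0<δ = M , λ m M≤m x → *-cancelˡ-< (scale-pos m) (begin-strict
        scale m * u m x        ≤⟨ decay m x ⟩
        K * h x                ≤⟨ *-monoˡ-≤ K-nonneg (h≤bound x) ⟩
        K * bound              ≈⟨ trans (*-congˡ (⁻¹-inverse (<⇒≉ 0<δ))) (*-identityʳ _) ⟨
        K * bound * (δ * δ ⁻¹) ≈⟨ solve 3 (λ k d i → k :* (d :* i) := d :* (k :* i)) refl (K * bound) δ (δ ⁻¹) ⟩
        δ * (K * bound * δ ⁻¹) <⟨ *-monoˡ-< 0<δ (proj₂ arch) ⟩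
        δ * fromℕ M            ≤⟨ *-monoˡ-≤ (<⇒≤ 0<δ) (fromℕ-mono-≤ M≤m) ⟩
        δ * fromℕ m            ≈⟨ *-congˡ (+-identityˡ _) ⟨
        δ * (0# + fromℕ m)     ≤⟨ *-monoˡ-≤ (<⇒≤ 0<δ) (+-monoˡ-≤ (fromℕ m) (<⇒≤ bound-pos)) ⟩
        δ * scale m            ≈⟨ *-comm δ (scale m) ⟩
        scale m * δ            ∎)
        where
        open ≤-Reasoning
        -- `M` exceeds `K * bound / δ`. Replacing `h x` by `bound` beforehand makes the threshold
        -- independent of `x`.
        arch = archimedean (K * bound * δ ⁻¹)
        M = proj₁ arch

    module Hitting {d} (σ : Signature n d) (σ-sig : IsSignature G σ) (j : Fin n) where
      open Potential σ σ-sig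

      hittingTerm-zero : ∀ x a b → hittingTerm G σ x j 0 a b ≈ I x j * I a b
      hittingTerm-zero x a b with x Fin.≟ j
      ... | yes _ = refl
      ... | no _  = sym (zeroˡ _)

      hittingTerm-suc-target : ∀ t a b → hittingTerm G σ j j (suc t) a b ≈ 0#
      hittingTerm-suc-target t a b = sumOverPaths-zero (suc t) stopped
        where
        stopped : ∀ (p : Vec (Fin n) (suc t)) →
          (if hitsFirstAtEnd G j j p then probability G j p * signatureProduct G σ j p a b else 0#) ≈ 0#
        stopped (y ∷ p) with j Fin.≟ j
        ... | yes _   = refl
        ... | no j≢j  = contradiction ≡.refl j≢j

      -- First-step analysis: stopping test, probability and signature product of a path all split
      -- off the first edge, and what remains is linear in the sum over its continuations.
      hittingTerm-suc : ∀ x → x ≢ j → ∀ t a b → hittingTerm G σ x j (suc t) a b ≈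
        sum λ y → transition G x y * (σ x y *ᵛ (λ c → hittingTerm G σ y j t c b)) a
      hittingTerm-suc x x≢j t a b = sum-cong λ y → begin
        sumOverPaths G t (λ p → if not ⌊ x Fin.≟ j ⌋ ∧ hitsFirstAtEnd G j y p
          then transition G x y * probability G y p * (σ x y *ᴹ signatureProduct G σ y p) a b else 0#)
          ≈⟨ sumOverPaths-cong t (firstStep y) ⟩
        sumOverPaths G t (λ p → (λ c → transition G x y * σ x y a c) ∙ term y p)
          ≈⟨ sumOverPaths-linear t (λ c → transition G x y * σ x y a c) (λ c p → term y p c) ⟩
        (λ c → transition G x y * σ x y a c) ∙ (λ c → hittingTerm G σ y j t c b)
          ≈⟨ ∙-scaleˡ (transition G x y) (σ x y a) (λ c → hittingTerm G σ y j t c b) ⟩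
        transition G x y * (σ x y *ᵛ (λ c → hittingTerm G σ y j t c b)) a ∎
        where
        open ≈-Reasoning
        term : ∀ y → Vec (Fin n) t → Vector d
        term y p c = if hitsFirstAtEnd G j y p then probability G y p * signatureProduct G σ y p c b else 0#

        firstStep : ∀ y p → (if not ⌊ x Fin.≟ j ⌋ ∧ hitsFirstAtEnd G j y p
          then transition G x y * probability G y p * (σ x y *ᴹ signatureProduct G σ y p) a b else 0#) ≈
          (λ c → transition G x y * σ x y a c) ∙ term y p
        firstStep y p with x Fin.≟ j | hitsFirstAtEnd G j y p
        ... | yes x≡j | _     = contradiction x≡j x≢j
        ... | no _    | false = sym (∙-zeroʳ (λ c → transition G x y * σ x y a c) λ _ → refl)
        ... | no _    | true  = trans (*-distribˡ-sum (transition G x y * probability G y p) λ c → σ x y a c * signatureProduct G σ y p c b)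
          (sum-cong λ c → solve 4 (λ t p s q → t :* p :* (s :* q) := t :* s :* (p :* q)) refl
            (transition G x y) (probability G y p) (σ x y a c) (signatureProduct G σ y p c b))

      partialSum : ℕ → Fin d → Matrix n d
      partialSum m b x a = sum {m} λ t → hittingTerm G σ x j (toℕ t) a b

      partialSum-target : ∀ m b a → partialSum (suc m) b j a ≈ I a b
      partialSum-target m b a = trans (+-cong
        (trans (hittingTerm-zero j a b) (trans (*-congʳ (I-diagonal j)) (*-identityˡ _)))
        (sum-zero {m} λ t → hittingTerm-suc-target (toℕ t) a b)) (+-identityʳ _)

      -- Off `j` the term for time 0 vanishes, so the other `m` terms are one step of the walk
      -- followed by the first `m` terms.
      partialSum-step : ∀ m b x → x ≢ j → ∀ a →
        partialSum (suc m) b x a ≈ sum λ y → transition G x y * (σ x y *ᵛ partialSum m b y) a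
      partialSum-step m b x x≢j a = begin
        hittingTerm G σ x j 0 a b + sum {m} (λ t → hittingTerm G σ x j (suc (toℕ t)) a b)
          ≈⟨ +-cong (trans (hittingTerm-zero x a b) (trans (*-congʳ (I-offDiagonal x≢j)) (zeroˡ _)))
               (sum-cong {m} λ t → hittingTerm-suc x x≢j (toℕ t) a b) ⟩
        0# + sum {m} (λ t → transition G x ∙ (λ y → (σ x y *ᵛ H t y) a))
          ≈⟨ +-identityˡ _ ⟩
        sum {m} (λ t → transition G x ∙ (λ y → (σ x y *ᵛ H t y) a))
          ≈⟨ ∙-sumʳ {m} (transition G x) (λ t y → (σ x y *ᵛ H t y) a) ⟨
        transition G x ∙ (λ y → sum {m} λ t → (σ x y *ᵛ H t y) a)
          ≈⟨ ∙-cong {u = transition G x} (λ _ → refl) (λ y → ∙-sumʳ {m} (σ x y a) (λ t c → H t y c)) ⟨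
        sum (λ y → transition G x y * (σ x y *ᵛ partialSum m b y) a) ∎
        where
        open ≈-Reasoning
        H : Fin m → Matrix n d
        H t y c = hittingTerm G σ y j (toℕ t) c b

      module _ {φ} (φ-ext : IsHarmonicExtension j φ) (b : Fin d) where
        open IsHarmonicExtension φ-ext

        error : ℕ → Matrix n d
        error m x a = partialSum m b x a - φ b x a

        error-target : ∀ m a → error (suc m) j a ≈ 0#
        error-target m a = x≈y⇒x-y≈0 (trans (partialSum-target m b a)
          (trans (I-symmetric a b) (sym (boundary b a))))

        -- Partial sums and harmonic extension obey the same one-step recursion off `j`, so their
        -- difference has no source.
        error-step : ∀ m x → x ≢ j → ∀ a →
          error (suc m) x a ≈ sum λ y → transition G x y * (σ x y *ᵛ error m y) a
        error-step m x x≢j a = begin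
          partialSum (suc m) b x a - φ b x a
            ≈⟨ +-cong (partialSum-step m b x x≢j a) (-‿cong (trans (meanValue σ (φ b) a)
                 (trans (+-congʳ (trans (*-congˡ (harmonic b x x≢j a)) (zeroʳ _))) (+-identityˡ _)))) ⟩
          transition G x ∙ (λ y → (σ x y *ᵛ partialSum m b y) a) - transition G x ∙ (λ y → (σ x y *ᵛ φ b y) a)
            ≈⟨ ∙-distribˡ-sub (transition G x) (λ y → (σ x y *ᵛ partialSum m b y) a) (λ y → (σ x y *ᵛ φ b y) a) ⟨
          transition G x ∙ (λ y → (σ x y *ᵛ partialSum m b y) a - (σ x y *ᵛ φ b y) a)
            ≈⟨ ∙-cong {u = transition G x} (λ _ → refl) (λ y → ∙-distribˡ-sub (σ x y a) (partialSum m b y) (φ b y)) ⟨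
          sum (λ y → transition G x y * (σ x y *ᵛ error m y) a) ∎
          where
          open ≈-Reasoning
          open Away x≢j

        squaredError : ℕ → Vector n
        squaredError m x = error m x ∙ error m x

        -- The transports mix the entries of the error, so single entries obey no comparison with
        -- their averages. The squared length does: `jensen` bounds the squared mean, and then the
        -- transports drop out as isometries.
        squaredError-step : ∀ m x → x ≢ j → squaredError (suc m) x ≤ transition G x ∙ squaredError m
        squaredError-step m x x≢j = begin
          squaredError (suc m) x
            ≈⟨ ∙-cong (error-step m x x≢j) (error-step m x x≢j) ⟩
          (λ a → sum λ y → transition G x y * (σ x y *ᵛ error m y) a) ∙
            (λ a → sum λ y → transition G x y * (σ x y *ᵛ error m y) a)
            ≤⟨ jensen transition-nonneg transition-total (λ y → σ x y *ᵛ error m y) ⟩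
          sum (λ y → transition G x y * ((σ x y *ᵛ error m y) ∙ (σ x y *ᵛ error m y)))
            ≈⟨ sum-cong (λ y → transition-congˡ y λ xy →
                 orthogonal-isometry (proj₁ (σ-sig x y xy)) (error m y) (error m y)) ⟩
          transition G x ∙ squaredError m ∎
          where
          open ≤-Reasoning
          open Away x≢j

        -- Shifted by one: the empty partial sum is zero at `j`, and the error there vanishes only
        -- once the term for time 0 is included. The `suc M` below undoes the shift.
        open Decay (hittingTime j) (λ m → squaredError (suc m)) (λ m x → square-norm-nonneg (error (suc m) x))
          (λ m → ∙-zeroˡ (error (suc m) j) (error-target m)) (λ m → squaredError-step (suc m)) using (eventually-small)

        hittingSeries-converges : ∀ x a → ConvergesTo (λ m → partialSum m b x a) (φ b x a)
        hittingSeries-converges x a δ 0<δ = suc M , λ { (suc m) (ℕ.s≤s M≤m) → close m (small m M≤m x) }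
          where
          eventually = eventually-small (δ * δ) (*-pos 0<δ 0<δ)
          M = proj₁ eventually
          small = proj₂ eventually
          close : ∀ m → squaredError (suc m) x < δ * δ → ∣ partialSum (suc m) b x a - φ b x a ∣< δ
          close m err<δ² = square-<-cancel 0<δ e²<δ² ,
            square-<-cancel 0<δ (<-respˡ-≈ (solve 2 (λ x y → (x :- y) :* (x :- y) := (y :- x) :* (y :- x)) refl
              (partialSum (suc m) b x a) (φ b x a)) e²<δ²)
            where
            e²<δ² = ≤-<-trans (term≤sum (λ a → square-nonneg (error (suc m) x a)) a) err<δ²

      isΩ⁰ : ∀ {φ} → IsHarmonicExtension j φ → ∀ i → IsΩ⁰ G σ i j (λ a b → φ b i a)
      isΩ⁰ φ-ext i a b = hittingSeries-converges φ-ext b i a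

-- Energies of dipole potentials, and traces of block sums.

module Resistances {c ℓ₁ ℓ₂} (𝓡 : Reals c ℓ₁ ℓ₂) where
  open Over 𝓡
  open OrderedField 𝓡
  open LinearAlgebra 𝓡
  open Sections 𝓡
  open Potentials 𝓡
  open RandomWalk 𝓡

  -- For `v` in the image of a symmetric `M`, the product of `v` with a preimage is the same for
  -- every preimage. The preimage `P v` can therefore be traded for an explicit `u`, here a Green
  -- function.
  module PseudoinverseSolution {m} {M P : Matrix m m} (M-sym : Symmetric M) (P-pinv : IsPseudoinverse M P)
                               {u v : Vector m} (v≈Mu : ∀ a → v a ≈ (M *ᵛ u) a) where
    open IsPseudoinverse P-pinv

    image-fixed : ∀ a → (M *ᵛ (P *ᵛ v)) a ≈ v a
    image-fixed a = begin
      (M *ᵛ (P *ᵛ v)) a           ≈⟨ *ᵛ-congˡ M (*ᵛ-congˡ P v≈Mu) a ⟩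
      (M *ᵛ (P *ᵛ (M *ᵛ u))) a    ≈⟨ *ᵛ-assoc M P (M *ᵛ u) a ⟨
      (M *ᴹ P *ᵛ (M *ᵛ u)) a      ≈⟨ *ᵛ-assoc (M *ᴹ P) M u a ⟨
      (M *ᴹ P *ᴹ M *ᵛ u) a        ≈⟨ ∙-cong (APA≈A a) (λ _ → refl) ⟩
      (M *ᵛ u) a                  ≈⟨ v≈Mu a ⟨
      v a                         ∎
      where open ≈-Reasoning

    quadraticForm : v ∙ (P *ᵛ v) ≈ v ∙ u
    quadraticForm = begin
      v ∙ (P *ᵛ v)                ≈⟨ ∙-cong v≈Mu (λ _ → refl) ⟩
      (M *ᵛ u) ∙ (P *ᵛ v)         ≈⟨ symmetric-adjoint M-sym u (P *ᵛ v) ⟨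
      u ∙ (M *ᵛ (P *ᵛ v))         ≈⟨ ∙-cong {u = u} (λ _ → refl) image-fixed ⟩
      u ∙ v                       ≈⟨ ∙-comm u v ⟩
      v ∙ u                       ∎
      where open ≈-Reasoning

    energyForm : (P *ᵛ v) ∙ (M *ᵛ (P *ᵛ v)) ≈ v ∙ u
    energyForm = trans (∙-cong {u = P *ᵛ v} (λ _ → refl) image-fixed) (trans (∙-comm (P *ᵛ v) v) quadraticForm)

  ↑-induction : ∀ {p q ℓ} {P : Fin (p ℕ.+ q) → Set ℓ} → (∀ a → P (a ↑ˡ q)) → (∀ b → P (p ↑ʳ b)) → ∀ r → P r
  ↑-induction {p} {q} {P = P} left right r = ≡.subst P (Fin.join-splitAt p q r) (cases (splitAt p r))
    where
    cases : ∀ s → P (join p q s)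
    cases (inj₁ a) = left a
    cases (inj₂ b) = right b

  ↑ˡ≢↑ʳ : ∀ {p q} (a : Fin p) (b : Fin q) → a ↑ˡ q ≢ p ↑ʳ b
  ↑ˡ≢↑ʳ {p} {q} a b eq with ≡.trans (≡.sym (Fin.splitAt-↑ˡ p a q)) (≡.trans (≡.cong (splitAt p) eq) (Fin.splitAt-↑ʳ p q b))
  ... | ()

  I-↑ˡ : ∀ {p} q (a b : Fin p) → I (a ↑ˡ q) (b ↑ˡ q) ≈ I a b
  I-↑ˡ q a b with a Fin.≟ b
  ... | yes ≡.refl = I-diagonal (a ↑ˡ q)
  ... | no a≢b     = I-offDiagonal λ eq → a≢b (Fin.↑ˡ-injective q a b eq)

  I-↑ʳ : ∀ p {q} (a b : Fin q) → I (p ↑ʳ a) (p ↑ʳ b) ≈ I a b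
  I-↑ʳ p a b with a Fin.≟ b
  ... | yes ≡.refl = I-diagonal (p ↑ʳ a)
  ... | no a≢b     = I-offDiagonal λ eq → a≢b (Fin.↑ʳ-injective p a b eq)

  module _ {p q} (A : Matrix p p) (B : Matrix q q) where
    ⊕-ˡˡ : ∀ a b → (A ⊕ᴹ B) (a ↑ˡ q) (b ↑ˡ q) ≡ A a b
    ⊕-ˡˡ a b rewrite Fin.splitAt-↑ˡ p a q | Fin.splitAt-↑ˡ p b q = ≡.refl

    ⊕-ˡʳ : ∀ a b → (A ⊕ᴹ B) (a ↑ˡ q) (p ↑ʳ b) ≡ 0#
    ⊕-ˡʳ a b rewrite Fin.splitAt-↑ˡ p a q | Fin.splitAt-↑ʳ p q b = ≡.refl

    ⊕-ʳˡ : ∀ a b → (A ⊕ᴹ B) (p ↑ʳ a) (b ↑ˡ q) ≡ 0#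
    ⊕-ʳˡ a b rewrite Fin.splitAt-↑ʳ p q a | Fin.splitAt-↑ˡ p b q = ≡.refl

    ⊕-ʳʳ : ∀ a b → (A ⊕ᴹ B) (p ↑ʳ a) (p ↑ʳ b) ≡ B a b
    ⊕-ʳʳ a b rewrite Fin.splitAt-↑ʳ p q a | Fin.splitAt-↑ʳ p q b = ≡.refl

    ⊕-*ᵛ-ˡ : ∀ v a → ((A ⊕ᴹ B) *ᵛ v) (a ↑ˡ q) ≈ (A *ᵛ (λ b → v (b ↑ˡ q))) a
    ⊕-*ᵛ-ˡ v a = trans (sum-↑ p λ r → (A ⊕ᴹ B) (a ↑ˡ q) r * v r) (trans
      (+-cong (sum-cong λ b → *-congʳ (reflexive (⊕-ˡˡ a b)))
        (∙-zeroˡ (λ b → v (p ↑ʳ b)) λ b → reflexive (⊕-ˡʳ a b)))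
      (+-identityʳ _))

    ⊕-*ᵛ-ʳ : ∀ v a → ((A ⊕ᴹ B) *ᵛ v) (p ↑ʳ a) ≈ (B *ᵛ (λ b → v (p ↑ʳ b))) a
    ⊕-*ᵛ-ʳ v a = trans (sum-↑ p λ r → (A ⊕ᴹ B) (p ↑ʳ a) r * v r) (trans
      (+-cong (∙-zeroˡ (λ b → v (b ↑ˡ q)) λ b → reflexive (⊕-ʳˡ a b))
        (sum-cong λ b → *-congʳ (reflexive (⊕-ʳʳ a b))))
      (+-identityˡ _))

    Tr-⊕ : Tr (A ⊕ᴹ B) ≈ Tr A + Tr B
    Tr-⊕ = trans (sum-↑ p λ r → (A ⊕ᴹ B) r r)
      (+-cong (sum-cong λ a → reflexive (⊕-ˡˡ a a)) (sum-cong λ b → reflexive (⊕-ʳʳ b b)))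

  Tr-comm : ∀ {m n} (A : Matrix m n) (B : Matrix n m) → Tr (A *ᴹ B) ≈ Tr (B *ᴹ A)
  Tr-comm A B = trans (∑-comm λ a k → A a k * B k a) (sum-cong λ k → sum-cong λ a → *-comm (A a k) (B k a))

  module Resistance {n} (G : WeightedGraph n) where
    open WeightedGraph G
    open PotentialTheory G
    open Walk G

    module _ {d} (σ : Signature n d) (σ-sig : IsSignature G σ) {i j : Fin n} (i≢j : i ≢ j) where
      open Potential σ σ-sig

      -- At `i` the source gives the identity block. At `j`, `green-flux` gives row `a` the value
      -- `- φ a i c`, with the indices of Ω exchanged, which accounts for the transpose in `N`.
      N-column : ∀ {u} → IsGreen i j u → ∀ {φ} → IsHarmonicExtension j φ → ∀ c r →
                 N G i j (λ a b → φ b i a) r c ≈ (𝓛 *ᵛ flatten (u c)) r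
      N-column {u} u-green {φ} φ-ext c = combine-induction {n} λ x a → begin
        N G i j Ω (combine x a) c               ≡⟨ ≡.cong (λ p → column (proj₁ p) (proj₂ p) c) (Fin.remQuot-combine x a) ⟩
        column x a c                            ≈⟨ column-source x a ⟩
        Δ (u c) x a                             ≈⟨ Δ-cong (λ y b → reflexive (unflatten-flatten (u c) y b)) x a ⟨
        Δ (unflatten (flatten (u c))) x a       ≈⟨ laplacian-*ᵛ (flatten (u c)) x a ⟨
        (𝓛 *ᵛ flatten (u c)) (combine x a)      ∎
        where
        open ≈-Reasoning
        open IsGreen u-green
        Ω : Matrix d d
        Ω a b = φ b i a
        column : Fin n → Matrix d d
        column x = if ⌊ x Fin.≟ i ⌋ then I else if ⌊ x Fin.≟ j ⌋ then -ᴹ (Ω ᵀ) else 0ᴹ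
        column-source : ∀ x a → column x a c ≈ Δ (u c) x a
        column-source x a with x Fin.≟ i | x Fin.≟ j
        ... | yes ≡.refl | _          = trans (I-symmetric a c) (sym (source-at i≢j u-green c a))
        ... | no _       | yes ≡.refl = sym (green-flux i≢j u-green φ-ext c a)
        ... | no x≢i     | no x≢j     = sym (trans (source c x x≢j a) (trans (*-congʳ (I-offDiagonal x≢i)) (zeroˡ _)))

      -- Column by column, the potential made with `P` has the same energy as the Green section
      -- `u c`. Pairing `u c` with its own Laplacian leaves only `u c i c`, since `u c` is zero at
      -- `j`.
      energy-trace : ∀ {u} → IsGreen i j u → ∀ {φ} → IsHarmonicExtension j φ → ∀ {P} → IsPseudoinverse 𝓛 P →
        let W = P *ᴹ N G i j (λ a b → φ b i a) in Tr (W ᵀ *ᴹ 𝓛 *ᴹ W) ≈ Tr (valueAt i u)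
      energy-trace {u} u-green {φ} φ-ext {P} P-pinv = sum-cong λ c → begin
        (W ᵀ *ᴹ 𝓛 *ᴹ W) c c
          ≈⟨ *ᴹ-assoc (W ᵀ) 𝓛 W c c ⟩
        (P *ᵛ column c) ∙ (𝓛 *ᵛ (P *ᵛ column c))
          ≈⟨ PseudoinverseSolution.energyForm (connectionLaplacian-symmetric σ-sig) P-pinv (N-column u-green φ-ext c) ⟩
        column c ∙ flatten (u c)
          ≈⟨ trans (∙-cong (N-column u-green φ-ext c) (λ _ → refl)) (∙-comm (𝓛 *ᵛ flatten (u c)) (flatten (u c))) ⟩
        flatten (u c) ∙ (𝓛 *ᵛ flatten (u c))
          ≈⟨ laplacian-form (flatten (u c)) ⟩
        ⟪ unflatten (flatten (u c)) , Δ (unflatten (flatten (u c))) ⟫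
          ≈⟨ ⟪⟫-cong (unflat c) (Δ-cong (unflat c)) ⟩
        ⟪ u c , Δ (u c) ⟫
          ≈⟨ green-dual-grounded i≢j u-green c (IsGreen.grounded u-green c) ⟩
        u c i c ∎
        where
        open ≈-Reasoning
        W = P *ᴹ N G i j (λ a b → φ b i a)
        column : Fin d → Vector (n ℕ.* d)
        column c r = N G i j (λ a b → φ b i a) r c
        unflat : ∀ c → unflatten (flatten (u c)) ≈ᴹ u c
        unflat c x a = reflexive (unflatten-flatten (u c) x a)

-- Scalar effective resistance and the diagonal blocks of the conductance matrix.

module Conductances {c ℓ₁ ℓ₂} (𝓡 : Reals c ℓ₁ ℓ₂) where
  open Over 𝓡
  open OrderedField 𝓡
  open LinearAlgebra 𝓡
  open Sections 𝓡
  open Potentials 𝓡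
  open RandomWalk 𝓡
  open Resistances 𝓡

  module Conductance {n} (G : WeightedGraph n) where
    open WeightedGraph G
    open PotentialTheory G
    open Walk G
    open Resistance G

    -- The graph Laplacian is the connection Laplacian of `ι¹` up to indexing. A sum over the single
    -- fibre index unfolds to a term plus `0#`, hence the many uses of `+-identityʳ`.
    module Scalar where
      open Potential ι¹ ι¹-isSignature public

      L : Matrix n n
      L = graphLaplacian G

      scalarSection : Vector n → Matrix n 1
      scalarSection v x _ = v x

      L-entry : ∀ x y → L x y ≈ laplacianBlock x y zero zero
      L-entry x y = sym (trans (laplacian-entry x y zero zero) (+-cong diagonal (-‿cong (*-identityʳ _))))
        where
        diagonal : I x y * (deg x * 1#) ≈ (if ⌊ x Fin.≟ y ⌋ then deg x else 0#)
        diagonal with x Fin.≟ y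
        ... | yes _ = trans (*-identityˡ _) (*-identityʳ _)
        ... | no _  = zeroˡ _

      L-*ᵛ : ∀ v x → (L *ᵛ v) x ≈ Δ (scalarSection v) x zero
      L-*ᵛ v x = sum-cong λ y → trans (*-congʳ (L-entry x y)) (sym (+-identityʳ _))

      L-symmetric : Symmetric L
      L-symmetric x y = trans (L-entry x y)
        (trans (laplacianBlock-symmetric ι¹-isSignature x y zero zero) (sym (L-entry y x)))

      L-form : ∀ v → v ∙ (L *ᵛ v) ≈ ⟪ scalarSection v , Δ (scalarSection v) ⟫
      L-form v = sum-cong λ x → trans (*-congˡ (L-*ᵛ v x)) (sym (+-identityʳ _))

      unit : Vector n
      unit _ = 1#

      unit-parallel : Parallel (scalarSection unit)
      unit-parallel _ zero = sym (trans (+-identityʳ _) (*-identityˡ 1#))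

      -- Connectedness makes every kernel vector constant, so `unit` alone spans the kernel; the
      -- given vertex is where the coefficient is read off.
      L-pseudoinverse : Fin n → ∃[ P ] IsPseudoinverse L P
      L-pseudoinverse i = symmetric-semidefinite⇒pseudoinverse L L-symmetric
        (λ v → ≤-trans (form-nonneg ι¹-isSignature (scalarSection v)) (≤-reflexive (sym (L-form v))))
        (λ v q≈0 x → trans (L-*ᵛ v x) (parallel⇒Δ≈0 (parallel v q≈0) x zero))
        (λ (_ : Fin 1) → unit)
        (λ _ x → trans (L-*ᵛ unit x) (parallel⇒Δ≈0 unit-parallel x zero))
        (λ v Lv≈0 → (λ _ → v i) , λ x → trans
          (constantAlong (parallel v (∙-zeroʳ v Lv≈0)) (connected x i))
          (sym (trans (+-identityʳ _) (*-identityʳ _))))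
        where
        parallel : ∀ v → v ∙ (L *ᵛ v) ≈ 0# → Parallel (scalarSection v)
        parallel v q≈0 = form≈0⇒parallel ι¹-isSignature (scalarSection v) (trans (sym (L-form v)) q≈0)
        constantAlong : ∀ {v} → Parallel (scalarSection v) → ∀ {x y} → Star Edge x y → v x ≈ v y
        constantAlong par ε           = refl
        constantAlong {v} par (xy ◅ path) =
          trans (par xy zero) (trans (trans (+-identityʳ _) (*-identityˡ _)) (constantAlong {v} par path))

      -- With a constant harmonic extension the flux into `j` is minus one, and the source becomes
      -- the ordinary dipole of the effective resistance.
      unit-harmonic : ∀ j → IsHarmonicExtension j (λ _ → scalarSection unit)
      unit-harmonic j = record
        { boundary = λ { zero zero → refl }
        ; harmonic = λ _ x _ a → parallel⇒Δ≈0 unit-parallel x a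
        }

      module _ {i j : Fin n} (i≢j : i ≢ j) {g} (g-green : IsGreen i j g) where
        potential : Vector n
        potential x = g zero x zero

        dipole-potential : ∀ x → e i x - e j x ≈ (L *ᵛ potential) x
        dipole-potential x = sym (begin
          (L *ᵛ potential) x
            ≈⟨ L-*ᵛ potential x ⟩
          Δ (scalarSection potential) x zero
            ≈⟨ Δ-cong {scalarSection potential} {g zero} (λ { y zero → refl }) x zero ⟩
          Δ (g zero) x zero
            ≈⟨ Δ-green i≢j g-green zero x zero ⟩
          I x i * 1# + I x j * Δ (g zero) j zero
            ≈⟨ +-cong (trans (*-identityʳ _) (I-symmetric x i))
                 (*-cong (I-symmetric x j) (green-flux i≢j g-green (unit-harmonic j) zero zero)) ⟩
          e i x + e j x * - 1#
            ≈⟨ +-congˡ (solve 1 (λ x → x :* :- con (ℤ.+ 1) := :- x) refl (e j x)) ⟩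
          e i x - e j x ∎)
          where open ≈-Reasoning

        effectiveResistance : ∀ {P} → IsPseudoinverse L P →
          let δ = λ x → e i x - e j x in δ ∙ (P *ᵛ δ) ≈ g zero i zero
        effectiveResistance {P} P-pinv = begin
          δ ∙ (P *ᵛ δ)
            ≈⟨ PseudoinverseSolution.quadraticForm L-symmetric P-pinv dipole-potential ⟩
          δ ∙ potential
            ≈⟨ trans (∙-comm δ potential) (∙-distribˡ-sub potential (e i) (e j)) ⟩
          potential ∙ e i - potential ∙ e j
            ≈⟨ +-cong (trans (∙-comm potential (e i)) (I-∙ i potential)) (-‿cong
                 (trans (∙-comm potential (e j)) (trans (I-∙ j potential) (IsGreen.grounded g-green zero zero)))) ⟩
          g zero i zero - 0#
            ≈⟨ trans (+-congˡ -0#≈0#) (+-identityʳ _) ⟩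
          g zero i zero ∎
          where
          open ≈-Reasoning
          δ : Vector n
          δ x = e i x - e j x

      -- Reversing the dipole changes the sign of both factors.
      effectiveResistance-symmetric : ∀ (P : Matrix n n) i j →
        let δ = λ i j x → e i x - e j x in δ i j ∙ (P *ᵛ δ i j) ≈ δ j i ∙ (P *ᵛ δ j i)
      effectiveResistance-symmetric P i j = sum-cong λ x → trans
        (*-cong (flip x) (trans (sum-cong λ y → trans (*-congˡ (flip y)) (sym (-‿distribʳ-* (P x y) (δ j i y))))
          (sum-neg λ y → P x y * δ j i y)))
        (solve 2 (λ x y → :- x :* :- y := x :* y) refl (δ j i x) ((P *ᵛ δ j i) x))
        where
        δ : Fin n → Fin n → Vector n
        δ i j x = e i x - e j x
        flip : ∀ x → δ i j x ≈ - δ j i x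
        flip x = solve 2 (λ x y → x :- y := :- (y :- x)) refl (e i x) (e j x)

    module Schur {d} (τ : Signature n d) (τ-sig : IsSignature G τ) (xs : List (Fin n)) where
      open Potential τ τ-sig

      s : Fin (length xs) → Fin n
      s = lookup xs

      open Restriction s

      -- One row of the Laplacian at `p`, cut down to the vertices of `xs`. By symmetry it is also
      -- the corresponding column, so it describes both off-diagonal parts of the Schur complement.
      coupling : Fin n → Fin d → Vector (length xs ℕ.* d)
      coupling p a = flatten λ k → laplacianBlock p (s k) a

      coupling-row : ∀ (ys : List (Fin n)) κ a r →
        submatrix 𝓛 ys xs (combine {length ys} κ a) r ≡ coupling (lookup ys κ) a r
      coupling-row ys κ a = combine-induction {length xs} λ k b → ≡.trans
        (fromBlocks-combine (λ κ l → block 𝓛 (lookup ys κ) (s l)) κ k a b) (≡.trans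
        (fromBlocks-combine laplacianBlock (lookup ys κ) (s k) a b)
        (≡.sym (unflatten-flatten (λ k → laplacianBlock (lookup ys κ) (s k) a) k b)))

      coupling-column : ∀ (ys : List (Fin n)) κ a r →
        submatrix 𝓛 xs ys r (combine {length ys} κ a) ≈ coupling (lookup ys κ) a r
      coupling-column ys κ a = combine-induction {length xs} λ k b → trans (reflexive (≡.trans
        (fromBlocks-combine (λ l κ → block 𝓛 (s l) (lookup ys κ)) k κ b a)
        (fromBlocks-combine laplacianBlock (s k) (lookup ys κ) b a)))
        (trans (laplacianBlock-symmetric τ-sig (s k) (lookup ys κ) b a)
        (sym (reflexive (unflatten-flatten (λ k → laplacianBlock (lookup ys κ) (s k) a) k b))))

      module _ {R} (R-inverse : IsInverse restriction R) (R-sym : Symmetric R) where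

        schurBlock : Fin n → Matrix d d
        schurBlock p a b = laplacianBlock p p a b - coupling p a ∙ (R *ᵛ coupling p b)

        schurComplement-block : ∀ ys κ a b →
          (submatrix 𝓛 ys ys -ᴹ submatrix 𝓛 ys xs *ᴹ R *ᴹ submatrix 𝓛 xs ys)
            (combine {length ys} κ a) (combine {length ys} κ b) ≈ schurBlock (lookup ys κ) a b
        schurComplement-block ys κ a b = +-cong
          (reflexive (≡.trans (fromBlocks-combine (λ κ l → block 𝓛 (lookup ys κ) (lookup ys l)) κ κ a b)
            (fromBlocks-combine laplacianBlock (lookup ys κ) (lookup ys κ) a b)))
          (-‿cong (trans
            (*ᴹ-assoc (submatrix 𝓛 ys xs) R (submatrix 𝓛 xs ys) (combine {length ys} κ a) (combine {length ys} κ b))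
            (∙-cong (λ r → reflexive (coupling-row ys κ a r)) (*ᵛ-congˡ R (coupling-column ys κ b)))))

        schurBlock-symmetric : ∀ p → Symmetric (schurBlock p)
        schurBlock-symmetric p a b = +-cong (laplacianBlock-symmetric τ-sig p p a b)
          (-‿cong (trans (symmetric-adjoint R-sym (coupling p a) (coupling p b)) (∙-comm (R *ᵛ coupling p a) (coupling p b))))

        module _ {p q : Fin n} (p≢q : p ≢ q) (s-injective : ∀ {k l} → s k ≡ s l → k ≡ l)
                 (s≢p : ∀ k → s k ≢ p) (s≢q : ∀ k → s k ≢ q) (s-surjective : ∀ x → x ≢ p → x ≢ q → ∃[ k ] s k ≡ x)
                 {g} (g-green : IsGreen p q g) where
          open IsGreen g-green

          inner : Fin d → Matrix (length xs) d
          inner c k = g c (s k)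

          -- The ground `q` contributes nothing, so the section consists of its value at `p` and its
          -- part on `xs`. This is how the two-vertex Schur complement comes to act through its
          -- diagonal block at `p` only.
          green-decomposition : ∀ c → g c ≈ᴹ pointMass p (g c p) +ᴹ extend (inner c)
          green-decomposition c x a with x Fin.≟ p | x Fin.≟ q
          ... | yes ≡.refl | _          = sym (trans (+-cong (*-identityˡ _)
            (extend-outside (inner c) s≢p a)) (+-identityʳ _))
          ... | no x≢p     | yes ≡.refl = trans (grounded c a) (sym (trans (+-cong (zeroˡ _)
            (extend-outside (inner c) s≢q a)) (+-identityʳ 0#)))
          ... | no x≢p     | no x≢q with s-surjective x x≢p x≢q
          ...   | k , ≡.refl = sym (trans (+-cong (zeroˡ _) (extend-inside s-injective (inner c) k a)) (+-identityˡ _))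

          Δ-decomposition : ∀ c x a → Δ (g c) x a ≈ laplacianBlock x p a ∙ g c p + Δ (extend (inner c)) x a
          Δ-decomposition c x a = trans (Δ-cong (green-decomposition c) x a)
            (trans (⟪⟫-distribˡ-+ (λ y → laplacianBlock x y a) (pointMass p (g c p)) (extend (inner c)))
              (+-congʳ (pointMass-dual (λ y → laplacianBlock x y a) p (g c p))))

          source-at-p : ∀ c a → laplacianBlock p p a ∙ g c p + coupling p a ∙ flatten (inner c) ≈ I c a
          source-at-p c a = begin
            laplacianBlock p p a ∙ g c p + coupling p a ∙ flatten (inner c)
              ≈⟨ +-congˡ (trans (∙-unflatten {length xs} (coupling p a) (flatten (inner c)))
                   (⟪⟫-cong (λ k b → reflexive (unflatten-flatten (λ k → laplacianBlock p (s k) a) k b))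
                     (λ k b → reflexive (unflatten-flatten (inner c) k b)))) ⟩
            laplacianBlock p p a ∙ g c p + ⟪ (λ k → laplacianBlock p (s k) a) , inner c ⟫
              ≈⟨ +-congˡ (trans (⟪⟫-comm (λ k → laplacianBlock p (s k) a) (inner c))
                   (trans (sym (extend-dual (inner c) (λ y → laplacianBlock p y a)))
                     (⟪⟫-comm (extend (inner c)) (λ y → laplacianBlock p y a)))) ⟩
            laplacianBlock p p a ∙ g c p + Δ (extend (inner c)) p a
              ≈⟨ Δ-decomposition c p a ⟨
            Δ (g c) p a
              ≈⟨ source-at p≢q g-green c a ⟩
            I c a ∎
            where open ≈-Reasoning

          -- There is no source on `xs`, so in the equations there the contribution of the value at
          -- `p` cancels that of the inner part.
          eliminated : ∀ c r → sum (λ b → g c p b * coupling p b r) ≈ - (restriction *ᵛ flatten (inner c)) r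
          eliminated c = combine-induction {length xs} λ k b → begin
            sum (λ b′ → g c p b′ * coupling p b′ (combine k b))
              ≈⟨ ∙-cong {u = g c p} (λ _ → refl) (λ b′ → trans
                   (reflexive (unflatten-flatten (λ k → laplacianBlock p (s k) b′) k b))
                   (laplacianBlock-symmetric τ-sig p (s k) b′ b)) ⟩
            g c p ∙ laplacianBlock (s k) p b
              ≈⟨ solve 2 (λ x y → x := (x :+ y) :- y) refl (g c p ∙ laplacianBlock (s k) p b) (Δ (extend (inner c)) (s k) b) ⟩
            g c p ∙ laplacianBlock (s k) p b + Δ (extend (inner c)) (s k) b - Δ (extend (inner c)) (s k) b
              ≈⟨ +-congʳ (trans (+-congʳ (∙-comm (g c p) (laplacianBlock (s k) p b))) (sym (Δ-decomposition c (s k) b))) ⟩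
            Δ (g c) (s k) b - Δ (extend (inner c)) (s k) b
              ≈⟨ trans (+-congʳ (trans (source c (s k) (s≢q k) b) (trans (*-congʳ (I-offDiagonal (s≢p k))) (zeroˡ _))))
                   (+-identityˡ _) ⟩
            - Δ (extend (inner c)) (s k) b
              ≈⟨ -‿cong (trans (restriction-*ᵛ (flatten (inner c)) k b) (Δ-cong (λ x a → sum-cong λ l →
                   *-congˡ (reflexive (unflatten-flatten (inner c) l a))) (s k) b)) ⟨
            - (restriction *ᵛ flatten (inner c)) (combine k b) ∎
            where open ≈-Reasoning

          schurBlock-green : schurBlock p *ᴹ (λ a c → g c p a) ≈ᴹ I
          schurBlock-green a c = begin
            schurBlock p a ∙ g c p
              ≈⟨ trans (∙-comm (schurBlock p a) (g c p))
                   (∙-distribˡ-sub (g c p) (laplacianBlock p p a) (λ b → coupling p a ∙ (R *ᵛ coupling p b))) ⟩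
            g c p ∙ laplacianBlock p p a - g c p ∙ (λ b → coupling p a ∙ (R *ᵛ coupling p b))
              ≈⟨ +-cong (∙-comm (g c p) (laplacianBlock p p a)) (-‿cong crossTerm) ⟩
            laplacianBlock p p a ∙ g c p - - (coupling p a ∙ flatten (inner c))
              ≈⟨ +-congˡ (-‿involutive _) ⟩
            laplacianBlock p p a ∙ g c p + coupling p a ∙ flatten (inner c)
              ≈⟨ source-at-p c a ⟩
            I c a
              ≈⟨ I-symmetric c a ⟩
            I a c ∎
            where
            open ≈-Reasoning
            y = flatten (inner c)
            Rβ = R *ᵛ coupling p a
            -- `R` is moved onto the row at `p`, where it cancels against `restriction`; the inner
            -- part itself need not be solved for.
            crossTerm : g c p ∙ (λ b → coupling p a ∙ (R *ᵛ coupling p b)) ≈ - (coupling p a ∙ y)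
            crossTerm = begin
              g c p ∙ (λ b → coupling p a ∙ (R *ᵛ coupling p b))
                ≈⟨ sum-cong (λ b → trans (*-congˡ (symmetric-adjoint R-sym (coupling p a) (coupling p b)))
                     (sym (∙-scaleʳ (g c p b) Rβ (coupling p b)))) ⟩
              sum (λ b → Rβ ∙ (λ r → g c p b * coupling p b r))
                ≈⟨ ∙-sumʳ Rβ (λ b r → g c p b * coupling p b r) ⟨
              Rβ ∙ (λ r → sum λ b → g c p b * coupling p b r)
                ≈⟨ ∙-cong {u = Rβ} (λ _ → refl) (eliminated c) ⟩
              Rβ ∙ (λ r → - (restriction *ᵛ y) r)
                ≈⟨ trans (sum-cong λ r → sym (-‿distribʳ-* (Rβ r) ((restriction *ᵛ y) r)))
                     (sum-neg λ r → Rβ r * (restriction *ᵛ y) r) ⟩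
              - (Rβ ∙ (restriction *ᵛ y))
                ≈⟨ -‿cong (symmetric-adjoint restriction-symmetric Rβ y) ⟩
              - ((restriction *ᵛ Rβ) ∙ y)
                ≈⟨ -‿cong (∙-cong (λ r → trans (sym (*ᵛ-assoc restriction R (coupling p a) r))
                     (trans (∙-cong (proj₁ R-inverse r) (λ _ → refl)) (I-∙ r (coupling p a)))) (λ _ → refl)) ⟩
              - (coupling p a ∙ y) ∎

          -- The second product is the transpose of the first, by symmetry of the Schur block and
          -- reciprocity of the Green function.
          schurBlock-inverse : IsInverse (schurBlock p) (λ a c → g c p a)
          schurBlock-inverse = schurBlock-green , λ a c → begin
            (λ b → g b p a) ∙ (λ b → schurBlock p b c)
              ≈⟨ trans (∙-comm (λ b → g b p a) (λ b → schurBlock p b c))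
                   (∙-cong (λ b → schurBlock-symmetric p b c) (λ b → green-symmetric p≢q g-green b a)) ⟩
            schurBlock p c ∙ (λ b → g a p b)
              ≈⟨ schurBlock-green c a ⟩
            I c a
              ≈⟨ I-symmetric c a ⟩
            I a c ∎
            where open ≈-Reasoning

-- Gauge transformations, direct sums and the conductance matrix.

module Decomposition {c ℓ₁ ℓ₂} (𝓡 : Reals c ℓ₁ ℓ₂) where
  open Over 𝓡
  open OrderedField 𝓡
  open LinearAlgebra 𝓡
  open Sections 𝓡
  open Potentials 𝓡
  open RandomWalk 𝓡
  open Resistances 𝓡
  open Conductances 𝓡

  module Decompose {n} (G : WeightedGraph n) where
    open WeightedGraph G
    open PotentialTheory G
    open Walk G
    open Resistance G
    open Conductance G
    open GreenFunction using (IsGreen)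
    open IsGreen using (grounded; source)

    module Gauge {d} {σ σ′ : Signature n d} (f : Fin n → Matrix d d) (f-orthogonal : ∀ x → IsOrthogonal (f x))
                 (f-intertwines : ∀ x y → Edge x y → f x *ᴹ σ x y ≈ᴹ σ′ x y *ᴹ f y) where
      open Laplacian σ using (Δ; Δ-gradient)
      open Laplacian σ′ using (laplacianBlock) renaming (Δ to Δ′; Δ-gradient to Δ′-gradient; gradient to gradient′)

      pullback : Matrix n d → Matrix n d
      pullback s x = f x ᵀ *ᵛ s x

      transpose-intertwines : ∀ {x y} → Edge x y → σ x y *ᴹ f y ᵀ ≈ᴹ f x ᵀ *ᴹ σ′ x y
      transpose-intertwines {x} {y} xy = begin
        σ x y *ᴹ f y ᵀ                          ≈⟨ *ᴹ-identityˡ (σ x y *ᴹ f y ᵀ) ⟨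
        I *ᴹ (σ x y *ᴹ f y ᵀ)                   ≈⟨ *ᴹ-congʳ (σ x y *ᴹ f y ᵀ) (proj₁ (f-orthogonal x)) ⟨
        f x ᵀ *ᴹ f x *ᴹ (σ x y *ᴹ f y ᵀ)        ≈⟨ *ᴹ-assoc (f x ᵀ) (f x) (σ x y *ᴹ f y ᵀ) ⟩
        f x ᵀ *ᴹ (f x *ᴹ (σ x y *ᴹ f y ᵀ))      ≈⟨ *ᴹ-congˡ (f x ᵀ) (*ᴹ-assoc (f x) (σ x y) (f y ᵀ)) ⟨
        f x ᵀ *ᴹ (f x *ᴹ σ x y *ᴹ f y ᵀ)        ≈⟨ *ᴹ-congˡ (f x ᵀ) (*ᴹ-congʳ (f y ᵀ) (f-intertwines x y xy)) ⟩
        f x ᵀ *ᴹ (σ′ x y *ᴹ f y *ᴹ f y ᵀ)       ≈⟨ *ᴹ-congˡ (f x ᵀ) (*ᴹ-assoc (σ′ x y) (f y) (f y ᵀ)) ⟩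
        f x ᵀ *ᴹ (σ′ x y *ᴹ (f y *ᴹ f y ᵀ))     ≈⟨ *ᴹ-congˡ (f x ᵀ) (*ᴹ-congˡ (σ′ x y) (proj₂ (f-orthogonal y))) ⟩
        f x ᵀ *ᴹ (σ′ x y *ᴹ I)                  ≈⟨ *ᴹ-congˡ (f x ᵀ) (*ᴹ-identityʳ (σ′ x y)) ⟩
        f x ᵀ *ᴹ σ′ x y                         ∎
        where open ≈ᴹ-Reasoning

      transport-pullback : ∀ s {x y} → Edge x y → ∀ a → (σ x y *ᵛ pullback s y) a ≈ (f x ᵀ *ᵛ (σ′ x y *ᵛ s y)) a
      transport-pullback s {x} {y} xy a = begin
        (σ x y *ᵛ (f y ᵀ *ᵛ s y)) a     ≈⟨ *ᵛ-assoc (σ x y) (f y ᵀ) (s y) a ⟨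
        (σ x y *ᴹ f y ᵀ *ᵛ s y) a       ≈⟨ ∙-cong (transpose-intertwines xy a) (λ _ → refl) ⟩
        (f x ᵀ *ᴹ σ′ x y *ᵛ s y) a      ≈⟨ *ᵛ-assoc (f x ᵀ) (σ′ x y) (s y) a ⟩
        (f x ᵀ *ᵛ (σ′ x y *ᵛ s y)) a    ∎
        where open ≈-Reasoning

      Δ-pullback : ∀ s x a → Δ (pullback s) x a ≈ (f x ᵀ *ᵛ Δ′ s x) a
      Δ-pullback s x a = begin
        Δ (pullback s) x a
          ≈⟨ Δ-gradient (pullback s) x a ⟩
        sum (λ y → w x y * (pullback s x a - (σ x y *ᵛ pullback s y) a))
          ≈⟨ sum-cong (λ y → w-congˡ x y λ xy → trans (+-congˡ (-‿cong (transport-pullback s xy a)))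
               (sym (∙-distribˡ-sub (λ b → f x b a) (s x) (σ′ x y *ᵛ s y)))) ⟩
        sum (λ y → w x y * ((λ b → f x b a) ∙ gradient′ s x y))
          ≈⟨ sum-cong (λ y → ∙-scaleʳ (w x y) (λ b → f x b a) (gradient′ s x y)) ⟨
        sum (λ y → (λ b → f x b a) ∙ (λ b → w x y * gradient′ s x y b))
          ≈⟨ ∙-sumʳ (λ b → f x b a) (λ y b → w x y * gradient′ s x y b) ⟨
        (λ b → f x b a) ∙ (λ b → sum λ y → w x y * gradient′ s x y b)
          ≈⟨ ∙-cong {u = λ b → f x b a} (λ _ → refl) (Δ′-gradient s x) ⟨
        (f x ᵀ *ᵛ Δ′ s x) a ∎
        where open ≈-Reasoning

      Δ′-combination : ∀ (u : Fin d → Matrix n d) (t : Vector d) x a →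
        Δ′ (λ y b → sum λ c → u c y b * t c) x a ≈ sum λ c → Δ′ (u c) x a * t c
      Δ′-combination u t x a = begin
        sum (λ y → laplacianBlock x y a ∙ (λ b → sum λ c → u c y b * t c))
          ≈⟨ sum-cong (λ y → trans (∙-sumʳ (laplacianBlock x y a) λ c b → u c y b * t c) (sum-cong λ c →
               trans (sum-cong λ b → sym (*-assoc (laplacianBlock x y a b) (u c y b) (t c)))
                 (sym (*-distribʳ-sum (t c) λ b → laplacianBlock x y a b * u c y b)))) ⟩
        sum (λ y → sum λ c → laplacianBlock x y a ∙ u c y * t c)
          ≈⟨ ∑-comm (λ y c → laplacianBlock x y a ∙ u c y * t c) ⟩
        sum (λ c → sum λ y → laplacianBlock x y a ∙ u c y * t c)
          ≈⟨ sum-cong (λ c → *-distribʳ-sum (t c) λ y → laplacianBlock x y a ∙ u c y) ⟨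
        sum (λ c → Δ′ (u c) x a * t c) ∎
        where open ≈-Reasoning

      module _ {i j : Fin n} {u} (u-green : IsGreen σ′ i j u) where

        -- Pulling back multiplies the source at `i` by the transpose of `f i`, so the source for σ′
        -- must be column `c` of `f i`. The resulting Green matrix at `x` is `f x ᵀ` times that of
        -- σ′ times `f i`.
        combination : Fin d → Matrix n d
        combination c x b = (valueAt x u *ᴹ f i) b c

        gaugedGreen : Fin d → Matrix n d
        gaugedGreen c = pullback (combination c)

        combination-source : ∀ c x → x ≢ j → ∀ b → Δ′ (combination c) x b ≈ I x i * f i b c
        combination-source c x x≢j b = begin
          Δ′ (combination c) x b
            ≈⟨ Δ′-combination u (λ c′ → f i c′ c) x b ⟩
          sum (λ c′ → Δ′ (u c′) x b * f i c′ c)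
            ≈⟨ sum-cong (λ c′ → trans (*-congʳ (trans (source u-green c′ x x≢j b) (*-congˡ (I-symmetric c′ b)))) (*-assoc (I x i) (I b c′) (f i c′ c))) ⟩
          sum (λ c′ → I x i * (I b c′ * f i c′ c))
            ≈⟨ *-distribˡ-sum (I x i) (λ c′ → I b c′ * f i c′ c) ⟨
          I x i * (I b ∙ (λ c′ → f i c′ c))
            ≈⟨ *-congˡ (I-∙ b λ c′ → f i c′ c) ⟩
          I x i * f i b c ∎
          where open ≈-Reasoning

        gaugedGreen-isGreen : IsGreen σ i j gaugedGreen
        gaugedGreen-isGreen = record
          { grounded = λ c a → ∙-zeroʳ (λ b → f j b a) λ b → ∙-zeroˡ (λ c′ → f i c′ c) λ c′ → grounded u-green c′ b
          ; source   = λ c x x≢j a → trans (Δ-pullback (combination c) x a) (trans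
              (trans (∙-cong {u = λ b → f x b a} (λ _ → refl) (combination-source c x x≢j))
                (∙-scaleʳ (I x i) (λ b → f x b a) (λ b → f i b c)))
              (orthogonality c x a))
          }
          where
          orthogonality : ∀ c x a → I x i * ((λ b → f x b a) ∙ (λ b → f i b c)) ≈ I x i * I c a
          orthogonality c x a with x Fin.≟ i
          ... | yes ≡.refl = *-congˡ (trans (proj₁ (f-orthogonal x) a c) (I-symmetric a c))
          ... | no _       = trans (zeroˡ _) (sym (zeroˡ _))

        -- At `i` the gauge acts by conjugation with an orthogonal matrix.
        Tr-gaugedGreen : Tr (valueAt i gaugedGreen) ≈ Tr (valueAt i u)
        Tr-gaugedGreen = begin
          Tr (f i ᵀ *ᴹ (valueAt i u *ᴹ f i))    ≈⟨ Tr-comm (f i ᵀ) (valueAt i u *ᴹ f i) ⟩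
          Tr (valueAt i u *ᴹ f i *ᴹ f i ᵀ)      ≈⟨ sum-cong (λ a → trans (*ᴹ-assoc (valueAt i u) (f i) (f i ᵀ) a a)
                                                     (trans (*ᴹ-congˡ (valueAt i u) (proj₂ (f-orthogonal i)) a a)
                                                       (*ᴹ-identityʳ (valueAt i u) a a))) ⟩
          Tr (valueAt i u)                      ∎
          where open ≈-Reasoning

    module DirectSum {p q} (α : Signature n p) (β : Signature n q) where
      module A = Laplacian α
      module B = Laplacian β
      open Laplacian (α ⊕ β) using (Δ; Δ-transport)

      Δ-ˡ : ∀ s x a → Δ s x (a ↑ˡ q) ≈ A.Δ (λ y b → s y (b ↑ˡ q)) x a
      Δ-ˡ s x a = trans (Δ-transport s x (a ↑ˡ q)) (trans
        (+-congˡ (-‿cong (sum-cong λ y → *-congˡ (⊕-*ᵛ-ˡ (α x y) (β x y) (s y) a))))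
        (sym (A.Δ-transport (λ y b → s y (b ↑ˡ q)) x a)))

      Δ-ʳ : ∀ s x b → Δ s x (p ↑ʳ b) ≈ B.Δ (λ y b → s y (p ↑ʳ b)) x b
      Δ-ʳ s x b = trans (Δ-transport s x (p ↑ʳ b)) (trans
        (+-congˡ (-‿cong (sum-cong λ y → *-congˡ (⊕-*ᵛ-ʳ (α x y) (β x y) (s y) b))))
        (sym (B.Δ-transport (λ y b → s y (p ↑ʳ b)) x b)))

      module _ {i j : Fin n} {u} (u-green : IsGreen α i j u) {v} (v-green : IsGreen β i j v) where

        directSumGreen : Fin (p ℕ.+ q) → Matrix n (p ℕ.+ q)
        directSumGreen c x a = (valueAt x u ⊕ᴹ valueAt x v) a c

        directSumGreen-isGreen : IsGreen (α ⊕ β) i j directSumGreen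
        directSumGreen-isGreen = record
          { grounded = ↑-induction
              (λ c → ↑-induction
                (λ a → trans (reflexive (⊕-ˡˡ (valueAt j u) (valueAt j v) a c)) (grounded u-green c a))
                (λ b → reflexive (⊕-ʳˡ (valueAt j u) (valueAt j v) b c)))
              (λ c → ↑-induction
                (λ a → reflexive (⊕-ˡʳ (valueAt j u) (valueAt j v) a c))
                (λ b → trans (reflexive (⊕-ʳʳ (valueAt j u) (valueAt j v) b c)) (grounded v-green c b)))
          ; source   = ↑-induction
              (λ c x x≢j → ↑-induction
                (λ a → trans (Δ-ˡ (directSumGreen (c ↑ˡ q)) x a) (trans
                  (A.Δ-cong (λ y b → reflexive (⊕-ˡˡ (valueAt y u) (valueAt y v) b c)) x a)
                  (trans (source u-green c x x≢j a) (*-congˡ (sym (I-↑ˡ q c a))))))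
                (λ b → trans (Δ-ʳ (directSumGreen (c ↑ˡ q)) x b) (trans
                  (sum-zero λ y → ∙-zeroʳ (B.laplacianBlock x y b) λ b → reflexive (⊕-ʳˡ (valueAt y u) (valueAt y v) b c))
                  (sym (trans (*-congˡ (I-offDiagonal (↑ˡ≢↑ʳ c b))) (zeroʳ (I x i)))))))
              (λ c x x≢j → ↑-induction
                (λ a → trans (Δ-ˡ (directSumGreen (p ↑ʳ c)) x a) (trans
                  (sum-zero λ y → ∙-zeroʳ (A.laplacianBlock x y a) λ a → reflexive (⊕-ˡʳ (valueAt y u) (valueAt y v) a c))
                  (sym (trans (*-congˡ (I-offDiagonal λ eq → ↑ˡ≢↑ʳ a c (≡.sym eq))) (zeroʳ (I x i))))))
                (λ b → trans (Δ-ʳ (directSumGreen (p ↑ʳ c)) x b) (trans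
                  (B.Δ-cong (λ y b → reflexive (⊕-ʳʳ (valueAt y u) (valueAt y v) b c)) x b)
                  (trans (source v-green c x x≢j b) (*-congˡ (sym (I-↑ʳ p c b)))))))
          }

    -- The same scalar Green function is stacked `r` times; these copies are the origin of the
    -- coefficient ρ of rᵢⱼ.
    trivialGreen : ∀ {i j g} → IsGreen ι¹ i j g → ∀ r →
      ∃[ u ] (IsGreen (⨁ι¹ r) i j u × Tr (valueAt i u) ≈ fromℕ r * g zero i zero)
    trivialGreen g-green zero    = (λ ()) , record { grounded = λ () ; source = λ () } , sym (zeroˡ _)
    trivialGreen {i} {_} {g} g-green (suc r) with trivialGreen g-green r
    ... | u , u-green , Tr-u = directSumGreen g-green u-green , directSumGreen-isGreen g-green u-green , (begin
      Tr (valueAt i g ⊕ᴹ valueAt i u)                    ≈⟨ Tr-⊕ (valueAt i g) (valueAt i u) ⟩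
      g zero i zero + 0# + Tr (valueAt i u)              ≈⟨ +-cong (trans (+-identityʳ _) (sym (*-identityˡ _))) Tr-u ⟩
      1# * g zero i zero + fromℕ r * g zero i zero       ≈⟨ distribʳ (g zero i zero) 1# (fromℕ r) ⟨
      fromℕ (suc r) * g zero i zero                      ∎)
      where
      open ≈-Reasoning
      open DirectSum ι¹ (⨁ι¹ r)

    decomposedGreen : ∀ {ρ k} {σ : Signature n (ρ ℕ.+ k)} {τ : Signature n k} → _≅_ G σ (⨁ι¹ ρ ⊕ τ) →
      ∀ {i j g v} → IsGreen ι¹ i j g → IsGreen τ i j v →
      ∃[ u ] (IsGreen σ i j u × Tr (valueAt i u) ≈ fromℕ ρ * g zero i zero + Tr (valueAt i v))
    decomposedGreen {ρ} {σ = σ} {τ} (f , f-orthogonal , f-intertwines) {i} {v = v} g-green v-green with trivialGreen g-green ρ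
    ... | u , u-green , Tr-u =
      gaugedGreen sum-green , gaugedGreen-isGreen sum-green ,
      trans (Tr-gaugedGreen sum-green) (trans (Tr-⊕ (valueAt i u) (valueAt i v)) (+-congʳ Tr-u))
      where
      open DirectSum (⨁ι¹ ρ) τ
      open Gauge {σ = σ} {σ′ = ⨁ι¹ ρ ⊕ τ} f f-orthogonal f-intertwines
      sum-green = directSumGreen-isGreen u-green v-green

    inverse-resp : ∀ {d} {A A′ B : Matrix d d} → A ≈ᴹ A′ → IsInverse A′ B → IsInverse A B
    inverse-resp {B = B} A≈A′ (A′B≈I , BA′≈I) =
      (λ a b → trans (*ᴹ-congʳ B A≈A′ a b) (A′B≈I a b)) , λ a b → trans (*ᴹ-congˡ B A≈A′ a b) (BA′≈I a b)

    -- A single elimination of `xs` serves both blocks. The block at `i` is inverted by the Green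
    -- function grounded at `j`, and the block at `j` by the one grounded at `i`.
    conductance : ∀ {k} (τ : Signature n k) → IsSignature G τ → ∀ {i j} → i ≢ j →
      ∀ xs → Enumerates (lookup xs) (λ x → x ≢ i × x ≢ j) →
      ∀ {g h} → IsGreen τ i j g → IsGreen τ j i h →
      let 𝓛 = connectionLaplacian G τ
          S = i ∷ j ∷ []
      in ∃[ C ] (IsSchurComplement (submatrix 𝓛 S S) (submatrix 𝓛 S xs) (submatrix 𝓛 xs S) (submatrix 𝓛 xs xs) C ×
           IsInverse (block {2} {2} {k} {k} C zero zero) (valueAt i g) ×
           IsInverse (block {2} {2} {k} {k} C (suc zero) (suc zero)) (valueAt j h))
    conductance {k} τ τ-sig {i} {j} i≢j xs away g-green h-green =
      C , (R , inverse⇒pseudoinverse R-inverse , λ _ _ → refl) ,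
      inverse-resp (schurComplement-block R-inverse R-sym S zero)
        (schurBlock-inverse R-inverse R-sym i≢j injective (λ l → proj₁ (sound l)) (λ l → proj₂ (sound l))
          (λ x x≢i x≢j → surjective x (x≢i , x≢j)) g-green) ,
      inverse-resp (schurComplement-block R-inverse R-sym S (suc zero))
        (schurBlock-inverse R-inverse R-sym (λ j≡i → i≢j (≡.sym j≡i)) injective (λ l → proj₂ (sound l)) (λ l → proj₁ (sound l))
          (λ x x≢j x≢i → surjective x (x≢i , x≢j)) h-green)
      where
      open Enumerates away
      open Schur τ τ-sig xs
      open Potential τ τ-sig using (𝓛; module Restriction)
      open Restriction (lookup xs)
      S = i ∷ j ∷ []
      -- One vertex missing from `xs`, here `i`, suffices to make the eliminated block invertible.
      inverse-exists = symmetric-anisotropic⇒inverse restriction restriction-symmetric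
        (restriction-anisotropic injective λ l → proj₁ (sound l))
      R = proj₁ inverse-exists
      R-inverse = proj₁ (proj₂ inverse-exists)
      R-sym = proj₂ (proj₂ inverse-exists)
      C = submatrix 𝓛 S S -ᴹ submatrix 𝓛 S xs *ᴹ R *ᴹ submatrix 𝓛 xs S

  -- Each of the two directions contributes the same `m * r`, and 1/(2d) taken twice is 1/d; `1 ≤ d`
  -- makes the denominators nonzero.
  average : ∀ {d} → 1 ℕ.≤ d → ∀ {m r x y s t} → x ≈ m * r + s → y ≈ m * r + t →
    fromℕ (2 ℕ.* d) ⁻¹ * (x + y) ≈ m * fromℕ d ⁻¹ * r + fromℕ (2 ℕ.* d) ⁻¹ * (s + t)
  average {suc d} _ {m} {r} {x} {y} {s} {t} x≈ y≈ = begin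
    E⁻¹ * (x + y)
      ≈⟨ *-congˡ (+-cong x≈ y≈) ⟩
    E⁻¹ * (m * r + s + (m * r + t))
      ≈⟨ solve 5 (λ e m r s t → e :* (m :* r :+ s :+ (m :* r :+ t)) := m :* r :* (e :+ e) :+ e :* (s :+ t)) refl E⁻¹ m r s t ⟩
    m * r * (E⁻¹ + E⁻¹) + E⁻¹ * (s + t)
      ≈⟨ +-congʳ (*-congˡ E⁻¹+E⁻¹≈D⁻¹) ⟩
    m * r * D⁻¹ + E⁻¹ * (s + t)
      ≈⟨ +-congʳ (solve 3 (λ m r e → m :* r :* e := m :* e :* r) refl m r D⁻¹) ⟩
    m * D⁻¹ * r + E⁻¹ * (s + t) ∎
    where
    open ≈-Reasoning
    open MonoidMultiples +-monoid using (×-homo-+)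
    D = fromℕ (suc d)
    E = fromℕ (2 ℕ.* suc d)
    D⁻¹ = D ⁻¹
    E⁻¹ = E ⁻¹
    E≈D+D : E ≈ D + D
    E≈D+D = trans (×-homo-+ 1# (suc d) (suc d ℕ.+ 0)) (+-congˡ (trans (×-homo-+ 1# (suc d) 0) (+-identityʳ D)))
    E⁻¹+E⁻¹≈D⁻¹ : E⁻¹ + E⁻¹ ≈ D⁻¹
    E⁻¹+E⁻¹≈D⁻¹ = *-cancelˡ-≈ (<⇒≉ (fromℕ-pos d)) (begin
      D * (E⁻¹ + E⁻¹)     ≈⟨ solve 2 (λ d e → d :* (e :+ e) := (d :+ d) :* e) refl D E⁻¹ ⟩
      (D + D) * E⁻¹       ≈⟨ *-congʳ E≈D+D ⟨
      E * E⁻¹             ≈⟨ ⁻¹-inverse (<⇒≉ (fromℕ-pos (d ℕ.+ 1 ℕ.* suc d))) ⟩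
      1#                  ≈⟨ ⁻¹-inverse (<⇒≉ (fromℕ-pos d)) ⟨
      D * D⁻¹             ∎)

-- Assembly of the resistance identity.

module Assembly {c ℓ₁ ℓ₂} (𝓡 : Reals c ℓ₁ ℓ₂) where
  open Over 𝓡
  open OrderedField 𝓡
  open Potentials 𝓡
  open RandomWalk 𝓡
  open Resistances 𝓡
  open Conductances 𝓡
  open Decomposition 𝓡

  module Formula {n} (G : WeightedGraph n) {ρ k} {σ : Signature n (ρ ℕ.+ k)} (σ-sig : IsSignature G σ)
                 {τ : Signature n k} (τ-sig : IsSignature G τ) (σ≅ι⊕τ : _≅_ G σ (⨁ι¹ ρ ⊕ τ)) where
    open PotentialTheory G
    open Walk G
    open Resistance G
    open Conductance G
    open Decompose G
    module S = Potential σ σ-sig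
    module T = Potential τ τ-sig

    d : ℕ
    d = ρ ℕ.+ k

    dipoleEnergy : Matrix (n ℕ.* d) (n ℕ.* d) → (i j : Fin n) → (Fin d → Matrix n d) → Matrix d d
    dipoleEnergy P i j φ = let W = P *ᴹ N G i j (λ a b → φ b i a) in W ᵀ *ᴹ S.𝓛 *ᴹ W

    resistance : Matrix n n → (i j : Fin n) → ℝ
    resistance L† i j = (λ x → e i x - e j x) ∙ (L† *ᵛ (λ x → e i x - e j x))

    trace-formula : ∀ {i j} → i ≢ j → ∀ {P} → IsPseudoinverse S.𝓛 P → ∀ {L†} → IsPseudoinverse Scalar.L L† →
      ∀ {φ} → S.IsHarmonicExtension j φ → ∀ {γ} → Scalar.IsGreen i j γ → ∀ {g} → T.IsGreen i j g →
      Tr (dipoleEnergy P i j φ) ≈ fromℕ ρ * resistance L† i j + Tr (valueAt i g)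
    trace-formula i≢j P-pinv L†-pinv φ-ext γ-green g-green =
      let u , u-green , Tr-u = decomposedGreen {ρ} {k} {σ} {τ} σ≅ι⊕τ γ-green g-green in
      trans (energy-trace σ σ-sig i≢j u-green φ-ext P-pinv)
        (trans Tr-u (+-congʳ (*-congˡ (sym (Scalar.effectiveResistance i≢j γ-green L†-pinv)))))

    resistance-formula : 1 ℕ.≤ d → ∀ {i j} → i ≢ j →
      ∀ {P} → IsPseudoinverse S.𝓛 P → ∀ {L†} → IsPseudoinverse Scalar.L L† →
      ∀ {φ} → S.IsHarmonicExtension j φ → ∀ {ψ} → S.IsHarmonicExtension i ψ →
      ∀ {g} → T.IsGreen i j g → ∀ {h} → T.IsGreen j i h →
      fromℕ (2 ℕ.* d) ⁻¹ * Tr (dipoleEnergy P i j φ +ᴹ dipoleEnergy P j i ψ) ≈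
        fromℕ ρ * fromℕ d ⁻¹ * resistance L† i j + fromℕ (2 ℕ.* d) ⁻¹ * Tr (valueAt i g +ᴹ valueAt j h)
    resistance-formula 1≤d {i} {j} i≢j {P} P-pinv {L†} L†-pinv {φ} φ-ext {ψ} ψ-ext {g} g-green {h} h-green = begin
      fromℕ (2 ℕ.* d) ⁻¹ * Tr (dipoleEnergy P i j φ +ᴹ dipoleEnergy P j i ψ)
        ≈⟨ *-congˡ (∑-distrib-+ (λ a → dipoleEnergy P i j φ a a) (λ a → dipoleEnergy P j i ψ a a)) ⟩
      fromℕ (2 ℕ.* d) ⁻¹ * (Tr (dipoleEnergy P i j φ) + Tr (dipoleEnergy P j i ψ))
        ≈⟨ average {d} 1≤d
             (trace-formula i≢j P-pinv L†-pinv φ-ext (proj₂ (Scalar.green i j)) g-green)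
             (trans (trace-formula j≢i P-pinv L†-pinv ψ-ext (proj₂ (Scalar.green j i)) h-green)
               (+-congʳ (*-congˡ (Scalar.effectiveResistance-symmetric L† j i)))) ⟩
      fromℕ ρ * fromℕ d ⁻¹ * resistance L† i j + fromℕ (2 ℕ.* d) ⁻¹ * (Tr (valueAt i g) + Tr (valueAt j h))
        ≈⟨ +-congˡ (*-congˡ (∑-distrib-+ (λ a → g a i a) (λ a → h a j a))) ⟨
      fromℕ ρ * fromℕ d ⁻¹ * resistance L† i j + fromℕ (2 ℕ.* d) ⁻¹ * Tr (valueAt i g +ᴹ valueAt j h) ∎
      where
      open ≈-Reasoning
      j≢i : j ≢ i
      j≢i j≡i = i≢j (≡.sym j≡i)

    connectionResistance : ∀ {i j P} → IsPseudoinverse S.𝓛 P →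
      ∀ {φ} → S.IsHarmonicExtension j φ → ∀ {ψ} → S.IsHarmonicExtension i ψ →
      IsConnectionEffectiveResistance G σ i j
        (fromℕ (2 ℕ.* d) ⁻¹ * Tr (dipoleEnergy P i j φ +ᴹ dipoleEnergy P j i ψ))
    connectionResistance {i} {j} {P} P-pinv {φ} φ-ext {ψ} ψ-ext =
      P , (λ a b → φ b i a) , (λ a b → ψ b j a) , P-pinv ,
        Hitting.isΩ⁰ σ σ-sig j φ-ext i , Hitting.isΩ⁰ σ σ-sig i ψ-ext j , refl

    ResistanceIdentity : (i j : Fin n) → Set (c ⊔ ℓ₁ ⊔ ℓ₂)
    ResistanceIdentity i j = ∃[ rσ ] ∃[ r ] ∃[ C ] ∃[ Cᵢᵢ⁻¹ ] ∃[ Cⱼⱼ⁻¹ ]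
      IsConnectionEffectiveResistance G σ i j rσ ×
      IsEffectiveResistance G i j r ×
      IsConductance G τ i j C ×
      IsInverse (block {2} {2} {k} {k} C zero zero) Cᵢᵢ⁻¹ ×
      IsInverse (block {2} {2} {k} {k} C (suc zero) (suc zero)) Cⱼⱼ⁻¹ ×
      rσ ≈ (fromℕ ρ * fromℕ d ⁻¹) * r + fromℕ (2 ℕ.* d) ⁻¹ * Tr (Cᵢᵢ⁻¹ +ᴹ Cⱼⱼ⁻¹)

    resistanceIdentity : 1 ℕ.≤ d → ∀ {i j} → i ≢ j → ∃ (IsPseudoinverse S.𝓛) → ∃ (IsPseudoinverse Scalar.L) →
      ∃ (S.IsHarmonicExtension j) → ∃ (S.IsHarmonicExtension i) → ∃ (T.IsGreen i j) → ∃ (T.IsGreen j i) →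
      ResistanceIdentity i j
    resistanceIdentity 1≤d {i} {j} i≢j (P , P-pinv) (L† , L†-pinv) (φ , φ-ext) (ψ , ψ-ext) (g , g-green) (h , h-green) =
      fromConductance (conductance τ τ-sig i≢j (complement G i j)
        (filter-enumerates λ x → ¬? (x Fin.≟ i) ×-dec ¬? (x Fin.≟ j)) g-green h-green)
      where
      fromConductance : ∃[ C ] (IsConductance G τ i j C × IsInverse (block {2} {2} {k} {k} C zero zero) (valueAt i g) ×
        IsInverse (block {2} {2} {k} {k} C (suc zero) (suc zero)) (valueAt j h)) → ResistanceIdentity i j
      fromConductance (C , C-schur , Cᵢᵢ-inverse , Cⱼⱼ-inverse) =
        fromℕ (2 ℕ.* d) ⁻¹ * Tr (dipoleEnergy P i j φ +ᴹ dipoleEnergy P j i ψ) ,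
        resistance L† i j , C , valueAt i g , valueAt j h ,
        connectionResistance P-pinv φ-ext ψ-ext , (L† , L†-pinv , refl) , C-schur , Cᵢᵢ-inverse , Cⱼⱼ-inverse ,
        resistance-formula 1≤d i≢j P-pinv L†-pinv φ-ext ψ-ext g-green h-green
theorem6p10 : ∀ {c ℓ₁ ℓ₂} (𝓡 : Reals c ℓ₁ ℓ₂) → let open Over 𝓡 in
    ∀ {n} (G : WeightedGraph n) (ρ k : ℕ) → let d = ρ ℕ.+ k in
    (σ : Signature n d) → IsSignature G σ →
    1 ℕ.≤ ρ → KernelHasDimension (connectionLaplacian G σ) ρ →
    (τ : Signature n k) → IsSignature G τ →
    Invertible (connectionLaplacian G τ) → _≅_ G σ (⨁ι¹ ρ ⊕ τ) →
    (i j : Fin n) → i ≢ j →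
    ∃[ rσ ] ∃[ r ] ∃[ C ] ∃[ Cᵢᵢ⁻¹ ] ∃[ Cⱼⱼ⁻¹ ]
    IsConnectionEffectiveResistance G σ i j rσ ×
    IsEffectiveResistance G i j r ×
    IsConductance G τ i j C ×
    IsInverse (block {2} {2} {k} {k} C zero zero) Cᵢᵢ⁻¹ ×
    IsInverse (block {2} {2} {k} {k} C (suc zero) (suc zero)) Cⱼⱼ⁻¹ ×
    rσ ≈ (fromℕ ρ * fromℕ d ⁻¹) * r + fromℕ (2 ℕ.* d) ⁻¹ * Tr (Cᵢᵢ⁻¹ +ᴹ Cⱼⱼ⁻¹)
theorem6p10 𝓡 G ρ k σ σ-sig 1≤ρ kernel τ τ-sig _ σ≅ι⊕τ i j i≢j =
  resistanceIdentity (ℕ.≤-trans 1≤ρ (ℕ.m≤m+n ρ k)) i≢j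
    (S.connectionLaplacian-pseudoinverse σ-sig kernel) (Scalar.L-pseudoinverse i)
    (S.harmonicExtension j) (S.harmonicExtension i) (T.green i j) (T.green j i)
  where
  open Assembly.Formula 𝓡 G σ-sig τ-sig σ≅ι⊕τ
  open Conductances.Conductance 𝓡 G using (module Scalar)
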